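{- There exists $n_0$ such that for every integer $n\ge n_0$ there exists an $r$-IPC$(n,n-1)$ for some integer $r \ge n^{0.0797}$.
   Context: For permutations $\sigma,\tau$ of $[n]=\{1,\dots,n\}$, the Hamming distance is the number of $x$ with $\sigma(x)\neq\tau(x)$. A permutation code PC$(n,d)$ is a subset of $\mathcal{S}_n$ in which any two distinct elements are at Hamming distance at least $d$. A permutation code is idempotent if each of its words has exactly one fixed point. An $r$-IPC$(n,n-1)$ is an idempotent PC$(n,n-1)$ on $[n]$ in which every symbol $i\in[n]$ is the fixed point of exactly $r$ words. -}

module Defs where

open import Data.Nat using (ℕ; _≤_; _∸_; _^_)
open import Data.Fin using (Fin; _≟_)
open import Data.Fin.Permutation using (Permutation′; _⟨$⟩ʳ_)
open import Data.List using (List; length; filter; allFin)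
open import Data.List.Relation.Unary.All using (All)
open import Data.List.Relation.Unary.AllPairs using (AllPairs)
open import Data.Product using (_×_)
open import Relation.Binary.PropositionalEquality using (_≡_)
open import Relation.Nullary using (¬_)
open import Relation.Nullary using (¬?)

hamming : ∀ {n} → Permutation′ n → Permutation′ n → ℕ
hamming {n} σ τ = length (filter (λ x → ¬? ((σ ⟨$⟩ʳ x) ≟ (τ ⟨$⟩ʳ x))) (allFin n))

fixCount : ∀ {n} → Permutation′ n → ℕ
fixCount {n} σ = length (filter (λ x → (σ ⟨$⟩ʳ x) ≟ x) (allFin n))

Distinct : ∀ {n} → Permutation′ n → Permutation′ n → Set
Distinct σ τ = ¬ (∀ x → σ ⟨$⟩ʳ x ≡ τ ⟨$⟩ʳ x)

-- A permutation code PC(n,d), given as a list of pairwise distinct words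
-- (i.e. a finite subset of S_n) with pairwise Hamming distance ≥ d.
IsPC : (n d : ℕ) → List (Permutation′ n) → Set
IsPC n d C = AllPairs (λ σ τ → Distinct σ τ × d ≤ hamming σ τ) C

Idempotent : ∀ {n} → List (Permutation′ n) → Set
Idempotent C = All (λ σ → fixCount σ ≡ 1) C

wordsFixing : ∀ {n} → List (Permutation′ n) → Fin n → ℕ
wordsFixing C i = length (filter (λ σ → (σ ⟨$⟩ʳ i) ≟ i) C)

IsRIPC : (r n : ℕ) → List (Permutation′ n) → Set
IsRIPC r n C = IsPC n (n ∸ 1) C × Idempotent C × (∀ (i : Fin n) → wordsFixing C i ≡ r)

{-# OPTIONS --safe #-}
module Submission where

-- A word is indexed by its fixed point c and a slope index a < r.  Over ℤ/N, for N without prime factors ≤ r + 1, the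
-- words x ↦ c + (a + 2)(x - c) form a code, and for large N a point ∞ can be adjoined.  For an odd prime k and r = k/2
-- there are similar words on the k² points of (ℤ/k)² and on (ℤ/k)² ∪ {∞}; gluing them along the lines of a transversal
-- design over ℤ/t gives length k² t + u whenever u ≤ t is one of the lengths N, N + 1 and t has no prime factor below k.
--
-- So the even one of n, n - 1 has to be written as k² t + N with t and N free of primes below k.  For k close to
-- n^(1/12.54) the variable t runs over an interval of length about n/k⁴ = k^8.54.  Brun's sieve of dimension 2, with
-- the 2j-th prime of a divisor kept below 2^(e j), e (j+1) ≈ 0.79 e j, uses divisors up to k^(1 + 2·0.79/0.21) < k^8.53,
-- and since ∑ 1/p over z^0.79 ≤ p < z tends to log(1/0.79) < 0.2375, it loses at most 25/28 of the main term.

open import Defs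
open import Data.Nat using (ℕ; zero; suc; _+_; _*_; _∸_; _^_; _≤_; _<_; _⊔_; _⊓_; _/_; _%_; _!; z≤n; s≤s; s≤s⁻¹; _≤?_; _<?_; NonZero; >-nonZero; >-nonZero⁻¹; nonTrivial⇒n>1)
open import Data.Nat.Properties
open import Data.Nat.DivMod using (m≡m%n+[m/n]*n; m%n<n; m<n⇒m%n≡m; [m+kn]%n≡m%n; m/n*n≤m; m*[n/m]≡n; m*n/n≡m; /-monoˡ-≤)
open import Data.Nat.Divisibility
open import Data.Nat.Primality using (Prime; prime?; euclidsLemma; prime⇒nonZero; prime⇒nonTrivial; prime⇒irreducible; ¬prime[0]; ¬prime[1]; prime[2])
open import Data.Nat.Primality.Factorisation using (factorise)
open import Data.Nat.Coprimality using (Coprime; coprime-divisor)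
import Data.Nat.Coprimality as Coprime
open import Data.Nat.Induction using (<-rec)
open import Data.Nat.Tactic.RingSolver using (solve-∀)
open import Data.Fin using (Fin)
open import Data.Fin.Permutation using (Permutation′)
open import Data.List using (List; []; _∷_)
open import Data.List.Relation.Unary.All using ([]; _∷_)
open import Data.Product using (Σ; ∃; _×_; _,_; proj₁; proj₂)
open import Data.Sum using (_⊎_; inj₁; inj₂; [_,_]′)
open import Data.Unit using (⊤; tt)
open import Data.Empty using (⊥; ⊥-elim)
open import Relation.Nullary using (¬_; ¬?; Dec; yes; no; contradiction; _×-dec_; _⊎-dec_)
open import Relation.Binary using (tri<; tri≈; tri>)
open import Relation.Binary.PropositionalEquality using (_≡_; _≢_; refl; sym; trans; cong; cong₂; subst; subst₂; setoid; module ≡-Reasoning)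

-- A slope s serves as a word only if s and s - 1 are cancellable, and two slopes are compatible
-- only if their difference is, so r words per symbol cost a length without small prime factors;
-- other lengths must be glued. A line of the design carries k² points, and one more if its gradient
-- lies in the truncated group at infinity, so both sizes need words compatible with the groups.
-- Over ℤ/N the point ∞ is adjoined by an argument that wants N of order 2 r³, hence not over ℤ/k
-- with r = k/2. Replacing every point of a line by k copies gives (ℤ/k)², whose k diagonals leave
-- two for each slope index: this is the origin of k² and of r = k/2.
--
-- The sum is made even because of the prime 2: with k odd, N then has the parity of t, the two
-- conditions coincide modulo 2, and one residue class survives.
--
-- The ratio ρ = 0.79 is a compromise. A larger ratio shrinks the loss of each sieve level but
-- lengthens the divisors, whose size is k to the power (1 + ρ)/(1 - ρ).

module PermutationCodes where

  open import Data.Integer using (ℤ; +_)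
  import Data.Integer as ℤ
  import Data.Integer.Properties as ℤ
  import Data.Integer.DivMod as ℤ
  import Data.Integer.Divisibility.Signed as ℤ
  open import Data.Integer.Tactic.RingSolver using () renaming (solve-∀ to ℤ-solve)
  open import Data.Bool using (Bool; true; false)
  open import Data.Fin using (toℕ; fromℕ<; inject≤; punchOut; zero; suc)
  import Data.Fin.Properties as Fin
  open import Data.Fin.Permutation using (permutation; _⟨$⟩ʳ_)
  open import Data.List using (length; map; filter; allFin; cartesianProduct)
  import Data.List.Properties as List
  import Data.List.Relation.Unary.All as All
  open import Data.List.Relation.Unary.All using (All)
  import Data.List.Relation.Unary.All.Properties as All
  open import Data.List.Relation.Unary.Any using (here; there)
  import Data.List.Relation.Unary.AllPairs as AllPairs
  open import Data.List.Relation.Unary.AllPairs using ([]; _∷_)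
  import Data.List.Relation.Unary.AllPairs.Properties as AllPairs
  open import Data.List.Relation.Unary.Unique.Propositional using (Unique)
  import Data.List.Relation.Unary.Unique.Propositional.Properties as Unique
  open import Data.List.Membership.Propositional using (_∈_)
  open import Data.List.Membership.Propositional.Properties using (∈-allFin; ∈-filter⁻)
  open import Data.Product using (uncurry)
  import Data.Product as Product
  import Data.Product.Properties as Product
  open import Data.Product.Function.NonDependent.Propositional using (_×-↔_)
  open import Data.Sum.Properties using (inj₁-injective; inj₂-injective)
  import Data.Sum.Properties as Sum
  open import Data.Sum.Function.Propositional using (_⊎-↔_)
  open import Function using (_∘_; id; _↔_; Inverse)
  open import Function.Properties.Inverse using (↔-sym; ↔-refl)
  open import Function.Construct.Composition using (_↔-∘_)
  open import Level using (0ℓ)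
  open import Relation.Unary using (Decidable; Pred)

  -- From codes indexed by fixed points to lists of permutations

  -- Indexing by the fixed point makes the count of r words per symbol part of the type. `agree` is
  -- distance n - 1 in contrapositive form: words agreeing at two different points have the same
  -- index.
  record Code (A : Set) (r : ℕ) : Set where
    field
      word      : A → Fin r → A → A
      fixed     : ∀ c a → word c a c ≡ c
      unique    : ∀ c a x → word c a x ≡ x → x ≡ c
      injective : ∀ c a {x y} → word c a x ≡ word c a y → x ≡ y
      agree     : ∀ c a c′ a′ x y → word c a x ≡ word c′ a′ x → word c a y ≡ word c′ a′ y →
                  x ≡ y ⊎ (c ≡ c′ × a ≡ a′)

  transport : ∀ {A B r} → A ↔ B → Code A r → Code B r
  transport {A} {B} {r} iso C = record
    { word = λ c a x → to (word (from c) a (from x))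
    ; fixed = λ c a → trans (cong to (fixed (from c) a)) (to-from c)
    ; unique = λ c a x e → from-inj (unique (from c) a (from x) (trans (sym (from-to _)) (cong from e)))
    ; injective = λ c a e → from-inj (injective (from c) a (to-inj e))
    ; agree = λ c a c′ a′ x y e e′ → back (agree (from c) a (from c′) a′ (from x) (from y) (to-inj e) (to-inj e′))
    }
    where
    open Code C
    open Inverse iso using (to; from; strictlyInverseˡ; strictlyInverseʳ)
    to-from : ∀ b → to (from b) ≡ b
    to-from = strictlyInverseˡ
    from-to : ∀ a → from (to a) ≡ a
    from-to = strictlyInverseʳ
    to-inj : ∀ {x y} → to x ≡ to y → x ≡ y
    to-inj e = trans (sym (from-to _)) (trans (cong from e) (from-to _))
    from-inj : ∀ {x y} → from x ≡ from y → x ≡ y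
    from-inj e = trans (sym (to-from _)) (trans (cong to e) (to-from _))
    back : ∀ {c c′ x y} {a a′ : Fin r} → from x ≡ from y ⊎ (from c ≡ from c′ × a ≡ a′) → x ≡ y ⊎ (c ≡ c′ × a ≡ a′)
    back (inj₁ e) = inj₁ (from-inj e)
    back (inj₂ (e , e′)) = inj₂ (from-inj e , e′)

  -- A missed value could be punched out of the codomain, embedding `suc n` points in `n`.
  injective⇒preimage : ∀ {n} (f : Fin n → Fin n) → (∀ {x y} → f x ≡ f y → x ≡ y) → ∀ y → ∃ λ x → f x ≡ y
  injective⇒preimage {suc n} f inj y with Fin.any? (λ x → f x Fin.≟ y)
  ... | yes p = p
  ... | no ¬p = ⊥-elim (1+n≰n (Fin.injective⇒≤ {f = λ x → punchOut (avoid x)}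
                  (λ {x} {z} e → inj (Fin.punchOut-injective (avoid x) (avoid z) e))))
    where
    avoid : ∀ x → y ≢ f x
    avoid x e = ¬p (x , sym e)

  injective⇒permutation : ∀ {n} (f : Fin n → Fin n) → (∀ {x y} → f x ≡ f y → x ≡ y) → Permutation′ n
  injective⇒permutation f inj = permutation f (proj₁ ∘ pre) (proj₂ ∘ pre) (λ x → inj (proj₂ (pre (f x))))
    where pre = injective⇒preimage f inj

  module _ {A : Set} where

    filter-¬-length : {P : Pred A 0ℓ} (P? : Decidable P) (xs : List A) →
      length (filter P? xs) + length (filter (¬? ∘ P?) xs) ≡ length xs
    filter-¬-length P? [] = refl
    filter-¬-length P? (x ∷ xs) with P? x
    ... | yes _ = cong suc (filter-¬-length P? xs)
    ... | no _ = trans (+-suc _ _) (cong suc (filter-¬-length P? xs))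

    subsingleton-length : ∀ {xs : List A} → Unique xs → (∀ {x y} → x ∈ xs → y ∈ xs → x ≡ y) → length xs ≤ 1
    subsingleton-length {[]} _ _ = z≤n
    subsingleton-length {x ∷ []} _ _ = s≤s z≤n
    subsingleton-length {x ∷ y ∷ xs} ((x≢y ∷ _) ∷ _) eq = contradiction (eq (here refl) (there (here refl))) x≢y

    filter-≡-length : {P : Pred A 0ℓ} (P? : Decidable P) {c : A} {xs : List A} → Unique xs → c ∈ xs →
      P c → (∀ x → P x → x ≡ c) → length (filter P? xs) ≡ 1
    filter-≡-length P? {c} {x ∷ xs} (x∉ ∷ _) (here refl) pc only =
      trans (cong length (List.filter-accept P? pc))
        (cong (suc ∘ length) (List.filter-none P? (All.map (λ c≢y py → c≢y (sym (only _ py))) x∉)))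
    filter-≡-length P? {c} {x ∷ xs} (x∉ ∷ u) (there c∈) pc only =
      trans (cong length (List.filter-reject P? (λ px → All.lookup x∉ c∈ (only x px))))
        (filter-≡-length P? u c∈ pc only)

    filter-map-length : {B : Set} {P : Pred B 0ℓ} (P? : Decidable P) (g : A → B) (xs : List A) →
      length (filter P? (map g xs)) ≡ length (filter (P? ∘ g) xs)
    filter-map-length P? g [] = refl
    filter-map-length P? g (x ∷ xs) with P? (g x)
    ... | yes _ = cong suc (filter-map-length P? g xs)
    ... | no _ = filter-map-length P? g xs

    filter-row-length : {B : Set} {P : Pred (A × B) 0ℓ} (P? : Decidable P) {c : A} {xs : List A} (ys : List B) →
      Unique xs → c ∈ xs → (∀ y → P (c , y)) → (∀ x y → P (x , y) → x ≡ c) →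
      length (filter P? (cartesianProduct xs ys)) ≡ length ys
    filter-row-length P? {c} {x ∷ xs} ys (x∉ ∷ u) c∈ pc only =
      trans (cong length (List.filter-++ P? (map (x ,_) ys) (cartesianProduct xs ys)))
        (trans (List.length-++ (filter P? (map (x ,_) ys))) (cases c∈))
      where
      none : ∀ {zs} → All (λ z → z ≢ c) zs → filter P? (cartesianProduct zs ys) ≡ []
      none {zs} ≢c = List.filter-none P? (All.cartesianProduct⁺ (setoid A) (setoid _) zs ys
        (λ {z} z∈ _ p → All.lookup ≢c z∈ (only z _ p)))
      cases : c ∈ x ∷ xs →
        length (filter P? (map (x ,_) ys)) + length (filter P? (cartesianProduct xs ys)) ≡ length ys
      cases (here refl) = trans (cong₂ _+_
        (trans (cong length (List.filter-all P? (All.map⁺ (All.universal pc ys)))) (List.length-map _ ys))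
        (cong length (none (All.map (λ ne e → ne (sym e)) x∉)))) (+-identityʳ _)
      cases (there c∈′) = cong₂ _+_
        (cong length (List.filter-none P? (All.map⁺ (All.universal (λ y p → All.lookup x∉ c∈′ (only x y p)) ys))))
        (filter-row-length P? ys u c∈′ pc only)

  code⇒IPC : ∀ {n r} → 2 ≤ n → Code (Fin n) r → Σ (List (Permutation′ n)) (IsRIPC r n)
  code⇒IPC {n} {r} 2≤n C = words , pc , All.map⁺ (All.universal fix1 _) , fixing
    where
    open Code C
    perm : Fin n → Fin r → Permutation′ n
    perm c a = injective⇒permutation (word c a) (injective c a)
    index : List (Fin n × Fin r)
    index = cartesianProduct (allFin n) (allFin r)
    words : List (Permutation′ n)
    words = map (uncurry perm) index
    far : ∀ {c a c′ a′} → (c , a) ≢ (c′ , a′) → Distinct (perm c a) (perm c′ a′) × n ∸ 1 ≤ hamming (perm c a) (perm c′ a′)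
    far {c} {a} {c′} {a′} ne = distinct , bound
      where
      same : ∀ {x y} → word c a x ≡ word c′ a′ x → word c a y ≡ word c′ a′ y → x ≡ y
      same {x} {y} e e′ with agree c a c′ a′ x y e e′
      ... | inj₁ x≡y = x≡y
      ... | inj₂ (p , q) = contradiction (cong₂ _,_ p q) ne
      distinct : Distinct (perm c a) (perm c′ a′)
      -- Equal words would agree at the points 0 and 1, which exist because `2 ≤ n`.
      distinct all = <⇒≢ (s≤s z≤n) (trans (sym (Fin.toℕ-fromℕ< _)) (trans
        (cong toℕ (same (all (fromℕ< {0} (≤-trans (s≤s z≤n) 2≤n))) (all (fromℕ< {1} 2≤n)))) (Fin.toℕ-fromℕ< _)))
      agree? : Decidable (λ x → word c a x ≡ word c′ a′ x)
      agree? x = word c a x Fin.≟ word c′ a′ x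
      few : length (filter agree? (allFin n)) ≤ 1
      few = subsingleton-length (Unique.filter⁺ agree? (Unique.allFin⁺ n))
        (λ x∈ y∈ → same (proj₂ (∈-filter⁻ agree? {xs = allFin n} x∈)) (proj₂ (∈-filter⁻ agree? {xs = allFin n} y∈)))
      bound : n ∸ 1 ≤ hamming (perm c a) (perm c′ a′)
      bound = m≤n+o⇒m∸n≤o n 1 (≤-trans (≤-reflexive (trans (sym (List.length-tabulate {n = n} id))
        (sym (filter-¬-length agree? (allFin n))))) (+-monoˡ-≤ _ few))
    pc : IsPC n (n ∸ 1) words
    pc = AllPairs.map⁺ (AllPairs.map far (Unique.cartesianProduct⁺ (Unique.allFin⁺ n) (Unique.allFin⁺ r)))
    fix1 : ∀ i → fixCount (uncurry perm i) ≡ 1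
    fix1 (c , a) = filter-≡-length (λ x → word c a x Fin.≟ x) (Unique.allFin⁺ n) (∈-allFin c) (fixed c a) (unique c a)
    fixing : ∀ i → wordsFixing words i ≡ r
    fixing i = trans (filter-map-length (λ σ → (σ ⟨$⟩ʳ i) Fin.≟ i) (uncurry perm) index)
      (trans (filter-row-length (λ ca → (uncurry perm ca ⟨$⟩ʳ i) Fin.≟ i) {c = i} (allFin r) (Unique.allFin⁺ n) (∈-allFin i)
        (fixed i) (λ c a e → sym (unique c a i e)))
        (List.length-tabulate id))

  -- Group divisible designs

  -- Group words act on the group of the centre, block words only off it. Centres in one group may
  -- share many blocks, so there `lw-agree⁰` forbids even a single agreement; for centres in
  -- different groups all agreements fall into one block, and `lw-agree¹` allows one.
  record GDDCode (A G B : Set) (r : ℕ) : Set₁ where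
    field
      _≟ᴳ_     : (g h : G) → Dec (g ≡ h)
      grp      : A → G
      On       : B → A → Set
      blk      : A → A → B
      blk-on   : ∀ c x → grp c ≢ grp x → On (blk c x) c × On (blk c x) x
      blk-uniq : ∀ {b b′} x y → grp x ≢ grp y → On b x → On b y → On b′ x → On b′ y → b ≡ b′
      gw       : A → Fin r → A → A
      gw-grp   : ∀ c a x → grp c ≡ grp x → grp (gw c a x) ≡ grp c
      gw-fixed : ∀ c a → gw c a c ≡ c
      gw-unique : ∀ c a x → grp c ≡ grp x → gw c a x ≡ x → x ≡ c
      gw-inj   : ∀ c a x y → grp c ≡ grp x → grp c ≡ grp y → gw c a x ≡ gw c a y → x ≡ y
      gw-agree : ∀ c a c′ a′ x y → grp c ≡ grp c′ → grp c ≡ grp x → grp c ≡ grp y →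
                 gw c a x ≡ gw c′ a′ x → gw c a y ≡ gw c′ a′ y → x ≡ y ⊎ (c ≡ c′ × a ≡ a′)
      lw       : B → A → Fin r → A → A
      lw-on    : ∀ b c a x → On b c → On b x → grp c ≢ grp x → On b (lw b c a x)
      lw-grpᶜ  : ∀ b c a x → On b c → On b x → grp c ≢ grp x → grp c ≢ grp (lw b c a x)
      lw-grpˣ  : ∀ b c a x → On b c → On b x → grp c ≢ grp x → grp x ≢ grp (lw b c a x)
      lw-inj   : ∀ b c a x y → On b c → On b x → On b y → grp c ≢ grp x → grp c ≢ grp y →
                 lw b c a x ≡ lw b c a y → x ≡ y
      lw-agree⁰ : ∀ b c a c′ a′ x → On b c → On b c′ → On b x → grp c ≡ grp c′ → grp c ≢ grp x →
                 lw b c a x ≡ lw b c′ a′ x → c ≡ c′ × a ≡ a′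
      lw-agree¹ : ∀ b c a c′ a′ x y → On b c → On b c′ → On b x → On b y → grp c ≢ grp c′ →
                 grp c ≢ grp x → grp c′ ≢ grp x → grp c ≢ grp y → grp c′ ≢ grp y →
                 lw b c a x ≡ lw b c′ a′ x → lw b c a y ≡ lw b c′ a′ y → x ≡ y

  -- The words of c permute its group by gw and every block through c by lw.  A value x ↦ z of a word with x
  -- outside the group of c determines the block through c and x, because x and z lie in different groups.
  gdd⇒code : ∀ {A G B r} → GDDCode A G B r → Code A r
  gdd⇒code {A} {G} {B} {r} D = record
    { word = word
    ; fixed = λ c a → trans (word-in refl) (gw-fixed c a)
    ; unique = unique
    ; injective = λ c a {x} {y} → injective c a x y
    ; agree = agree
    }
    where
    open GDDCode D
    word : A → Fin r → A → A
    word c a x with grp c ≟ᴳ grp x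
    ... | yes _ = gw c a x
    ... | no _ = lw (blk c x) c a x
    word-in : ∀ {c a x} → grp c ≡ grp x → word c a x ≡ gw c a x
    word-in {c} {a} {x} e with grp c ≟ᴳ grp x
    ... | yes _ = refl
    ... | no ne = contradiction e ne
    word-out : ∀ {c a x} → grp c ≢ grp x → word c a x ≡ lw (blk c x) c a x
    word-out {c} {a} {x} ne with grp c ≟ᴳ grp x
    ... | yes e = contradiction e ne
    ... | no _ = refl
    onᶜ : ∀ {c x} → grp c ≢ grp x → On (blk c x) c
    onᶜ ne = proj₁ (blk-on _ _ ne)
    onˣ : ∀ {c x} → grp c ≢ grp x → On (blk c x) x
    onˣ ne = proj₂ (blk-on _ _ ne)
    out-on : ∀ {c a x} → grp c ≢ grp x → On (blk c x) (word c a x)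
    out-on {c} {a} {x} ne = subst (On (blk c x)) (sym (word-out ne)) (lw-on _ c a x (onᶜ ne) (onˣ ne) ne)
    out-grpˣ : ∀ {c a x} → grp c ≢ grp x → grp x ≢ grp (word c a x)
    out-grpˣ {c} {a} {x} ne = subst (λ z → grp x ≢ grp z) (sym (word-out ne)) (lw-grpˣ _ c a x (onᶜ ne) (onˣ ne) ne)
    in-grp : ∀ {c a x} → grp c ≡ grp x → grp (word c a x) ≡ grp c
    in-grp {c} {a} {x} e = trans (cong grp (word-in e)) (gw-grp c a x e)
    unique : ∀ c a x → word c a x ≡ x → x ≡ c
    unique c a x e with grp c ≟ᴳ grp x
    ... | yes g = gw-unique c a x g e
    ... | no ne = contradiction (cong grp (sym e)) (lw-grpˣ _ c a x (onᶜ ne) (onˣ ne) ne)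
    injective : ∀ c a x y → word c a x ≡ word c a y → x ≡ y
    injective c a x y e with grp c ≟ᴳ grp x | grp c ≟ᴳ grp y
    ... | yes g | yes h = gw-inj c a x y g h e
    ... | yes g | no h = contradiction (trans (sym (gw-grp c a x g)) (cong grp e)) (lw-grpᶜ _ c a y (onᶜ h) (onˣ h) h)
    ... | no g | yes h = contradiction (trans (sym (gw-grp c a y h)) (cong grp (sym e))) (lw-grpᶜ _ c a x (onᶜ g) (onˣ g) g)
    ... | no g | no h = lw-inj (blk c x) c a x y (onᶜ g) (onˣ g) (subst (λ b → On b y) (sym same) (onˣ h)) g h
                          (trans e (cong (λ b → lw b c a y) (sym same)))
      where
      same : blk c x ≡ blk c y
      same = blk-uniq c _ (lw-grpᶜ _ c a x (onᶜ g) (onˣ g) g) (onᶜ g) (lw-on _ c a x (onᶜ g) (onˣ g) g)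
               (onᶜ h) (subst (On (blk c y)) (sym e) (lw-on _ c a y (onᶜ h) (onˣ h) h))
    agree-block : ∀ {c a c′ a′ x} → grp c ≢ grp x → grp c′ ≢ grp x → word c a x ≡ word c′ a′ x → blk c x ≡ blk c′ x
    agree-block {c} {a} {c′} {a′} {x} g h e = blk-uniq x _ (out-grpˣ {a = a} g) (onˣ g) (out-on g) (onˣ h)
      (subst (On (blk c′ x)) (sym e) (out-on h))
    agree-lw : ∀ {c a c′ a′ x} → grp c ≢ grp x → grp c′ ≢ grp x → word c a x ≡ word c′ a′ x →
      lw (blk c x) c a x ≡ lw (blk c x) c′ a′ x
    agree-lw {c} {a} {c′} {a′} {x} g h e = trans (sym (word-out g)) (trans e (trans (word-out h)
      (cong (λ b → lw b c′ a′ x) (sym (agree-block g h e)))))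
    agree : ∀ c a c′ a′ x y → word c a x ≡ word c′ a′ x → word c a y ≡ word c′ a′ y → x ≡ y ⊎ (c ≡ c′ × a ≡ a′)
    agree c a c′ a′ x y e e′ with grp c ≟ᴳ grp c′
    ... | yes cc′ = same (grp c ≟ᴳ grp x) (grp c ≟ᴳ grp y)
      where
      outside : ∀ z → grp c ≢ grp z → word c a z ≡ word c′ a′ z → c ≡ c′ × a ≡ a′
      outside z g ez = lw-agree⁰ (blk c z) c a c′ a′ z (onᶜ g) (subst (λ b → On b c′) (sym (agree-block g h ez)) (onᶜ h))
        (onˣ g) cc′ g (agree-lw g h ez)
        where
        h : grp c′ ≢ grp z
        h q = g (trans cc′ q)
      same : Dec (grp c ≡ grp x) → Dec (grp c ≡ grp y) → x ≡ y ⊎ (c ≡ c′ × a ≡ a′)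
      same (no g) _ = inj₂ (outside x g e)
      same (yes _) (no h) = inj₂ (outside y h e′)
      same (yes g) (yes h) = gw-agree c a c′ a′ x y cc′ g h
        (trans (sym (word-in g)) (trans e (word-in (trans (sym cc′) g))))
        (trans (sym (word-in h)) (trans e′ (word-in (trans (sym cc′) h))))
    -- Each agreement puts its point and both centres on one block. The centres lie in different
    -- groups and so determine this block, which is therefore the same for x and y.
    ... | no cc′ = inj₁ (lw-agree¹ (blk c x) c a c′ a′ x y (onᶜ gx) (c′-on x gx hx e) (onˣ gx)
                     (subst (λ b → On b y) (sym same) (onˣ gy)) cc′ gx hx gy hy (agree-lw gx hx e)
                     (subst (λ b → lw b c a y ≡ lw b c′ a′ y) (sym same) (agree-lw gy hy e′)))
      where
      -- Were z in the group of c, the word of c would keep it there, while the word of c′ moves z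
      -- out of its group.
      outˡ : ∀ {z} → word c a z ≡ word c′ a′ z → grp c ≢ grp z
      outˡ {z} ez g = out-grpˣ {c′} {a′} {z} (λ h → cc′ (trans g (sym h))) (trans (sym g) (trans (sym (in-grp g)) (cong grp ez)))
      outʳ : ∀ {z} → word c a z ≡ word c′ a′ z → grp c′ ≢ grp z
      outʳ {z} ez h = out-grpˣ {c} {a} {z} (λ g → cc′ (trans g (sym h))) (trans (sym h) (trans (sym (in-grp h)) (cong grp (sym ez))))
      gx = outˡ e
      hx = outʳ e
      gy = outˡ e′
      hy = outʳ e′
      c′-on : ∀ z → grp c ≢ grp z → grp c′ ≢ grp z → word c a z ≡ word c′ a′ z → On (blk c z) c′
      c′-on z g h ez = subst (λ b → On b c′) (sym (agree-block g h ez)) (onᶜ h)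
      same : blk c x ≡ blk c y
      same = blk-uniq c c′ cc′ (onᶜ gx) (c′-on x gx hx e) (onᶜ gy) (c′-on y gy hy e′)

  -- Arithmetic modulo n

  ⟦_⟧ : ∀ {n} → Fin n → ℤ
  ⟦ x ⟧ = + toℕ x

  ∣-scale : ∀ {n a b} q → n ℤ.∣ a → b ≡ q ℤ.* a → n ℤ.∣ b
  ∣-scale q n∣a refl = ℤ.∣n⇒∣m*n q n∣a

  ∣-combine : ∀ {n a a′ b} q q′ → n ℤ.∣ a → n ℤ.∣ a′ → b ≡ q ℤ.* a ℤ.+ q′ ℤ.* a′ → n ℤ.∣ b
  ∣-combine q q′ n∣a n∣a′ refl = ℤ.∣m∣n⇒∣m+n (ℤ.∣n⇒∣m*n q n∣a) (ℤ.∣n⇒∣m*n q′ n∣a′)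

  telescope : ∀ x z w → x ℤ.- w ≡ + 1 ℤ.* (x ℤ.- z) ℤ.+ + 1 ℤ.* (z ℤ.- w)
  telescope = ℤ-solve

  diff-bounds : ∀ {m n K} → m ≢ n → m < K → n < K → 0 < ℤ.∣ + m ℤ.- + n ∣ × ℤ.∣ + m ℤ.- + n ∣ < K
  diff-bounds {m} {n} {K} m≢n m<K n<K = positive , below (≤-total m n)
    where
    positive : 0 < ℤ.∣ + m ℤ.- + n ∣
    positive = n≢0⇒n>0 (λ e → m≢n (ℤ.+-injective (ℤ.i-j≡0⇒i≡j (+ m) (+ n) (ℤ.∣i∣≡0⇒i≡0 e))))
    below : m ≤ n ⊎ n ≤ m → ℤ.∣ + m ℤ.- + n ∣ < K
    below (inj₁ m≤n) = ≤-<-trans (≤-reflexive (trans (ℤ.∣i-j∣≡∣j-i∣ (+ m) (+ n))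
      (trans (cong ℤ.∣_∣ (ℤ.m-n≡m⊖n n m)) (cong ℤ.∣_∣ (ℤ.⊖-≥ m≤n))))) (≤-<-trans (m∸n≤m n m) n<K)
    below (inj₂ n≤m) = ≤-<-trans (≤-reflexive (trans (cong ℤ.∣_∣ (ℤ.m-n≡m⊖n m n)) (cong ℤ.∣_∣ (ℤ.⊖-≥ n≤m))))
      (≤-<-trans (m∸n≤m m n) m<K)

  -- Invertibility modulo n in the form of cancellation: the uniqueness claims below all reduce to a
  -- unit times a difference being divisible by n.
  record Unit (n : ℕ) (z : ℤ) : Set where
    field cancel : ∀ w → + n ℤ.∣ z ℤ.* w → + n ℤ.∣ w
  open Unit

  CoprimeBelow : ℕ → ℕ → Set
  CoprimeBelow k n = ∀ m → 0 < m → m < k → Coprime n m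

  unit : ∀ {k n} → CoprimeBelow k n → ∀ z → 0 < ℤ.∣ z ∣ → ℤ.∣ z ∣ < k → Unit n z
  cancel (unit {k} {n} rough z 0<z z<k) w n∣zw = ℤ.∣ᵤ⇒∣ (coprime-divisor (rough _ 0<z z<k)
    (subst (n ∣_) (ℤ.∣i*j∣≡∣i∣*∣j∣ z w) (ℤ.∣⇒∣ᵤ n∣zw)))

  module _ {n : ℕ} .{{_ : NonZero n}} where

    opaque
      residue : ℤ → Fin n
      residue z = fromℕ< (ℤ.n%ℕd<d z n)

      ⟦residue⟧ : ∀ z → + n ℤ.∣ ⟦ residue z ⟧ ℤ.- z
      ⟦residue⟧ z = ℤ.divides (ℤ.- (z ℤ./ℕ n)) (trans (cong (λ t → + t ℤ.- z) (Fin.toℕ-fromℕ< _)) (trans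
        (cong (λ t → + (z ℤ.%ℕ n) ℤ.- t) (ℤ.a≡a%ℕn+[a/ℕn]*n z n)) (identity (+ (z ℤ.%ℕ n)) (z ℤ./ℕ n) (+ n))))
        where
        identity : ∀ a b c → a ℤ.- (a ℤ.+ b ℤ.* c) ≡ (ℤ.- b) ℤ.* c
        identity = ℤ-solve

    ≈⇒≡ : ∀ {x y : Fin n} → + n ℤ.∣ ⟦ x ⟧ ℤ.- ⟦ y ⟧ → x ≡ y
    ≈⇒≡ {x} {y} n∣ with x Fin.≟ y
    ... | yes e = e
    ... | no ne = contradiction (∣⇒≤ {{>-nonZero (proj₁ b)}} (ℤ.∣⇒∣ᵤ n∣)) (<⇒≱ (proj₂ b))
      where
      b : 0 < ℤ.∣ ⟦ x ⟧ ℤ.- ⟦ y ⟧ ∣ × ℤ.∣ ⟦ x ⟧ ℤ.- ⟦ y ⟧ ∣ < n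
      b = diff-bounds (λ e → ne (Fin.toℕ-injective e)) (Fin.toℕ<n x) (Fin.toℕ<n y)

    residue-≈ : ∀ {z w} → residue z ≡ residue w → + n ℤ.∣ z ℤ.- w
    residue-≈ {z} {w} e = ∣-combine (ℤ.- (+ 1)) (+ 1) (⟦residue⟧ z) (subst (λ x → + n ℤ.∣ ⟦ x ⟧ ℤ.- w) (sym e) (⟦residue⟧ w))
      (identity z w ⟦ residue z ⟧)
      where
      identity : ∀ z w x → z ℤ.- w ≡ (ℤ.- (+ 1)) ℤ.* (x ℤ.- z) ℤ.+ + 1 ℤ.* (x ℤ.- w)
      identity = ℤ-solve

    residue-⟦⟧ : ∀ {z} {x : Fin n} → residue z ≡ x → + n ℤ.∣ z ℤ.- ⟦ x ⟧
    residue-⟦⟧ {z} refl = ∣-scale (ℤ.- (+ 1)) (⟦residue⟧ z) (identity z ⟦ residue z ⟧)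
      where
      identity : ∀ z x → z ℤ.- x ≡ (ℤ.- (+ 1)) ℤ.* (x ℤ.- z)
      identity = ℤ-solve

    ⟦⟧-residue : ∀ {z} {x : Fin n} → + n ℤ.∣ z ℤ.- ⟦ x ⟧ → residue z ≡ x
    ⟦⟧-residue {z} {x} n∣ = ≈⇒≡ (∣-combine (+ 1) (+ 1) (⟦residue⟧ z) n∣ (telescope ⟦ residue z ⟧ z ⟦ x ⟧))

    -- Cancellation makes multiplication by z injective on `Fin n`, hence surjective.
    unit-solve : ∀ {z} → Unit n z → ∀ w → ∃ λ (e : Fin n) → + n ℤ.∣ z ℤ.* ⟦ e ⟧ ℤ.- w
    unit-solve {z} u w = proj₁ pre , ∣-combine (+ 1) (+ 1) (residue-⟦⟧ (proj₂ pre)) (⟦residue⟧ w)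
        (telescope (z ℤ.* ⟦ proj₁ pre ⟧) ⟦ residue w ⟧ w)
      where
      identity : ∀ z x y → z ℤ.* (x ℤ.- y) ≡ z ℤ.* x ℤ.- z ℤ.* y
      identity = ℤ-solve
      pre : ∃ λ e → residue (z ℤ.* ⟦ e ⟧) ≡ residue w
      pre = injective⇒preimage (λ e → residue (z ℤ.* ⟦ e ⟧))
        (λ {x} {y} e → ≈⇒≡ (cancel u _ (subst (+ n ℤ.∣_) (sym (identity z ⟦ x ⟧ ⟦ y ⟧)) (residue-≈ e)))) (residue w)

    opaque
      affine : ℤ → Fin n → Fin n → Fin n
      affine s c x = residue (⟦ c ⟧ ℤ.+ s ℤ.* (⟦ x ⟧ ℤ.- ⟦ c ⟧))

      affine-residue : ∀ s c x → affine s c x ≡ residue (⟦ c ⟧ ℤ.+ s ℤ.* (⟦ x ⟧ ℤ.- ⟦ c ⟧))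
      affine-residue s c x = refl

      affine-fixed : ∀ s c → affine s c c ≡ c
      affine-fixed s c = ⟦⟧-residue (ℤ.divides (+ 0) (identity s ⟦ c ⟧))
        where
        identity : ∀ s c → c ℤ.+ s ℤ.* (c ℤ.- c) ℤ.- c ≡ + 0
        identity = ℤ-solve

      affine-unique : ∀ {s} → Unit n (s ℤ.- + 1) → ∀ {c x} → affine s c x ≡ x → x ≡ c
      affine-unique {s} u {c} {x} e = ≈⇒≡ (cancel u _ (∣-scale (+ 1) (residue-⟦⟧ e) (identity s ⟦ c ⟧ ⟦ x ⟧)))
        where
        identity : ∀ s c x → (s ℤ.- + 1) ℤ.* (x ℤ.- c) ≡ + 1 ℤ.* (c ℤ.+ s ℤ.* (x ℤ.- c) ℤ.- x)
        identity = ℤ-solve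

      affine-avoid : ∀ {s} → Unit n s → ∀ {c x} → affine s c x ≡ c → x ≡ c
      affine-avoid {s} u {c} {x} e = ≈⇒≡ (cancel u _ (∣-scale (+ 1) (residue-⟦⟧ e) (identity s ⟦ c ⟧ ⟦ x ⟧)))
        where
        identity : ∀ s c x → s ℤ.* (x ℤ.- c) ≡ + 1 ℤ.* (c ℤ.+ s ℤ.* (x ℤ.- c) ℤ.- c)
        identity = ℤ-solve

      affine-injective : ∀ {s} → Unit n s → ∀ {c x y} → affine s c x ≡ affine s c y → x ≡ y
      affine-injective {s} u {c} {x} {y} e = ≈⇒≡ (cancel u _ (∣-scale (+ 1) (residue-≈ e) (identity s ⟦ c ⟧ ⟦ x ⟧ ⟦ y ⟧)))
        where
        identity : ∀ s c x y → s ℤ.* (x ℤ.- y) ≡ + 1 ℤ.* (c ℤ.+ s ℤ.* (x ℤ.- c) ℤ.- (c ℤ.+ s ℤ.* (y ℤ.- c)))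
        identity = ℤ-solve

      affine-slopes : ∀ {s s′} → Unit n (s ℤ.- s′) → ∀ {c c′ x y} →
        affine s c x ≡ affine s′ c′ x → affine s c y ≡ affine s′ c′ y → x ≡ y
      affine-slopes {s} {s′} u {c} {c′} {x} {y} e e′ = ≈⇒≡ (cancel u _ (∣-combine (+ 1) (ℤ.- (+ 1)) (residue-≈ e) (residue-≈ e′)
          (identity s s′ ⟦ c ⟧ ⟦ c′ ⟧ ⟦ x ⟧ ⟦ y ⟧)))
        where
        identity : ∀ s s′ c c′ x y → (s ℤ.- s′) ℤ.* (x ℤ.- y) ≡
          + 1 ℤ.* (c ℤ.+ s ℤ.* (x ℤ.- c) ℤ.- (c′ ℤ.+ s′ ℤ.* (x ℤ.- c′))) ℤ.+
          (ℤ.- (+ 1)) ℤ.* (c ℤ.+ s ℤ.* (y ℤ.- c) ℤ.- (c′ ℤ.+ s′ ℤ.* (y ℤ.- c′)))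
        identity = ℤ-solve

      -- For fixed s and x the value s x + (1 - s) c is affine in c with slope 1 - s, so words of
      -- equal slope and different centres never meet.
      affine-centre : ∀ {s} → Unit n (s ℤ.- + 1) → ∀ {c c′ x} → affine s c x ≡ affine s c′ x → c ≡ c′
      affine-centre {s} u {c} {c′} {x} e = ≈⇒≡ (cancel u _ (∣-scale (ℤ.- (+ 1)) (residue-≈ e) (identity s ⟦ c ⟧ ⟦ c′ ⟧ ⟦ x ⟧)))
        where
        identity : ∀ s c c′ x → (s ℤ.- + 1) ℤ.* (c ℤ.- c′) ≡
          (ℤ.- (+ 1)) ℤ.* (c ℤ.+ s ℤ.* (x ℤ.- c) ℤ.- (c′ ℤ.+ s ℤ.* (x ℤ.- c′)))
        identity = ℤ-solve

  slope : ∀ {r} → ℕ → Fin r → ℤ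
  slope d a = + (toℕ a + d)

  module Slopes {k n r : ℕ} (rough : CoprimeBelow k n) (d : ℕ) (d+r≤k : d + r ≤ k) where
    private
      bound : ∀ (a : Fin r) → toℕ a + d < k
      bound a = <-≤-trans (+-monoˡ-< d (Fin.toℕ<n a)) (≤-trans (≤-reflexive (+-comm r d)) d+r≤k)

    slope-unit : 0 < d → ∀ a → Unit n (slope d a)
    slope-unit 0<d a = unit rough (slope d a) (<-≤-trans 0<d (m≤n+m d (toℕ a))) (bound a)

    slope-1-unit : 1 < d → ∀ a → Unit n (slope d a ℤ.- + 1)
    slope-1-unit 1<d a = unit rough _ (proj₁ b) (proj₂ b)
      where
      b : 0 < ℤ.∣ slope d a ℤ.- + 1 ∣ × ℤ.∣ slope d a ℤ.- + 1 ∣ < k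
      b = diff-bounds (>⇒≢ (<-≤-trans 1<d (m≤n+m d (toℕ a)))) (bound a)
        (<-≤-trans 1<d (≤-trans (m≤m+n d r) d+r≤k))

    slopes-unit : ∀ {a a′} → a ≢ a′ → Unit n (slope d a ℤ.- slope d a′)
    slopes-unit {a} {a′} a≢ = unit rough _ (proj₁ b) (proj₂ b)
      where
      b : 0 < ℤ.∣ slope d a ℤ.- slope d a′ ∣ × ℤ.∣ slope d a ℤ.- slope d a′ ∣ < k
      b = diff-bounds (λ e → a≢ (Fin.toℕ-injective (+-cancelʳ-≡ d _ _ e))) (bound a) (bound a′)

  -- Slopes start at 2 because slope 0 is constant and slope 1 is the identity; `2 + r ≤ k` keeps
  -- the slopes and their differences below k.
  affineCode : ∀ {k n r} .{{_ : NonZero n}} → CoprimeBelow k n → 2 + r ≤ k → Code (Fin n) r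
  affineCode {k} {n} {r} rough 2+r≤k = record
    { word = λ c a → affine (slope 2 a) c
    ; fixed = λ c a → affine-fixed (slope 2 a) c
    ; unique = λ c a x → affine-unique (slope-1-unit (s≤s (s≤s z≤n)) a)
    ; injective = λ c a → affine-injective (slope-unit (s≤s z≤n) a)
    ; agree = agree
    }
    where
    open Slopes rough 2 2+r≤k
    agree : ∀ c a c′ a′ x y → affine (slope 2 a) c x ≡ affine (slope 2 a′) c′ x →
      affine (slope 2 a) c y ≡ affine (slope 2 a′) c′ y → x ≡ y ⊎ (c ≡ c′ × a ≡ a′)
    agree c a c′ a′ x y e e′ with a Fin.≟ a′
    ... | yes refl = inj₂ (affine-centre (slope-1-unit (s≤s (s≤s z≤n)) a) e , refl)
    ... | no a≢ = inj₁ (affine-slopes (slopes-unit a≢) e e′)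

  -- Adjoining a point

  -- The words of the given code fall into r parallel classes; the word of (c , a) is modified at one point ch c a, as
  -- ch c a ↦ ∞ ↦ img c a.  Words of different classes must use different points and images; words of
  -- one class meet nowhere before the modification, so at most once after it.
  module Extension {X : Set} {r : ℕ} (_≟_ : (x y : X) → Dec (x ≡ y)) (base : Code X r)
    (parallel : ∀ {c c′ a x} → Code.word base c a x ≡ Code.word base c′ a x → c ≡ c′)
    (sh : Fin r → X → X)
    (sh-moves : ∀ a x → sh a x ≢ x)
    (sh-injective : ∀ a {x y} → sh a x ≡ sh a y → x ≡ y)
    (sh-distinct : ∀ {a a′ x} → sh a x ≡ sh a′ x → a ≡ a′)
    (sh-agree : ∀ {a c a′ x y} → sh a x ≡ Code.word base c a′ x → sh a y ≡ Code.word base c a′ y → x ≡ y)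
    (ch : X → Fin r → X)
    (ch≢ : ∀ c a → ch c a ≢ c)
    (ch-class : ∀ {c a c′ a′} → ch c a ≡ ch c′ a′ → a ≡ a′)
    (img-class : ∀ {c a c′ a′} → Code.word base c a (ch c a) ≡ Code.word base c′ a′ (ch c′ a′) → a ≡ a′)
    where

    open Code base

    X⁺ : Set
    X⁺ = X ⊎ Fin 1

    pattern ∞ = inj₂ zero

    img : X → Fin r → X
    img c a = word c a (ch c a)

    data Agreement (c : X) (a : Fin r) (c′ : X) (a′ : Fin r) : X⁺ → Set where
      chosen  : ∀ {x} → x ≡ ch c a → x ≡ ch c′ a′ → Agreement c a c′ a′ (inj₁ x)
      regular : ∀ {x} → word c a x ≡ word c′ a′ x → Agreement c a c′ a′ (inj₁ x)
      added   : img c a ≡ img c′ a′ → Agreement c a c′ a′ ∞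

    -- An agreement at a modified point or at ∞ forces a = a′, by `ch-class` or `img-class`. Words
    -- of one class are parallel, so an agreement of any other kind then forces c = c′.
    agreement-class : ∀ {c a c′ a′ x y} → Agreement c a c′ a′ x → Agreement c a c′ a′ y → x ≡ y ⊎ (c ≡ c′ × a ≡ a′)
    agreement-class (chosen p q) s with refl ← ch-class (trans (sym p) q) | s
    ... | chosen p′ _ = inj₁ (cong inj₁ (trans p (sym p′)))
    ... | regular e = inj₂ (parallel e , refl)
    ... | added e = inj₂ (parallel (trans (cong (word _ _) p) (trans e (cong (word _ _) (sym q)))) , refl)
    agreement-class (added e) s with refl ← img-class e | s
    ... | chosen p q = inj₂ (parallel (trans (cong (word _ _) p) (trans e (cong (word _ _) (sym q)))) , refl)
    ... | regular e′ = inj₂ (parallel e′ , refl)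
    ... | added _ = inj₁ refl
    agreement-class (regular e) (regular e′) with agree _ _ _ _ _ _ e e′
    ... | inj₁ p = inj₁ (cong inj₁ p)
    ... | inj₂ p = inj₂ p
    agreement-class (regular e) (chosen p q) with refl ← ch-class (trans (sym p) q) = inj₂ (parallel e , refl)
    agreement-class (regular e) (added e′) with refl ← img-class e′ = inj₂ (parallel e , refl)

    opaque
      word⁺ : X⁺ → Fin r → X⁺ → X⁺
      word⁺ (inj₁ c) a (inj₁ x) with x ≟ ch c a
      ... | yes _ = ∞
      ... | no _ = inj₁ (word c a x)
      word⁺ (inj₁ c) a ∞ = inj₁ (img c a)
      word⁺ ∞ a (inj₁ x) = inj₁ (sh a x)
      word⁺ ∞ a ∞ = ∞

      word⁺-reg : ∀ {c a x y} → word⁺ (inj₁ c) a (inj₁ x) ≡ inj₁ y → x ≢ ch c a × word c a x ≡ y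
      word⁺-reg {c} {a} {x} e with x ≟ ch c a
      word⁺-reg () | yes _
      word⁺-reg refl | no p = p , refl

      word⁺-added : ∀ c a → word⁺ (inj₁ c) a ∞ ≡ inj₁ (img c a)
      word⁺-added c a = refl

      word⁺-shift : ∀ a x → word⁺ ∞ a (inj₁ x) ≡ inj₁ (sh a x)
      word⁺-shift a x = refl

      word⁺-cases : ∀ c a x → word⁺ (inj₁ c) a (inj₁ x) ≡ ∞ ⊎ word⁺ (inj₁ c) a (inj₁ x) ≡ inj₁ (word c a x)
      word⁺-cases c a x with x ≟ ch c a
      ... | yes _ = inj₁ refl
      ... | no _ = inj₂ refl

      agreement : ∀ c a c′ a′ x → word⁺ (inj₁ c) a x ≡ word⁺ (inj₁ c′) a′ x → Agreement c a c′ a′ x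
      agreement c a c′ a′ ∞ e = added (inj₁-injective e)
      agreement c a c′ a′ (inj₁ x) e with x ≟ ch c a | x ≟ ch c′ a′
      ... | yes p | yes q = chosen p q
      ... | no _ | no _ = regular (inj₁-injective e)
      agreement c a c′ a′ (inj₁ x) () | yes _ | no _
      agreement c a c′ a′ (inj₁ x) () | no _ | yes _

      fixed⁺ : ∀ c a → word⁺ c a c ≡ c
      fixed⁺ (inj₁ c) a with c ≟ ch c a
      ... | yes e = contradiction (sym e) (ch≢ c a)
      ... | no _ = cong inj₁ (fixed c a)
      fixed⁺ ∞ a = refl
      unique⁺ : ∀ c a x → word⁺ c a x ≡ x → x ≡ c
      unique⁺ (inj₁ c) a (inj₁ x) e = cong inj₁ (unique c a x (proj₂ (word⁺-reg e)))
      unique⁺ (inj₁ c) a ∞ ()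
      unique⁺ ∞ a (inj₁ x) e = contradiction (inj₁-injective e) (sh-moves a x)
      unique⁺ ∞ a ∞ e = refl
      injective⁺ : ∀ c a x y → word⁺ c a x ≡ word⁺ c a y → x ≡ y
      injective⁺ (inj₁ c) a (inj₁ x) (inj₁ y) e with x ≟ ch c a | y ≟ ch c a
      ... | yes p | yes q = cong inj₁ (trans p (sym q))
      ... | no _ | no _ = cong inj₁ (injective c a (inj₁-injective e))
      injective⁺ (inj₁ c) a (inj₁ x) (inj₁ y) () | yes _ | no _
      injective⁺ (inj₁ c) a (inj₁ x) (inj₁ y) () | no _ | yes _
      injective⁺ (inj₁ c) a (inj₁ x) ∞ e with p , q ← word⁺-reg e = contradiction (injective c a q) p
      injective⁺ (inj₁ c) a ∞ (inj₁ y) e with p , q ← word⁺-reg (sym e) = contradiction (injective c a q) p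
      injective⁺ (inj₁ c) a ∞ ∞ e = refl
      injective⁺ ∞ a (inj₁ x) (inj₁ y) e = cong inj₁ (sh-injective a (inj₁-injective e))
      injective⁺ ∞ a ∞ ∞ e = refl
      injective⁺ ∞ a (inj₁ x) ∞ ()
      injective⁺ ∞ a ∞ (inj₁ y) ()
      mixed : ∀ c a a′ x y → word⁺ ∞ a x ≡ word⁺ (inj₁ c) a′ x → word⁺ ∞ a y ≡ word⁺ (inj₁ c) a′ y → x ≡ y
      mixed c a a′ (inj₁ x) (inj₁ y) e e′ = cong inj₁ (sh-agree (sym (proj₂ (word⁺-reg (sym e)))) (sym (proj₂ (word⁺-reg (sym e′)))))
      mixed c a a′ ∞ y () e′
      mixed c a a′ (inj₁ x) ∞ e ()
      agree⁺ : ∀ c a c′ a′ x y → word⁺ c a x ≡ word⁺ c′ a′ x → word⁺ c a y ≡ word⁺ c′ a′ y → x ≡ y ⊎ (c ≡ c′ × a ≡ a′)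
      agree⁺ (inj₁ c) a (inj₁ c′) a′ x y e e′ with agreement-class (agreement c a c′ a′ x e) (agreement c a c′ a′ y e′)
      ... | inj₁ p = inj₁ p
      ... | inj₂ (p , q) = inj₂ (cong inj₁ p , q)
      agree⁺ (inj₁ c) a ∞ a′ x y e e′ = inj₁ (mixed c a′ a x y (sym e) (sym e′))
      agree⁺ ∞ a (inj₁ c′) a′ x y e e′ = inj₁ (mixed c′ a a′ x y e e′)
      agree⁺ ∞ a ∞ a′ (inj₁ x) y e e′ = inj₂ (refl , sh-distinct (inj₁-injective e))
      agree⁺ ∞ a ∞ a′ ∞ (inj₁ y) e e′ = inj₂ (refl , sh-distinct (inj₁-injective e′))
      agree⁺ ∞ a ∞ a′ ∞ ∞ e e′ = inj₁ refl

    extended : Code X⁺ r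
    extended = record
      { word = word⁺
      ; fixed = fixed⁺
      ; unique = unique⁺
      ; injective = λ c a {x} {y} → injective⁺ c a x y
      ; agree = agree⁺
      }

  -- The words with fixed point ∞ are the translations by 1, ..., r: they fix no finite point, never
  -- agree with one another there, and meet an affine map of slope s at most once because s - 1 is
  -- cancellable.
  module Shift {n r : ℕ} .{{_ : NonZero n}} (r<n : r < n) where

    opaque
      shift : Fin r → Fin n → Fin n
      shift a x = residue (⟦ x ⟧ ℤ.+ + suc (toℕ a))

      shift-moves : ∀ a x → shift a x ≢ x
      shift-moves a x e = <⇒≱ (≤-<-trans (Fin.toℕ<n a) r<n) (∣⇒≤ (ℤ.∣⇒∣ᵤ (∣-scale (+ 1) (residue-⟦⟧ e)
          (identity ⟦ x ⟧ (+ suc (toℕ a))))))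
        where
        identity : ∀ x s → s ≡ + 1 ℤ.* (x ℤ.+ s ℤ.- x)
        identity = ℤ-solve

      shift-injective : ∀ a {x y} → shift a x ≡ shift a y → x ≡ y
      shift-injective a {x} {y} e = ≈⇒≡ (∣-scale (+ 1) (residue-≈ e) (identity ⟦ x ⟧ ⟦ y ⟧ (+ suc (toℕ a))))
        where
        identity : ∀ x y s → x ℤ.- y ≡ + 1 ℤ.* (x ℤ.+ s ℤ.- (y ℤ.+ s))
        identity = ℤ-solve

      shift-distinct : ∀ {a a′ x} → shift a x ≡ shift a′ x → a ≡ a′
      shift-distinct {a} {a′} {x} e with a Fin.≟ a′
      ... | yes p = p
      ... | no a≢ = contradiction (∣⇒≤ {{>-nonZero (proj₁ b)}} (ℤ.∣⇒∣ᵤ (∣-scale (+ 1) (residue-≈ e)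
                      (identity ⟦ x ⟧ (+ suc (toℕ a)) (+ suc (toℕ a′)))))) (<⇒≱ (proj₂ b))
        where
        identity : ∀ x s s′ → s ℤ.- s′ ≡ + 1 ℤ.* (x ℤ.+ s ℤ.- (x ℤ.+ s′))
        identity = ℤ-solve
        b : 0 < ℤ.∣ + suc (toℕ a) ℤ.- + suc (toℕ a′) ∣ × ℤ.∣ + suc (toℕ a) ℤ.- + suc (toℕ a′) ∣ < n
        b = diff-bounds (λ e → a≢ (Fin.toℕ-injective (suc-injective e)))
          (≤-<-trans (Fin.toℕ<n a) r<n) (≤-<-trans (Fin.toℕ<n a′) r<n)

      shift-affine : ∀ {s} → Unit n (s ℤ.- + 1) → ∀ {a c x y} → shift a x ≡ affine s c x → shift a y ≡ affine s c y → x ≡ y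
      shift-affine {s} u {a} {c} {x} {y} e e′ = ≈⇒≡ (Unit.cancel u _ (∣-combine (ℤ.- (+ 1)) (+ 1)
          (residue-≈ (trans e (affine-residue s c x)))
          (residue-≈ (trans e′ (affine-residue s c y))) (identity s ⟦ c ⟧ ⟦ x ⟧ ⟦ y ⟧ (+ suc (toℕ a)))))
        where
        identity : ∀ s c x y t → (s ℤ.- + 1) ℤ.* (x ℤ.- y) ≡ (ℤ.- (+ 1)) ℤ.* (x ℤ.+ t ℤ.- (c ℤ.+ s ℤ.* (x ℤ.- c))) ℤ.+
          + 1 ℤ.* (y ℤ.+ t ℤ.- (c ℤ.+ s ℤ.* (y ℤ.- c)))
        identity = ℤ-solve

  interval-disjoint : ∀ {W y m n} → m * W ≤ y → y < suc m * W → n * W ≤ y → y < suc n * W → m ≡ n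
  interval-disjoint {W} {y} {m} {n} m≤ <m n≤ <n with <-cmp m n
  ... | tri< m<n _ _ = contradiction (≤-trans (*-monoˡ-≤ W m<n) n≤) (<⇒≱ <m)
  ... | tri≈ _ m≡n _ = m≡n
  ... | tri> _ _ n<m = contradiction (≤-trans (*-monoˡ-≤ W n<m) m≤) (<⇒≱ <n)

  -- Classes for the extension of ℤ/N: the points used by slope index a are ≡ a mod g, their images lie in
  -- [aW, (a+1)W).  Along the progression the image advances by less than W/2, so it meets the interval twice.
  module PointChoice {k N r : ℕ} .{{_ : NonZero N}} (rough : CoprimeBelow k N) (2+r≤k : 2 + r ≤ k)
    (g W : ℕ) .{{_ : NonZero g}} (2+r≤g : 2 + r ≤ g) (2g²≤W : 2 * (g * g) ≤ W) (r<N : r < N) (rW≤N : r * W ≤ N) where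

    Good : Fin N → Fin r → Fin N → Set
    Good c a x = (∃ λ p → toℕ x ≡ toℕ a + p * g) ×
      (toℕ a * W ≤ toℕ (affine (slope 2 a) c x) × toℕ (affine (slope 2 a) c x) < suc (toℕ a) * W)

    module _ (c : Fin N) (a : Fin r) where
      private
        -- Modulo N the word sends x to s x + b, where b ≡ (1 - s) c. On x = al + p g this integer
        -- starts at F₀ and grows by m = s g per step. T is the left end of the target interval
        -- moved up by N, which ensures F₀ ≤ T. Steps q + 1 and q + 2 reach T and pass it by at most
        -- 2 m < 2 g² ≤ W.
        al s m b T F₀ D q : ℕ
        al = toℕ a
        s = al + 2
        m = s * g
        b = toℕ (residue {N} (ℤ.- ((+ s ℤ.- + 1) ℤ.* ⟦ c ⟧)))
        T = N + al * W
        F₀ = s * al + b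
        D = T ∸ F₀
        instance
          m≢0 : NonZero m
          m≢0 = >-nonZero (<-≤-trans (s≤s z≤n) (*-mono-≤ (m≤n+m 2 al) (≤-trans (s≤s z≤n) 2+r≤g)))
        q = D / m
        s<g : s < g
        s<g = <-≤-trans (+-monoˡ-< 2 (Fin.toℕ<n a)) (≤-trans (≤-reflexive (+-comm r 2)) 2+r≤g)
        s≤W : s ≤ W
        s≤W = ≤-trans (<⇒≤ s<g) (≤-trans (m≤m*n g g) (≤-trans (m≤n*m (g * g) 2) 2g²≤W))
        F₀≤T : F₀ ≤ T
        F₀≤T = ≤-trans (+-mono-≤ (≤-trans (≤-reflexive (*-comm s al)) (*-monoʳ-≤ al s≤W))
          (<⇒≤ (Fin.toℕ<n (residue {N} (ℤ.- ((+ s ℤ.- + 1) ℤ.* ⟦ c ⟧)))))) (≤-reflexive (+-comm (al * W) N))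

      point : ℕ → ℕ
      point i = al + (q + i) * g

      module _ (i : ℕ) (1≤i : 1 ≤ i) (i≤2 : i ≤ 2) where
        private
          F : ℕ
          F = s * point i + b
          F-rem : F + D % m ≡ T + i * m
          F-rem = begin
            s * (al + (q + i) * g) + b + D % m ≡⟨ identity s al q i g b (D % m) ⟩
            (s * al + b) + (D % m + q * (s * g)) + i * (s * g) ≡⟨ cong (λ z → F₀ + z + i * m) (sym (m≡m%n+[m/n]*n D m)) ⟩
            F₀ + D + i * m ≡⟨ cong (_+ i * m) (m+[n∸m]≡n F₀≤T) ⟩
            T + i * m ∎
            where
            open ≡-Reasoning
            identity : ∀ s al q i g b rm → s * (al + (q + i) * g) + b + rm ≡ (s * al + b) + (rm + q * (s * g)) + i * (s * g)
            identity = solve-∀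
          T≤F : T ≤ F
          T≤F = +-cancelʳ-≤ (i * m) T F (≤-trans (≤-reflexive (sym F-rem)) (+-monoʳ-≤ F
            (≤-trans (<⇒≤ (m%n<n D m)) (≤-trans (≤-reflexive (sym (*-identityˡ m))) (*-monoˡ-≤ m 1≤i)))))
          F<T+W : F < T + W
          F<T+W = ≤-<-trans (m≤m+n F (D % m)) (≤-<-trans (≤-reflexive F-rem) (+-monoʳ-< T
            (≤-<-trans (*-monoˡ-≤ m i≤2) (<-≤-trans (*-monoʳ-< 2 (*-monoˡ-< g s<g)) 2g²≤W))))
          [1+a]W≤N : suc al * W ≤ N
          [1+a]W≤N = ≤-trans (*-monoˡ-≤ W (Fin.toℕ<n a)) rW≤N
          T+W≤2N : T + W ≤ 2 * N
          T+W≤2N = ≤-trans (≤-reflexive (identity N al W)) (≤-trans (+-monoʳ-≤ N [1+a]W≤N) (≤-reflexive (double N)))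
            where
            identity : ∀ N al W → N + al * W + W ≡ N + suc al * W
            identity = solve-∀
            double : ∀ N → N + N ≡ 2 * N
            double = solve-∀
          point<N : point i < N
          point<N = *-cancelˡ-< 2 (point i) N (<-≤-trans (≤-<-trans (≤-trans (*-monoˡ-≤ (point i) (m≤n+m 2 al))
            (m≤m+n _ b)) F<T+W) T+W≤2N)
          y : ℕ
          y = F ∸ N
          N+y≡F : N + y ≡ F
          N+y≡F = m+[n∸m]≡n (≤-trans (m≤m+n N _) T≤F)
          aW≤y : al * W ≤ y
          aW≤y = +-cancelˡ-≤ N _ _ (≤-trans T≤F (≤-reflexive (sym N+y≡F)))
          y<[1+a]W : y < suc al * W
          y<[1+a]W = +-cancelˡ-< N _ _ (≤-<-trans (≤-reflexive N+y≡F) (<-≤-trans F<T+W (≤-reflexive (identity N al W))))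
            where
            identity : ∀ N al W → N + al * W + W ≡ N + suc al * W
            identity = solve-∀
          y<N : y < N
          y<N = <-≤-trans y<[1+a]W [1+a]W≤N

        candidate : Fin N
        candidate = fromℕ< point<N

        toℕ-candidate : toℕ candidate ≡ point i
        toℕ-candidate = Fin.toℕ-fromℕ< point<N

        private
          y≡ : affine (slope 2 a) c candidate ≡ fromℕ< y<N
          y≡ = trans (affine-residue (slope 2 a) c candidate) (⟦⟧-residue (subst (+ N ℤ.∣_) (sym value)
                 (∣-combine (ℤ.- (+ 1)) (+ 1) (⟦residue⟧ {N} (ℤ.- ((+ s ℤ.- + 1) ℤ.* ⟦ c ⟧))) ℤ.∣-refl
                   (identity (+ s) ⟦ c ⟧ (+ point i) (+ b) (+ N)))))
            where
            y-int : + y ≡ + s ℤ.* + point i ℤ.+ + b ℤ.- + N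
            y-int = trans (restore (+ y) (+ N)) (cong (ℤ._- + N) (trans (cong (+_) N+y≡F)
              (cong (ℤ._+ + b) (ℤ.pos-* s (point i)))))
              where
              restore : ∀ y N → y ≡ N ℤ.+ y ℤ.- N
              restore = ℤ-solve
            value : ⟦ c ⟧ ℤ.+ + s ℤ.* (⟦ candidate ⟧ ℤ.- ⟦ c ⟧) ℤ.- ⟦ fromℕ< y<N ⟧ ≡
              ⟦ c ⟧ ℤ.+ + s ℤ.* (+ point i ℤ.- ⟦ c ⟧) ℤ.- (+ s ℤ.* + point i ℤ.+ + b ℤ.- + N)
            value = cong₂ (λ u v → ⟦ c ⟧ ℤ.+ + s ℤ.* (u ℤ.- ⟦ c ⟧) ℤ.- v) (cong +_ (Fin.toℕ-fromℕ< point<N))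
              (trans (cong +_ (Fin.toℕ-fromℕ< y<N)) y-int)
            identity : ∀ s c x b N → c ℤ.+ s ℤ.* (x ℤ.- c) ℤ.- (s ℤ.* x ℤ.+ b ℤ.- N) ≡
              (ℤ.- (+ 1)) ℤ.* (b ℤ.- (ℤ.- ((s ℤ.- + 1) ℤ.* c))) ℤ.+ + 1 ℤ.* N
            identity = ℤ-solve

        candidate-good : Good c a candidate
        candidate-good = (q + i , Fin.toℕ-fromℕ< point<N) , ≤-trans aW≤y (≤-reflexive (sym value)) ,
          ≤-<-trans (≤-reflexive value) y<[1+a]W
          where
          value : toℕ (affine (slope 2 a) c candidate) ≡ y
          value = trans (cong toℕ y≡) (Fin.toℕ-fromℕ< y<N)

      opaque
        -- Two hits are needed because one of them may be `c` itself, which its word must keep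
        -- fixed.
        choice : ∃ λ x → Good c a x × x ≢ c
        choice = select (x₁ Fin.≟ c)
          where
          1≤1 : 1 ≤ 1
          1≤1 = s≤s z≤n
          1≤2 : 1 ≤ 2
          1≤2 = s≤s z≤n
          x₁ x₂ : Fin N
          x₁ = candidate 1 1≤1 1≤2
          x₂ = candidate 2 1≤2 ≤-refl
          x₁≢x₂ : x₁ ≢ x₂
          x₁≢x₂ e = <⇒≢ (+-monoʳ-< al (*-monoˡ-< g (+-monoʳ-< q (s≤s (s≤s z≤n)))))
            (trans (sym (toℕ-candidate 1 1≤1 1≤2)) (trans (cong toℕ e) (toℕ-candidate 2 1≤2 ≤-refl)))
          select : Dec (x₁ ≡ c) → ∃ λ x → Good c a x × x ≢ c
          select (no ne) = x₁ , candidate-good 1 1≤1 1≤2 , ne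
          select (yes e) = x₂ , candidate-good 2 1≤2 ≤-refl , λ e′ → x₁≢x₂ (trans e (sym e′))

    pointCode : Code (Fin (N + 1)) r
    pointCode = transport (↔-sym (Fin.+↔⊎ {N} {1})) E.extended
      where
      open Slopes rough 2 2+r≤k
      open Shift {N} {r} r<N
      ch : Fin N → Fin r → Fin N
      ch c a = proj₁ (choice c a)
      good : ∀ c a → Good c a (ch c a)
      good c a = proj₁ (proj₂ (choice c a))
      ch-class : ∀ {c a c′ a′} → ch c a ≡ ch c′ a′ → a ≡ a′
      ch-class {c} {a} {c′} {a′} e = Fin.toℕ-injective (trans (sym (class a (good c a))) (trans (cong (λ x → toℕ x % g) e) (class a′ (good c′ a′))))
        where
        class : ∀ {c x} a → Good c a x → toℕ x % g ≡ toℕ a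
        class a ((p , e) , _) = trans (cong (_% g) e) (trans ([m+kn]%n≡m%n (toℕ a) p g)
          (m<n⇒m%n≡m (<-≤-trans (Fin.toℕ<n a) (≤-trans (m≤n+m r 2) 2+r≤g))))
      img-class : ∀ {c a c′ a′} → affine (slope 2 a) c (ch c a) ≡ affine (slope 2 a′) c′ (ch c′ a′) → a ≡ a′
      img-class {c} {a} {c′} {a′} e = Fin.toℕ-injective (interval-disjoint {W} (proj₁ (proj₂ (good c a))) (proj₂ (proj₂ (good c a)))
        (subst (λ z → toℕ a′ * W ≤ toℕ z) (sym e) (proj₁ (proj₂ (good c′ a′))))
        (subst (λ z → toℕ z < suc (toℕ a′) * W) (sym e) (proj₂ (proj₂ (good c′ a′)))))
      parallel : ∀ {c c′ : Fin N} {a : Fin r} {x : Fin N} → affine (slope 2 a) c x ≡ affine (slope 2 a) c′ x → c ≡ c′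
      parallel {a = a} = affine-centre (slope-1-unit (s≤s (s≤s z≤n)) a)
      sh-agree : ∀ {a : Fin r} {c : Fin N} {a′ : Fin r} {x y : Fin N} → shift a x ≡ affine (slope 2 a′) c x → shift a y ≡ affine (slope 2 a′) c y → x ≡ y
      sh-agree {a′ = a′} = shift-affine (slope-1-unit (s≤s (s≤s z≤n)) a′)
      ch≢ : ∀ c a → ch c a ≢ c
      ch≢ c a = proj₂ (proj₂ (choice c a))
      module E = Extension Fin._≟_ (affineCode rough 2+r≤k) parallel shift shift-moves shift-injective shift-distinct
        sh-agree ch ch≢ ch-class img-class

  -- The blocks

  module Local {k r : ℕ} .{{_ : NonZero k}} (rough : CoprimeBelow k k) (3+r≤k : 3 + r ≤ k) (r*2≤k : r * 2 ≤ k) where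

    open Slopes {r = r} rough 2 (≤-trans (n≤1+n _) 3+r≤k) using () renaming (slope-unit to α-unit; slope-1-unit to α-1-unit; slopes-unit to αs-unit)
    open Slopes {r = r} rough 3 3+r≤k using () renaming (slope-unit to β-unit; slope-1-unit to β-1-unit; slopes-unit to βs-unit)
    open Shift {k} {r} (≤-trans (m≤n+m (suc r) 2) 3+r≤k)

    Pair : Set
    Pair = Fin k × Fin k

    1<2 : 1 < 2
    1<2 = s≤s (s≤s z≤n)
    1<3 : 1 < 3
    1<3 = s≤s (s≤s z≤n)
    0<2 : 0 < 2
    0<2 = s≤s z≤n
    0<3 : 0 < 3
    0<3 = s≤s z≤n

    -- The slopes a + 2 and a + 3 differ by one, so a word sends the points (h, h + ξ) of a diagonal
    -- to pairwise different diagonals j′ - i′ = h + const. Exactly one of them stays on its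
    -- diagonal; solving j′ - i′ = ξ for h gives `height`.
    pairWord : Pair → Fin r → Pair → Pair
    pairWord (i₀ , j₀) a (i , j) = affine (slope 2 a) i₀ i , affine (slope 3 a) j₀ j

    pair-parallel : ∀ {c c′ a x} → pairWord c a x ≡ pairWord c′ a x → c ≡ c′
    pair-parallel {a = a} e = cong₂ _,_ (affine-centre (α-1-unit 1<2 a) (cong proj₁ e)) (affine-centre (β-1-unit 1<3 a) (cong proj₂ e))

    pairCode : Code Pair r
    pairCode = record
      { word = pairWord
      ; fixed = λ c a → cong₂ _,_ (affine-fixed _ _) (affine-fixed _ _)
      ; unique = λ c a x e → cong₂ _,_ (affine-unique (α-1-unit 1<2 a) (cong proj₁ e)) (affine-unique (β-1-unit 1<3 a) (cong proj₂ e))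
      ; injective = λ c a e → cong₂ _,_ (affine-injective (α-unit 0<2 a) (cong proj₁ e)) (affine-injective (β-unit 0<3 a) (cong proj₂ e))
      ; agree = agree
      }
      where
      agree : ∀ c a c′ a′ x y → pairWord c a x ≡ pairWord c′ a′ x → pairWord c a y ≡ pairWord c′ a′ y → x ≡ y ⊎ (c ≡ c′ × a ≡ a′)
      agree c a c′ a′ x y e e′ with a Fin.≟ a′
      ... | yes refl = inj₂ (pair-parallel e , refl)
      ... | no a≢ = inj₁ (cong₂ _,_ (affine-slopes (αs-unit a≢) (cong proj₁ e) (cong proj₁ e′))
                                   (affine-slopes (βs-unit a≢) (cong proj₂ e) (cong proj₂ e′)))

    pairShift : Fin r → Pair → Pair
    pairShift a (i , j) = shift a i , j

    -- Slope index a owns the two diagonals j - i = ξ with ξ ∈ {2a, 2a+1}; the point (h , h + ξ) of such a diagonal is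
    -- mapped by the word of (i₀ , j₀) to the same diagonal.  The second diagonal serves when h = i₀ on the first.
    height : ℕ → Pair → Fin r → Fin k
    height ξ (i₀ , j₀) a = residue (slope 2 a ℤ.* (⟦ j₀ ⟧ ℤ.- + ξ) ℤ.- (slope 2 a ℤ.- + 1) ℤ.* ⟦ i₀ ⟧)

    opaque
      diagonal : (c : Pair) (a : Fin r) →
        ∃ λ ξ → (toℕ a * 2 ≤ ξ × ξ < suc (toℕ a) * 2) × height ξ c a ≢ proj₁ c
      diagonal c@(i₀ , j₀) a with height (toℕ a * 2) c a Fin.≟ i₀
      ... | no ne = toℕ a * 2 , (≤-refl , m<n+m (toℕ a * 2) {2} (s≤s z≤n)) , ne
      -- Raising ξ by one changes the height by minus the slope, which is a unit, so the two heights
      -- cannot both be i₀.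
      ... | yes e = 1 + toℕ a * 2 , (n≤1+n _ , ≤-refl) , λ e′ → contradiction (∣⇒≤ (ℤ.∣⇒∣ᵤ (Unit.cancel (α-unit 0<2 a) (+ 1)
              (∣-combine (+ 1) (ℤ.- (+ 1)) (residue-⟦⟧ e) (residue-⟦⟧ e′)
                (identity (slope 2 a) ⟦ j₀ ⟧ (+ (toℕ a * 2)) ⟦ i₀ ⟧))))) (<⇒≱ (≤-trans 1<3 (≤-trans (m≤m+n 3 r) 3+r≤k)))
        where
        identity : ∀ s j x i → s ℤ.* + 1 ≡ + 1 ℤ.* (s ℤ.* (j ℤ.- x) ℤ.- (s ℤ.- + 1) ℤ.* i ℤ.- i) ℤ.+
          (ℤ.- (+ 1)) ℤ.* (s ℤ.* (j ℤ.- (+ 1 ℤ.+ x)) ℤ.- (s ℤ.- + 1) ℤ.* i ℤ.- i)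
        identity = ℤ-solve

    ξ : Pair → Fin r → ℕ
    ξ c a = proj₁ (diagonal c a)

    ξ-bounds : ∀ c a → toℕ a * 2 ≤ ξ c a × ξ c a < suc (toℕ a) * 2
    ξ-bounds c a = proj₁ (proj₂ (diagonal c a))

    ξ<k : ∀ c a → ξ c a < k
    ξ<k c a = <-≤-trans (proj₂ (ξ-bounds c a)) (≤-trans (*-monoˡ-≤ 2 (Fin.toℕ<n a)) r*2≤k)

    opaque
      top : Pair → Fin r → Fin k
      top c a = height (ξ c a) c a

      top≢ : ∀ c a → top c a ≢ proj₁ c
      top≢ c a = proj₂ (proj₂ (diagonal c a))

      top-≈ : ∀ i₀ j₀ a → + k ℤ.∣ ⟦ top (i₀ , j₀) a ⟧ ℤ.- (slope 2 a ℤ.* (⟦ j₀ ⟧ ℤ.- + ξ (i₀ , j₀) a) ℤ.- (slope 2 a ℤ.- + 1) ℤ.* ⟦ i₀ ⟧)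
      top-≈ i₀ j₀ a = ⟦residue⟧ (slope 2 a ℤ.* (⟦ j₀ ⟧ ℤ.- + ξ (i₀ , j₀) a) ℤ.- (slope 2 a ℤ.- + 1) ℤ.* ⟦ i₀ ⟧)

      ch : Pair → Fin r → Pair
      ch c a = top c a , residue (⟦ top c a ⟧ ℤ.+ + ξ c a)

      ch-top : ∀ c a → proj₁ (ch c a) ≡ top c a
      ch-top c a = refl

      ch-≈ : ∀ c a → + k ℤ.∣ ⟦ proj₂ (ch c a) ⟧ ℤ.- ⟦ proj₁ (ch c a) ⟧ ℤ.- + ξ c a
      ch-≈ c a = ∣-scale (+ 1) (⟦residue⟧ (⟦ top c a ⟧ ℤ.+ + ξ c a)) (identity ⟦ proj₂ (ch c a) ⟧ ⟦ top c a ⟧ (+ ξ c a))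
        where
        identity : ∀ y t x → y ℤ.- t ℤ.- x ≡ + 1 ℤ.* (y ℤ.- (t ℤ.+ x))
        identity = ℤ-solve

    affine-≈ : ∀ s (c x : Fin k) → + k ℤ.∣ ⟦ affine s c x ⟧ ℤ.- (⟦ c ⟧ ℤ.+ s ℤ.* (⟦ x ⟧ ℤ.- ⟦ c ⟧))
    affine-≈ s c x = subst (λ z → + k ℤ.∣ ⟦ z ⟧ ℤ.- (⟦ c ⟧ ℤ.+ s ℤ.* (⟦ x ⟧ ℤ.- ⟦ c ⟧))) (sym (affine-residue s c x)) (⟦residue⟧ (⟦ c ⟧ ℤ.+ s ℤ.* (⟦ x ⟧ ℤ.- ⟦ c ⟧)))

    img-≈ : ∀ c a → + k ℤ.∣ ⟦ proj₂ (pairWord c a (ch c a)) ⟧ ℤ.- ⟦ proj₁ (pairWord c a (ch c a)) ⟧ ℤ.- + ξ c a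
    img-≈ c@(i₀ , j₀) a = ∣-combine (+ 1) (+ 1)
        (∣-combine (+ 1) (ℤ.- (+ 1)) (affine-≈ (slope 3 a) j₀ (proj₂ (ch c a))) (affine-≈ (slope 2 a) i₀ (proj₁ (ch c a))) refl)
        (∣-combine (slope 3 a) (+ 1) (ch-≈ c a) top-≈′ refl)
        (identity (slope 2 a) ⟦ i₀ ⟧ ⟦ j₀ ⟧ ⟦ proj₁ (ch c a) ⟧ ⟦ proj₂ (ch c a) ⟧ (+ ξ c a)
          ⟦ proj₁ (pairWord c a (ch c a)) ⟧ ⟦ proj₂ (pairWord c a (ch c a)) ⟧ (slope 3 a) (cong +_ (trans (+-suc (toℕ a) 2) (+-comm 1 (toℕ a + 2)))))
      where
      top-≈′ : + k ℤ.∣ ⟦ proj₁ (ch c a) ⟧ ℤ.- (slope 2 a ℤ.* (⟦ j₀ ⟧ ℤ.- + ξ c a) ℤ.- (slope 2 a ℤ.- + 1) ℤ.* ⟦ i₀ ⟧)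
      top-≈′ = subst (λ z → + k ℤ.∣ ⟦ z ⟧ ℤ.- (slope 2 a ℤ.* (⟦ j₀ ⟧ ℤ.- + ξ c a) ℤ.- (slope 2 a ℤ.- + 1) ℤ.* ⟦ i₀ ⟧)) (sym (ch-top c a)) (top-≈ i₀ j₀ a)
      identity : ∀ s i₀ j₀ i j x i′ j′ s′ → s′ ≡ s ℤ.+ + 1 → j′ ℤ.- i′ ℤ.- x ≡
        + 1 ℤ.* (+ 1 ℤ.* (j′ ℤ.- (j₀ ℤ.+ s′ ℤ.* (j ℤ.- j₀))) ℤ.+ (ℤ.- (+ 1)) ℤ.* (i′ ℤ.- (i₀ ℤ.+ s ℤ.* (i ℤ.- i₀)))) ℤ.+
        + 1 ℤ.* (s′ ℤ.* (j ℤ.- i ℤ.- x) ℤ.+ + 1 ℤ.* (i ℤ.- (s ℤ.* (j₀ ℤ.- x) ℤ.- (s ℤ.- + 1) ℤ.* i₀)))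
      identity s i₀ j₀ i j x i′ j′ _ refl = identity′ s i₀ j₀ i j x i′ j′
        where
        identity′ : ∀ s i₀ j₀ i j x i′ j′ → j′ ℤ.- i′ ℤ.- x ≡
          + 1 ℤ.* (+ 1 ℤ.* (j′ ℤ.- (j₀ ℤ.+ (s ℤ.+ + 1) ℤ.* (j ℤ.- j₀))) ℤ.+ (ℤ.- (+ 1)) ℤ.* (i′ ℤ.- (i₀ ℤ.+ s ℤ.* (i ℤ.- i₀)))) ℤ.+
          + 1 ℤ.* ((s ℤ.+ + 1) ℤ.* (j ℤ.- i ℤ.- x) ℤ.+ + 1 ℤ.* (i ℤ.- (s ℤ.* (j₀ ℤ.- x) ℤ.- (s ℤ.- + 1) ℤ.* i₀)))
        identity′ = ℤ-solve

    ξ-unique : ∀ {p p′ : Pair} {c a c′ a′} → p ≡ p′ → + k ℤ.∣ ⟦ proj₂ p ⟧ ℤ.- ⟦ proj₁ p ⟧ ℤ.- + ξ c a →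
      + k ℤ.∣ ⟦ proj₂ p′ ⟧ ℤ.- ⟦ proj₁ p′ ⟧ ℤ.- + ξ c′ a′ → ξ c a ≡ ξ c′ a′
    ξ-unique {p} {c = c} {a} {c′} {a′} refl d d′ with ξ c a ≟ ξ c′ a′
    ... | yes e = e
    ... | no ne = contradiction (∣⇒≤ {{>-nonZero (proj₁ b)}} (ℤ.∣⇒∣ᵤ (∣-combine (ℤ.- (+ 1)) (+ 1) d d′
                    (identity ⟦ proj₂ p ⟧ ⟦ proj₁ p ⟧ (+ ξ c a) (+ ξ c′ a′))))) (<⇒≱ (proj₂ b))
      where
      b : 0 < ℤ.∣ + ξ c a ℤ.- + ξ c′ a′ ∣ × ℤ.∣ + ξ c a ℤ.- + ξ c′ a′ ∣ < k
      b = diff-bounds ne (ξ<k c a) (ξ<k c′ a′)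
      identity : ∀ j i x y → x ℤ.- y ≡ (ℤ.- (+ 1)) ℤ.* (j ℤ.- i ℤ.- x) ℤ.+ + 1 ℤ.* (j ℤ.- i ℤ.- y)
      identity = ℤ-solve

    ξ-class : ∀ {c a c′ a′} → ξ c a ≡ ξ c′ a′ → a ≡ a′
    ξ-class {c} {a} {c′} {a′} e = Fin.toℕ-injective (interval-disjoint {2} (proj₁ (ξ-bounds c a)) (proj₂ (ξ-bounds c a))
      (subst (toℕ a′ * 2 ≤_) (sym e) (proj₁ (ξ-bounds c′ a′))) (subst (_< suc (toℕ a′) * 2) (sym e) (proj₂ (ξ-bounds c′ a′))))

    ch-ξ : ∀ {c a c′ a′} → ch c a ≡ ch c′ a′ → ξ c a ≡ ξ c′ a′
    ch-ξ {c} {a} {c′} {a′} e = ξ-unique {ch c a} {c = c} {a} {c′} {a′} e (ch-≈ c a) (ch-≈ c′ a′)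

    img-ξ : ∀ {c a c′ a′} → pairWord c a (ch c a) ≡ pairWord c′ a′ (ch c′ a′) → ξ c a ≡ ξ c′ a′
    img-ξ {c} {a} {c′} {a′} e = ξ-unique {pairWord c a (ch c a)} {c = c} {a} {c′} {a′} e (img-≈ c a) (img-≈ c′ a′)

    -- For fixed i₀ and ξ the height is affine in j₀ with the unit slope a + 2. Hence words of one
    -- class with centres in one column never share a modified point or an image, as `lword-agree⁰`
    -- requires.
    top-centre : ∀ {i₀ j₀ j₀′ a} → ξ (i₀ , j₀) a ≡ ξ (i₀ , j₀′) a → top (i₀ , j₀) a ≡ top (i₀ , j₀′) a → j₀ ≡ j₀′
    top-centre {i₀} {j₀} {j₀′} {a} eξ e = ≈⇒≡ (Unit.cancel (α-unit 0<2 a) _ (∣-combine (ℤ.- (+ 1)) (+ 1)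
        (top-≈ i₀ j₀ a) (subst₂ (λ h x → + k ℤ.∣ ⟦ h ⟧ ℤ.- (slope 2 a ℤ.* (⟦ j₀′ ⟧ ℤ.- + x) ℤ.- (slope 2 a ℤ.- + 1) ℤ.* ⟦ i₀ ⟧))
          (sym e) (sym eξ) (top-≈ i₀ j₀′ a))
        (identity (slope 2 a) ⟦ i₀ ⟧ ⟦ j₀ ⟧ ⟦ j₀′ ⟧ (+ ξ (i₀ , j₀) a) ⟦ top (i₀ , j₀) a ⟧)))
      where
      identity : ∀ s i j j′ x h → s ℤ.* (j ℤ.- j′) ≡ (ℤ.- (+ 1)) ℤ.* (h ℤ.- (s ℤ.* (j ℤ.- x) ℤ.- (s ℤ.- + 1) ℤ.* i)) ℤ.+
        + 1 ℤ.* (h ℤ.- (s ℤ.* (j′ ℤ.- x) ℤ.- (s ℤ.- + 1) ℤ.* i))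
      identity = ℤ-solve

    pairShift-agree : ∀ {a c a′ x y} → pairShift a x ≡ pairWord c a′ x → pairShift a y ≡ pairWord c a′ y → x ≡ y
    pairShift-agree {a′ = a′} e e′ = cong₂ _,_ (shift-affine (α-1-unit 1<2 a′) (cong proj₁ e) (cong proj₁ e′))
      (trans (affine-unique (β-1-unit 1<3 a′) (sym (cong proj₂ e))) (sym (affine-unique (β-1-unit 1<3 a′) (sym (cong proj₂ e′)))))

    pairShift-injective : ∀ a {x y} → pairShift a x ≡ pairShift a y → x ≡ y
    pairShift-injective a e = cong₂ _,_ (shift-injective a (cong proj₁ e)) (cong proj₂ e)

    pairShift-moves : ∀ a x → pairShift a x ≢ x
    pairShift-moves a x e = shift-moves a _ (cong proj₁ e)

    pairShift-distinct : ∀ {a a′ x} → pairShift a x ≡ pairShift a′ x → a ≡ a′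
    pairShift-distinct e = shift-distinct (cong proj₁ e)

    ch≢ : ∀ c a → ch c a ≢ c
    ch≢ c a e = top≢ c a (trans (sym (ch-top c a)) (cong proj₁ e))

    ch-class : ∀ {c a c′ a′} → ch c a ≡ ch c′ a′ → a ≡ a′
    ch-class e = ξ-class (ch-ξ e)

    img-class : ∀ {c a c′ a′} → pairWord c a (ch c a) ≡ pairWord c′ a′ (ch c′ a′) → a ≡ a′
    img-class e = ξ-class (img-ξ e)

    open Extension (Product.≡-dec Fin._≟_ Fin._≟_) pairCode pair-parallel pairShift pairShift-moves pairShift-injective
      pairShift-distinct pairShift-agree ch ch≢ ch-class img-class public

    gr : X⁺ → Fin k ⊎ Fin 1
    gr (inj₁ (i , _)) = inj₁ i
    gr (inj₂ z) = inj₂ z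

    -- Blocks come with (true) or without (false) their point at infinity.
    Present : Bool → X⁺ → Set
    Present true _ = ⊤
    Present false (inj₁ _) = ⊤
    Present false (inj₂ _) = ⊥

    lword : Bool → X⁺ → Fin r → X⁺ → X⁺
    lword true = word⁺
    lword false (inj₁ c) a (inj₁ x) = inj₁ (pairWord c a x)
    -- Default for the point at infinity, which is absent from such a block.
    lword false c _ _ = c

    pair-grpᶜ : ∀ c a x → proj₁ c ≢ proj₁ x → proj₁ c ≢ proj₁ (pairWord c a x)
    pair-grpᶜ c a x ne e = ne (sym (affine-avoid (α-unit 0<2 a) (sym e)))

    pair-grpˣ : ∀ c a x → proj₁ c ≢ proj₁ x → proj₁ x ≢ proj₁ (pairWord c a x)
    pair-grpˣ c a x ne e = ne (sym (affine-unique (α-1-unit 1<2 a) (sym e)))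

    -- For centres in one column both first coordinates fix that column, so with different slopes an
    -- agreement in another column would be a second one.
    pair-agree⁰ : ∀ {c a c′ a′ x} → proj₁ c ≡ proj₁ c′ → proj₁ c ≢ proj₁ x → pairWord c a x ≡ pairWord c′ a′ x → c ≡ c′ × a ≡ a′
    pair-agree⁰ {c} {a} {c′} {a′} {x} refl ne e with a Fin.≟ a′
    ... | yes refl = pair-parallel e , refl
    ... | no a≢ = contradiction (sym (affine-slopes (αs-unit a≢) (cong proj₁ e)
                    (trans (affine-fixed _ (proj₁ c)) (sym (affine-fixed _ (proj₁ c)))))) ne

    private
      reg≢ : ∀ {i i′ : Fin k} → inj₁ {B = Fin 1} i ≢ inj₁ i′ → i ≢ i′
      reg≢ ne e = ne (cong inj₁ e)
      reg≢∞ : ∀ {i : Fin k} {z : Fin 1} → inj₁ i ≢ inj₂ z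
      reg≢∞ ()

    word⁺-grp : ∀ c a x {i} → inj₁ i ≢ inj₂ zero → i ≢ proj₁ (pairWord c a x) → inj₁ i ≢ gr (word⁺ (inj₁ c) a (inj₁ x))
    word⁺-grp c a x n n′ e = [ (λ p → n (trans e (cong gr p))) , (λ p → n′ (inj₁-injective (trans e (cong gr p)))) ]′ (word⁺-cases c a x)

    lword-present : ∀ b c a x → Present b c → Present b x → Present b (lword b c a x)
    lword-present true c a x _ _ = tt
    lword-present false (inj₁ c) a (inj₁ x) _ _ = tt

    lword-grpᶜ : ∀ b c a x → Present b c → Present b x → gr c ≢ gr x → gr c ≢ gr (lword b c a x)
    lword-grpᶜ true (inj₁ c) a (inj₁ x) _ _ ne = word⁺-grp c a x reg≢∞ (pair-grpᶜ c a x (reg≢ ne))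
    lword-grpᶜ true (inj₁ c) a ∞ _ _ ne e = pair-grpᶜ c a (ch c a) (λ q → top≢ c a (trans (sym (ch-top c a)) (sym q)))
      (inj₁-injective (trans e (cong gr (word⁺-added c a))))
    lword-grpᶜ true ∞ a (inj₁ x) _ _ ne e = reg≢∞ (sym (trans e (cong gr (word⁺-shift a x))))
    lword-grpᶜ true ∞ a ∞ _ _ ne e = ne refl
    lword-grpᶜ false (inj₁ c) a (inj₁ x) _ _ ne e = pair-grpᶜ c a x (reg≢ ne) (inj₁-injective e)

    lword-grpˣ : ∀ b c a x → Present b c → Present b x → gr c ≢ gr x → gr x ≢ gr (lword b c a x)
    lword-grpˣ true (inj₁ c) a (inj₁ x) _ _ ne = word⁺-grp c a x reg≢∞ (pair-grpˣ c a x (reg≢ ne))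
    lword-grpˣ true (inj₁ c) a ∞ _ _ ne e = reg≢∞ (sym (trans e (cong gr (word⁺-added c a))))
    lword-grpˣ true ∞ a (inj₁ x) _ _ ne e = shift-moves a _ (sym (inj₁-injective (trans e (cong gr (word⁺-shift a x)))))
    lword-grpˣ true ∞ a ∞ _ _ ne e = ne refl
    lword-grpˣ false (inj₁ c) a (inj₁ x) _ _ ne e = pair-grpˣ c a x (reg≢ ne) (inj₁-injective e)

    lword-inj : ∀ b c a x y → Present b c → Present b x → Present b y → lword b c a x ≡ lword b c a y → x ≡ y
    lword-inj true c a x y _ _ _ e = Code.injective extended c a e
    lword-inj false (inj₁ c) a (inj₁ x) (inj₁ y) _ _ _ e = cong inj₁ (Code.injective pairCode c a (inj₁-injective e))

    lword-agree¹ : ∀ b c a c′ a′ x y → Present b c → Present b c′ → Present b x → Present b y → gr c ≢ gr c′ →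
      lword b c a x ≡ lword b c′ a′ x → lword b c a y ≡ lword b c′ a′ y → x ≡ y
    lword-agree¹ true c a c′ a′ x y _ _ _ _ ne e e′ =
      [ (λ p → p) , (λ p → contradiction (cong gr (proj₁ p)) ne) ]′ (Code.agree extended c a c′ a′ x y e e′)
    lword-agree¹ false (inj₁ c) a (inj₁ c′) a′ (inj₁ x) (inj₁ y) _ _ _ _ ne e e′ =
      [ cong inj₁ , (λ p → contradiction (cong (λ d → inj₁ (proj₁ d)) (proj₁ p)) ne) ]′
        (Code.agree pairCode c a c′ a′ x y (inj₁-injective e) (inj₁-injective e′))

    chosen-agree⁰ : ∀ {i₀ j₀ j₀′ a a′} → ch (i₀ , j₀) a ≡ ch (i₀ , j₀′) a′ → a ≡ a′ → j₀ ≡ j₀′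
    chosen-agree⁰ {i₀} {j₀} {j₀′} {a} e refl = top-centre (ch-ξ e)
      (trans (sym (ch-top (i₀ , j₀) a)) (trans (cong proj₁ e) (ch-top (i₀ , j₀′) a)))

    added-agree⁰ : ∀ {i₀ j₀ j₀′ a a′} → img (i₀ , j₀) a ≡ img (i₀ , j₀′) a′ → a ≡ a′ → j₀ ≡ j₀′
    added-agree⁰ {i₀} {j₀} {j₀′} {a} e refl = top-centre (img-ξ {i₀ , j₀} {a} {i₀ , j₀′} {a} e)
      (trans (sym (ch-top (i₀ , j₀) a)) (trans (affine-injective (α-unit 0<2 a) (cong proj₁ e)) (ch-top (i₀ , j₀′) a)))

    agreement⁰ : ∀ {c a c′ a′ x} → proj₁ c ≡ proj₁ c′ → gr (inj₁ c) ≢ gr x → Agreement c a c′ a′ x → c ≡ c′ × a ≡ a′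
    agreement⁰ g ne (regular q) = pair-agree⁰ g (reg≢ ne) q
    agreement⁰ {c} {a} {c′} {a′} refl ne (chosen p q) = cong (proj₁ c ,_) (chosen-agree⁰ e a≡a′) , a≡a′
      where
      e : ch c a ≡ ch c′ a′
      e = trans (sym p) q
      a≡a′ : a ≡ a′
      a≡a′ = ch-class e
    agreement⁰ {c} {a} {c′} {a′} refl ne (added q) = cong (proj₁ c ,_) (added-agree⁰ q a≡a′) , a≡a′
      where
      a≡a′ : a ≡ a′
      a≡a′ = img-class {c} {a} {c′} {a′} q

    lword-agree⁰ : ∀ b c a c′ a′ x → Present b c → Present b c′ → Present b x → gr c ≡ gr c′ → gr c ≢ gr x →
      lword b c a x ≡ lword b c′ a′ x → c ≡ c′ × a ≡ a′
    lword-agree⁰ true (inj₁ c) a (inj₁ c′) a′ x _ _ _ g ne e =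
      Product.map₁ (cong inj₁) (agreement⁰ (inj₁-injective g) ne (agreement c a c′ a′ x e))
    lword-agree⁰ true ∞ a ∞ a′ (inj₁ x) _ _ _ g ne e = refl , pairShift-distinct {x = x}
      (inj₁-injective (trans (sym (word⁺-shift a x)) (trans e (word⁺-shift a′ x))))
    lword-agree⁰ true ∞ a ∞ a′ ∞ _ _ _ g ne e = contradiction refl ne
    lword-agree⁰ false (inj₁ c) a (inj₁ c′) a′ (inj₁ x) _ _ _ g ne e =
      Product.map₁ (cong inj₁) (pair-agree⁰ (inj₁-injective g) (reg≢ ne) (inj₁-injective e))

  -- The design

  -- The lines x = e i + f over ℤ/t form a transversal design with columns i < k. Every point (i ,
  -- x) carries k copies j, and the group at infinity consists of the gradients e < u, each a single
  -- point; `u ≤ t` is the truncation.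
  module Design {k t u r : ℕ} .{{_ : NonZero k}} .{{_ : NonZero t}} (roughᵏ : CoprimeBelow k k) (roughᵗ : CoprimeBelow k t)
    (3+r≤k : 3 + r ≤ k) (r*2≤k : r * 2 ≤ k) (u≤t : u ≤ t) (codeᵘ : Code (Fin u) r) where

    open Local {k} {r} roughᵏ 3+r≤k r*2≤k
    open Slopes {r = r} roughᵏ 3 3+r≤k using () renaming (slope-unit to β-unit; slope-1-unit to β-1-unit; slopes-unit to βs-unit)
    open Slopes {r = r} roughᵗ 2 (≤-trans (n≤1+n _) 3+r≤k) using () renaming (slope-unit to γ-unit; slope-1-unit to γ-1-unit; slopes-unit to γs-unit)

    Point Group Block : Set
    Point = (Pair × Fin t) ⊎ Fin u
    Group = Fin k ⊎ Fin 1
    Block = Fin t × Fin t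

    shape : Point → X⁺
    shape (inj₁ (p , _)) = inj₁ p
    shape (inj₂ _) = ∞

    grp : Point → Group
    grp p = gr (shape p)

    opaque
      line : Block → Fin k → Fin t
      line (e , f) i = residue (⟦ e ⟧ ℤ.* ⟦ i ⟧ ℤ.+ ⟦ f ⟧)

      line-≈ : ∀ {e f i x} → x ≡ line (e , f) i → + t ℤ.∣ ⟦ e ⟧ ℤ.* ⟦ i ⟧ ℤ.+ ⟦ f ⟧ ℤ.- ⟦ x ⟧
      line-≈ e = residue-⟦⟧ (sym e)

      ≈-line : ∀ {e f i x} → + t ℤ.∣ ⟦ e ⟧ ℤ.* ⟦ i ⟧ ℤ.+ ⟦ f ⟧ ℤ.- ⟦ x ⟧ → x ≡ line (e , f) i
      ≈-line d = sym (⟦⟧-residue d)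

    On : Block → Point → Set
    On b (inj₁ ((i , _) , x)) = x ≡ line b i
    On b (inj₂ v) = toℕ v ≡ toℕ (proj₁ b)

    intercept : Fin t → Fin k → Fin t → Fin t
    intercept e i x = residue (⟦ x ⟧ ℤ.- ⟦ e ⟧ ℤ.* ⟦ i ⟧)

    intercept-on : ∀ e i x → x ≡ line (e , intercept e i x) i
    intercept-on e i x = ≈-line (∣-scale (+ 1) (⟦residue⟧ (⟦ x ⟧ ℤ.- ⟦ e ⟧ ℤ.* ⟦ i ⟧)) (identity ⟦ e ⟧ ⟦ i ⟧ ⟦ x ⟧ ⟦ intercept e i x ⟧))
      where
      identity : ∀ e i x f → e ℤ.* i ℤ.+ f ℤ.- x ≡ + 1 ℤ.* (f ℤ.- (x ℤ.- e ℤ.* i))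
      identity = ℤ-solve

    -- This makes two points of different columns lie on a line: the gradient solves an equation
    -- with coefficient i - i′, which is nonzero and below k.
    columns-unit : ∀ {i i′ : Fin k} → i ≢ i′ → Unit t (⟦ i ⟧ ℤ.- ⟦ i′ ⟧)
    columns-unit {i} {i′} ne = unit roughᵗ _ (proj₁ b) (proj₂ b)
      where
      b : 0 < ℤ.∣ ⟦ i ⟧ ℤ.- ⟦ i′ ⟧ ∣ × ℤ.∣ ⟦ i ⟧ ℤ.- ⟦ i′ ⟧ ∣ < k
      b = diff-bounds (λ e → ne (Fin.toℕ-injective e)) (Fin.toℕ<n i) (Fin.toℕ<n i′)

    opaque
      gradient : Fin k → Fin t → Fin k → Fin t → Fin t
      gradient i x i′ x′ with i Fin.≟ i′
      ... | yes _ = x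
      ... | no ne = proj₁ (unit-solve (columns-unit ne) (⟦ x ⟧ ℤ.- ⟦ x′ ⟧))

      gradient-≈ : ∀ i x i′ x′ → i ≢ i′ → + t ℤ.∣ (⟦ i ⟧ ℤ.- ⟦ i′ ⟧) ℤ.* ⟦ gradient i x i′ x′ ⟧ ℤ.- (⟦ x ⟧ ℤ.- ⟦ x′ ⟧)
      gradient-≈ i x i′ x′ ne with i Fin.≟ i′
      ... | yes e = contradiction e ne
      ... | no ne′ = proj₂ (unit-solve (columns-unit ne′) (⟦ x ⟧ ℤ.- ⟦ x′ ⟧))

    gradient-on : ∀ i x i′ x′ → i ≢ i′ → x′ ≡ line (gradient i x i′ x′ , intercept (gradient i x i′ x′) i x) i′
    gradient-on i x i′ x′ ne = ≈-line (∣-combine (+ 1) (ℤ.- (+ 1)) (⟦residue⟧ (⟦ x ⟧ ℤ.- ⟦ e ⟧ ℤ.* ⟦ i ⟧)) (gradient-≈ i x i′ x′ ne)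
        (identity ⟦ e ⟧ ⟦ i ⟧ ⟦ i′ ⟧ ⟦ x ⟧ ⟦ x′ ⟧ ⟦ intercept e i x ⟧))
      where
      e = gradient i x i′ x′
      identity : ∀ e i i′ x x′ f → e ℤ.* i′ ℤ.+ f ℤ.- x′ ≡ + 1 ℤ.* (f ℤ.- (x ℤ.- e ℤ.* i)) ℤ.+
        (ℤ.- (+ 1)) ℤ.* ((i ℤ.- i′) ℤ.* e ℤ.- (x ℤ.- x′))
      identity = ℤ-solve

    blk : Point → Point → Block
    blk (inj₁ ((i , _) , x)) (inj₁ ((i′ , _) , x′)) = gradient i x i′ x′ , intercept (gradient i x i′ x′) i x
    blk (inj₁ ((i , _) , x)) (inj₂ v) = inject≤ v u≤t , intercept (inject≤ v u≤t) i x
    blk (inj₂ v) (inj₁ ((i , _) , x)) = inject≤ v u≤t , intercept (inject≤ v u≤t) i x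
    blk (inj₂ v) (inj₂ w) = inject≤ v u≤t , inject≤ w u≤t

    blk-on : ∀ c x → grp c ≢ grp x → On (blk c x) c × On (blk c x) x
    blk-on (inj₁ ((i , _) , x)) (inj₁ ((i′ , _) , x′)) ne = intercept-on _ i x , gradient-on i x i′ x′ (λ e → ne (cong inj₁ e))
    blk-on (inj₁ ((i , _) , x)) (inj₂ v) ne = intercept-on _ i x , sym (Fin.toℕ-inject≤ v u≤t)
    blk-on (inj₂ v) (inj₁ ((i , _) , x)) ne = sym (Fin.toℕ-inject≤ v u≤t) , intercept-on _ i x
    blk-on (inj₂ v) (inj₂ w) ne = contradiction refl ne

    intercept-unique : ∀ {e f f′ i x} → x ≡ line (e , f) i → x ≡ line (e , f′) i → f ≡ f′
    intercept-unique {e} {f} {f′} {i} {x} d d′ = ≈⇒≡ (∣-combine (+ 1) (ℤ.- (+ 1)) (line-≈ d) (line-≈ d′) (identity ⟦ e ⟧ ⟦ i ⟧ ⟦ x ⟧ ⟦ f ⟧ ⟦ f′ ⟧))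
      where
      identity : ∀ e i x f f′ → f ℤ.- f′ ≡ + 1 ℤ.* (e ℤ.* i ℤ.+ f ℤ.- x) ℤ.+ (ℤ.- (+ 1)) ℤ.* (e ℤ.* i ℤ.+ f′ ℤ.- x)
      identity = ℤ-solve

    gradient-unique : ∀ {e f e′ f′ i i′ x x′} → i ≢ i′ → x ≡ line (e , f) i → x′ ≡ line (e , f) i′ →
      x ≡ line (e′ , f′) i → x′ ≡ line (e′ , f′) i′ → e ≡ e′
    gradient-unique {e} {f} {e′} {f′} {i} {i′} {x} {x′} ne d₁ d₂ d₃ d₄ = ≈⇒≡ (Unit.cancel (columns-unit ne) _
        (∣-combine (+ 1) (+ 1) (∣-combine (+ 1) (ℤ.- (+ 1)) (line-≈ d₁) (line-≈ d₂) refl)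
          (∣-combine (ℤ.- (+ 1)) (+ 1) (line-≈ d₃) (line-≈ d₄) refl)
          (identity ⟦ e ⟧ ⟦ e′ ⟧ ⟦ i ⟧ ⟦ i′ ⟧ ⟦ x ⟧ ⟦ x′ ⟧ ⟦ f ⟧ ⟦ f′ ⟧)))
      where
      identity : ∀ e e′ i i′ x x′ f f′ → (i ℤ.- i′) ℤ.* (e ℤ.- e′) ≡
        + 1 ℤ.* (+ 1 ℤ.* (e ℤ.* i ℤ.+ f ℤ.- x) ℤ.+ (ℤ.- (+ 1)) ℤ.* (e ℤ.* i′ ℤ.+ f ℤ.- x′)) ℤ.+
        + 1 ℤ.* ((ℤ.- (+ 1)) ℤ.* (e′ ℤ.* i ℤ.+ f′ ℤ.- x) ℤ.+ + 1 ℤ.* (e′ ℤ.* i′ ℤ.+ f′ ℤ.- x′))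
      identity = ℤ-solve

    block-≡ : ∀ {b b′ : Block} {i x} → proj₁ b ≡ proj₁ b′ → x ≡ line b i → x ≡ line b′ i → b ≡ b′
    block-≡ {e , f} {.e , f′} refl d d′ = cong (e ,_) (intercept-unique d d′)

    blk-uniq : ∀ {b b′} x y → grp x ≢ grp y → On b x → On b y → On b′ x → On b′ y → b ≡ b′
    blk-uniq {b} {b′} (inj₁ ((i , _) , x)) (inj₁ ((i′ , _) , x′)) ne d₁ d₂ d₃ d₄ =
      block-≡ {b} {b′} (gradient-unique {i = i} {i′} (λ e → ne (cong inj₁ e)) d₁ d₂ d₃ d₄) d₁ d₃
    blk-uniq {b} {b′} (inj₁ ((i , _) , x)) (inj₂ v) ne d₁ d₂ d₃ d₄ = block-≡ {b} {b′} (Fin.toℕ-injective (trans (sym d₂) d₄)) d₁ d₃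
    blk-uniq {b} {b′} (inj₂ v) (inj₁ ((i , _) , x)) ne d₁ d₂ d₃ d₄ = block-≡ {b} {b′} (Fin.toℕ-injective (trans (sym d₁) d₃)) d₂ d₄
    blk-uniq (inj₂ v) (inj₂ w) ne _ _ _ _ = contradiction refl ne

    groupWord : Point → Fin r → Point → Point
    groupWord (inj₁ ((i₀ , j₀) , x₀)) a (inj₁ ((i , j) , x)) = inj₁ ((i₀ , affine (slope 3 a) j₀ j) , affine (slope 2 a) x₀ x)
    groupWord (inj₂ v) a (inj₂ w) = inj₂ (Code.word codeᵘ v a w)
    -- Default value; a group word is only used inside its own group.
    groupWord c a _ = c

    private
      coords : ∀ {i i′ j j′ : Fin k} {x x′ : Fin t} → i ≡ i′ → j ≡ j′ → x ≡ x′ → inj₁ {B = Fin u} ((i , j) , x) ≡ inj₁ ((i′ , j′) , x′)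
      coords refl refl refl = refl
      ≡j : ∀ {i i′ j j′ : Fin k} {x x′ : Fin t} → inj₁ {B = Fin u} ((i , j) , x) ≡ inj₁ ((i′ , j′) , x′) → j ≡ j′
      ≡j refl = refl
      ≡x : ∀ {i i′ j j′ : Fin k} {x x′ : Fin t} → inj₁ {B = Fin u} ((i , j) , x) ≡ inj₁ ((i′ , j′) , x′) → x ≡ x′
      ≡x refl = refl

    gw-grp : ∀ c a x → grp c ≡ grp x → grp (groupWord c a x) ≡ grp c
    gw-grp (inj₁ _) a (inj₁ _) e = refl
    gw-grp (inj₂ _) a (inj₂ _) e = refl

    gw-fixed : ∀ c a → groupWord c a c ≡ c
    gw-fixed (inj₁ _) a = coords refl (affine-fixed _ _) (affine-fixed _ _)
    gw-fixed (inj₂ v) a = cong inj₂ (Code.fixed codeᵘ v a)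

    gw-unique : ∀ c a x → grp c ≡ grp x → groupWord c a x ≡ x → x ≡ c
    gw-unique (inj₁ _) a (inj₁ _) g e = coords (sym (inj₁-injective g)) (affine-unique (β-1-unit 1<3 a) (≡j e)) (affine-unique (γ-1-unit 1<2 a) (≡x e))
    gw-unique (inj₂ v) a (inj₂ w) g e = cong inj₂ (Code.unique codeᵘ v a w (inj₂-injective e))

    gw-inj : ∀ c a x y → grp c ≡ grp x → grp c ≡ grp y → groupWord c a x ≡ groupWord c a y → x ≡ y
    gw-inj (inj₁ _) a (inj₁ _) (inj₁ _) g h e = coords (inj₁-injective (trans (sym g) h)) (affine-injective (β-unit 0<3 a) (≡j e))
      (affine-injective (γ-unit 0<2 a) (≡x e))
    gw-inj (inj₂ v) a (inj₂ x) (inj₂ y) g h e = cong inj₂ (Code.injective codeᵘ v a (inj₂-injective e))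

    gw-agree : ∀ c a c′ a′ x y → grp c ≡ grp c′ → grp c ≡ grp x → grp c ≡ grp y →
      groupWord c a x ≡ groupWord c′ a′ x → groupWord c a y ≡ groupWord c′ a′ y → x ≡ y ⊎ (c ≡ c′ × a ≡ a′)
    gw-agree (inj₁ _) a (inj₁ _) a′ (inj₁ _) (inj₁ _) g h h′ e e′ = cases (a Fin.≟ a′)
      where
      cases : Dec (a ≡ a′) → _
      cases (yes refl) = inj₂ (coords (inj₁-injective g) (affine-centre (β-1-unit 1<3 a) (≡j e)) (affine-centre (γ-1-unit 1<2 a) (≡x e)) , refl)
      cases (no a≢) = inj₁ (coords (inj₁-injective (trans (sym h) h′)) (affine-slopes (βs-unit a≢) (≡j e) (≡j e′))
        (affine-slopes (γs-unit a≢) (≡x e) (≡x e′)))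
    gw-agree (inj₂ v) a (inj₂ v′) a′ (inj₂ x) (inj₂ y) g h h′ e e′ =
      [ (λ p → inj₁ (cong inj₂ p)) , (λ p → inj₂ (Product.map₁ (cong inj₂) p)) ]′
        (Code.agree codeᵘ v a v′ a′ x y (inj₂-injective e) (inj₂-injective e′))

    flagᵈ : {P : Set} → Dec P → Bool
    flagᵈ (yes _) = true
    flagᵈ (no _) = false

    below? : (b : Block) → Dec (toℕ (proj₁ b) < u)
    below? b = toℕ (proj₁ b) <? u

    flag : Block → Bool
    flag b = flagᵈ (below? b)

    -- Inverse of `shape` on a block. The decision is an argument so that it is the one `flag`
    -- reads; `d` is a default for an absent ∞.
    placeᵈ : (b : Block) → Dec (toℕ (proj₁ b) < u) → Point → X⁺ → Point
    placeᵈ b _ d (inj₁ p) = inj₁ (p , line b (proj₁ p))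
    placeᵈ b (yes e<u) d (inj₂ _) = inj₂ (fromℕ< e<u)
    placeᵈ b (no _) d (inj₂ _) = d

    placeᵈ-on : ∀ b e? d p → Present (flagᵈ e?) p → On b (placeᵈ b e? d p)
    placeᵈ-on b e? d (inj₁ p) _ = refl
    placeᵈ-on b (yes e<u) d (inj₂ _) _ = Fin.toℕ-fromℕ< e<u

    placeᵈ-shape : ∀ b e? d p → Present (flagᵈ e?) p → shape (placeᵈ b e? d p) ≡ p
    placeᵈ-shape b e? d (inj₁ p) _ = refl
    placeᵈ-shape b (yes _) d ∞ _ = refl

    on-presentᵈ : ∀ b e? p → On b p → Present (flagᵈ {toℕ (proj₁ b) < u} e?) (shape p)
    on-presentᵈ b (yes _) p _ = tt
    on-presentᵈ b (no _) (inj₁ _) _ = tt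
    on-presentᵈ b (no ≮) (inj₂ v) e = ≮ (subst (_< u) e (Fin.toℕ<n v))

    on-present : ∀ b p → On b p → Present (flag b) (shape p)
    on-present b = on-presentᵈ b (below? b)

    shape-injective : ∀ b p q → On b p → On b q → shape p ≡ shape q → p ≡ q
    shape-injective b (inj₁ (p , x)) (inj₁ (.p , y)) e e′ refl = cong (λ z → inj₁ (p , z)) (trans e (sym e′))
    shape-injective b (inj₂ v) (inj₂ w) e e′ _ = cong inj₂ (Fin.toℕ-injective (trans e (sym e′)))

    blockWord : Block → Point → Fin r → Point → Point
    blockWord b c a x = placeᵈ b (below? b) c (lword (flag b) (shape c) a (shape x))

    module _ {b c x} (a : Fin r) (onᶜ : On b c) (onˣ : On b x) where
      present : Present (flag b) (lword (flag b) (shape c) a (shape x))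
      present = lword-present (flag b) (shape c) a (shape x) (on-present b c onᶜ) (on-present b x onˣ)

      blockWord-shape : shape (blockWord b c a x) ≡ lword (flag b) (shape c) a (shape x)
      blockWord-shape = placeᵈ-shape b (below? b) c _ present

    same-shape : ∀ {b c a c′ a′ x y} → On b c → On b c′ → On b x → On b y → blockWord b c a x ≡ blockWord b c′ a′ y →
      lword (flag b) (shape c) a (shape x) ≡ lword (flag b) (shape c′) a′ (shape y)
    same-shape {a = a} {a′ = a′} o o′ p p′ e = trans (sym (blockWord-shape a o p)) (trans (cong shape e) (blockWord-shape a′ o′ p′))

    gddCode : GDDCode Point Group Block r
    gddCode = record
      { _≟ᴳ_ = Sum.≡-dec Fin._≟_ Fin._≟_
      ; grp = grp
      ; On = On
      ; blk = blk
      ; blk-on = blk-on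
      ; blk-uniq = blk-uniq
      ; gw = groupWord
      ; gw-grp = gw-grp
      ; gw-fixed = gw-fixed
      ; gw-unique = gw-unique
      ; gw-inj = gw-inj
      ; gw-agree = gw-agree
      ; lw = blockWord
      ; lw-on = λ b c a x o p ne → placeᵈ-on b (below? b) c _ (present a o p)
      ; lw-grpᶜ = λ b c a x o p ne e → lword-grpᶜ (flag b) (shape c) a (shape x) (on-present b c o) (on-present b x p) ne
          (trans e (cong gr (blockWord-shape a o p)))
      ; lw-grpˣ = λ b c a x o p ne e → lword-grpˣ (flag b) (shape c) a (shape x) (on-present b c o) (on-present b x p) ne
          (trans e (cong gr (blockWord-shape a o p)))
      ; lw-inj = λ b c a x y o p p′ ne ne′ e → shape-injective b x y p p′ (lword-inj (flag b) (shape c) a (shape x) (shape y)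
          (on-present b c o) (on-present b x p) (on-present b y p′) (same-shape o o p p′ e))
      ; lw-agree⁰ = λ b c a c′ a′ x o o′ p g ne e → Product.map₁ (shape-injective b c c′ o o′)
          (lword-agree⁰ (flag b) (shape c) a (shape c′) a′ (shape x) (on-present b c o) (on-present b c′ o′) (on-present b x p) g ne
            (same-shape o o′ p p e))
      ; lw-agree¹ = λ b c a c′ a′ x y o o′ p p′ g _ _ _ _ e e′ → shape-injective b x y p p′
          (lword-agree¹ (flag b) (shape c) a (shape c′) a′ (shape x) (shape y) (on-present b c o) (on-present b c′ o′)
            (on-present b x p) (on-present b y p′) g (same-shape o o′ p p e) (same-shape o o′ p′ p′ e′))
      }

    designCode : Code (Fin (k * k * t + u)) r
    designCode = transport (↔-sym iso) (gdd⇒code gddCode)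
      where
      iso : Fin (k * k * t + u) ↔ Point
      iso = (((Fin.*↔× {k} {k}) ×-↔ ↔-refl) ⊎-↔ ↔-refl) ↔-∘ ((Fin.*↔× {k * k} {t} ⊎-↔ ↔-refl) ↔-∘ Fin.+↔⊎ {k * k * t} {u})

open PermutationCodes

-- Finite sums

*-swap : ∀ a b c → a * (b * c) ≡ b * (a * c)
*-swap = solve-∀

∑ : ℕ → (ℕ → ℕ) → ℕ
∑ zero f = 0
∑ (suc n) f = ∑ n f + f n

∑-cong : ∀ n {f g} → (∀ i → i < n → f i ≡ g i) → ∑ n f ≡ ∑ n g
∑-cong zero e = refl
∑-cong (suc n) e = cong₂ _+_ (∑-cong n (λ i i<n → e i (m<n⇒m<1+n i<n))) (e n ≤-refl)

∑-mono : ∀ n {f g} → (∀ i → i < n → f i ≤ g i) → ∑ n f ≤ ∑ n g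
∑-mono zero e = z≤n
∑-mono (suc n) e = +-mono-≤ (∑-mono n (λ i i<n → e i (m<n⇒m<1+n i<n))) (e n ≤-refl)

∑-+ : ∀ n f g → ∑ n (λ i → f i + g i) ≡ ∑ n f + ∑ n g
∑-+ zero f g = refl
∑-+ (suc n) f g = trans (cong (_+ (f n + g n)) (∑-+ n f g)) (shuffle (∑ n f) (∑ n g) (f n) (g n))
  where
  shuffle : ∀ a b c d → a + b + (c + d) ≡ a + c + (b + d)
  shuffle = solve-∀

∑-*ˡ : ∀ n c f → ∑ n (λ i → c * f i) ≡ c * ∑ n f
∑-*ˡ zero c f = sym (*-zeroʳ c)
∑-*ˡ (suc n) c f = trans (cong (_+ c * f n) (∑-*ˡ n c f)) (sym (*-distribˡ-+ c (∑ n f) (f n)))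

∑-const : ∀ n c → ∑ n (λ _ → c) ≡ n * c
∑-const zero c = refl
∑-const (suc n) c = trans (cong (_+ c) (∑-const n c)) (+-comm (n * c) c)

∑-zero : ∀ n {f} → (∀ i → i < n → f i ≡ 0) → ∑ n f ≡ 0
∑-zero n e = trans (∑-cong n e) (trans (∑-const n 0) (*-zeroʳ n))

∑-swap : ∀ m n (f : ℕ → ℕ → ℕ) → ∑ m (λ i → ∑ n (f i)) ≡ ∑ n (λ j → ∑ m (λ i → f i j))
∑-swap zero n f = sym (∑-zero n (λ _ _ → refl))
∑-swap (suc m) n f = trans (cong (_+ ∑ n (f m)) (∑-swap m n f)) (sym (∑-+ n (λ j → ∑ m (λ i → f i j)) (f m)))

∑-split : ∀ m n f → ∑ (m + n) f ≡ ∑ m f + ∑ n (λ i → f (m + i))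
∑-split m zero f = trans (cong (λ k → ∑ k f) (+-identityʳ m)) (sym (+-identityʳ (∑ m f)))
∑-split m (suc n) f = trans (cong (λ k → ∑ k f) (+-suc m n))
  (trans (cong (_+ f (m + n)) (∑-split m n f)) (+-assoc (∑ m f) _ _))

∑-head : ∀ n f → ∑ (suc n) f ≡ f 0 + ∑ n (λ i → f (suc i))
∑-head n f = ∑-split 1 n f

∑-≤-extend : ∀ {m n} f → m ≤ n → ∑ m f ≤ ∑ n f
∑-≤-extend {m} {n} f m≤n = subst (λ k → ∑ m f ≤ ∑ k f) (m+[n∸m]≡n m≤n)
  (≤-trans (m≤m+n (∑ m f) _) (≤-reflexive (sym (∑-split m (n ∸ m) f))))

∑-positive : ∀ n {f} → 0 < ∑ n f → ∃ λ i → i < n × 0 < f i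
∑-positive (suc n) {f} pos with 0 <? f n
... | yes p = n , ≤-refl , p
... | no ¬p with i , i<n , p ← ∑-positive n {f} (subst (0 <_) (trans (cong (∑ n f +_) (n≤0⇒n≡0 (≮⇒≥ ¬p))) (+-identityʳ _)) pos)
  = i , m<n⇒m<1+n i<n , p

𝟙 : {P : Set} → Dec P → ℕ
𝟙 (yes _) = 1
𝟙 (no _) = 0

𝟙-yes : {P : Set} (d : Dec P) → P → 𝟙 d ≡ 1
𝟙-yes (yes _) _ = refl
𝟙-yes (no ¬p) p = contradiction p ¬p

𝟙-no : {P : Set} (d : Dec P) → ¬ P → 𝟙 d ≡ 0
𝟙-no (yes p) ¬p = contradiction p ¬p
𝟙-no (no _) _ = refl

𝟙≤1 : {P : Set} (d : Dec P) → 𝟙 d ≤ 1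
𝟙≤1 (yes _) = ≤-refl
𝟙≤1 (no _) = z≤n

𝟙-mono : {P R : Set} (d : Dec P) (e : Dec R) → (P → R) → 𝟙 d ≤ 𝟙 e
𝟙-mono (yes p) e h = ≤-reflexive (sym (𝟙-yes e (h p)))
𝟙-mono (no _) e h = z≤n

∑-point : ∀ n p c → p < n → ∑ n (λ i → 𝟙 (i ≟ p) * c) ≡ c
∑-point (suc n) p c p<1+n with n ≟ p
... | yes refl = trans (cong₂ _+_ (∑-zero n (λ i i<n → cong (_* c) (𝟙-no (i ≟ n) (<⇒≢ i<n)))) (+-identityʳ c)) refl
... | no n≢p = trans (+-identityʳ _) (∑-point n p c (≤∧≢⇒< (s≤s⁻¹ p<1+n) (λ e → n≢p (sym e))))

-- Primes

prime>1 : ∀ {p} → Prime p → 1 < p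
prime>1 {p} pp = nonTrivial⇒n>1 p {{prime⇒nonTrivial pp}}

prime-coprime : ∀ {p n} → Prime p → p ∤ n → Coprime p n
prime-coprime {p} pp p∤n {d} (d∣p , d∣n) with prime⇒irreducible pp d∣p
... | inj₁ e = e
... | inj₂ refl = contradiction d∣n p∤n

primeDivisor : ∀ n → 1 < n → ∃ λ p → Prime p × p ∣ n
primeDivisor n 1<n with factorise n {{>-nonZero (<-trans (s≤s z≤n) 1<n)}}
... | record { factors = [] ; isFactorisation = e } = contradiction e (λ e → <⇒≢ 1<n (sym e))
... | record { factors = p ∷ ps ; isFactorisation = e ; factorsPrime = pp ∷ _ } = p , pp , subst (p ∣_) (sym e) (m∣m*n _)

prime-∣-prime : ∀ {p q} → Prime p → Prime q → p ∣ q → p ≡ q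
prime-∣-prime pp pq p∣q with prime⇒irreducible pq p∣q
... | inj₁ refl = contradiction pp ¬prime[1]
... | inj₂ e = e

2^-positive : ∀ n → 0 < 2 ^ n
2^-positive n = m^n>0 2 n

n<2^n : ∀ n → n < 2 ^ n
n<2^n zero = s≤s z≤n
n<2^n (suc n) = ≤-trans (+-mono-≤ (2^-positive n) (n<2^n n)) (≤-reflexive (cong (2 ^ n +_) (sym (+-identityʳ _))))

-- The binary logarithm, rounded down

private
  lgSpec : ∀ m → ∃ λ l → 2 ^ l ≤ suc m × suc m < 2 ^ suc l
  lgSpec zero = 0 , ≤-refl , ≤-refl
  lgSpec (suc m) with l , lo , hi ← lgSpec m | suc (suc m) <? 2 ^ suc l
  ... | yes p = l , ≤-trans lo (n≤1+n _) , p
  ... | no p = suc l , ≮⇒≥ p , ≤-<-trans hi (^-monoʳ-< 2 (s≤s (s≤s z≤n)) (n<1+n (suc l)))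

opaque
  lg : ℕ → ℕ
  lg zero = 0
  lg (suc m) = proj₁ (lgSpec m)

  lg-lower : ∀ m → 0 < m → 2 ^ lg m ≤ m
  lg-lower (suc m) _ = proj₁ (proj₂ (lgSpec m))

  lg-upper : ∀ m → m < 2 ^ suc (lg m)
  lg-upper zero = s≤s z≤n
  lg-upper (suc m) = proj₂ (proj₂ (lgSpec m))

2^-reflects-≤ : ∀ m n → 2 ^ m ≤ 2 ^ n → m ≤ n
2^-reflects-≤ m n le = ≮⇒≥ (λ n<m → <⇒≱ (^-monoʳ-< 2 (s≤s (s≤s z≤n)) n<m) le)

2^-reflects-< : ∀ m n → 2 ^ m < 2 ^ n → m < n
2^-reflects-< m n lt = ≰⇒> (λ n≤m → <⇒≱ lt (^-monoʳ-≤ 2 n≤m))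

lg-≥ : ∀ {J m} → 2 ^ J ≤ m → J ≤ lg m
lg-≥ {J} {m} le = s≤s⁻¹ (2^-reflects-< J (suc (lg m)) (≤-<-trans le (lg-upper m)))

lg-< : ∀ {J m} → 0 < m → m < 2 ^ J → lg m < J
lg-< {J} {m} pos lt = 2^-reflects-< (lg m) J (≤-<-trans (lg-lower m pos) lt)

-- Multiples, prime divisors and valuations

multiples : ℕ → ℕ → ℕ
multiples d x = ∑ x (λ i → 𝟙 (d ∣? suc i))

multiples-upper : ∀ d x → multiples d x * d ≤ x
multiples-upper d zero = z≤n
multiples-upper d (suc x) with d ∣? suc x
... | no _ = ≤-trans (≤-reflexive (cong (_* d) (+-identityʳ (multiples d x)))) (≤-trans (multiples-upper d x) (n≤1+n x))
... | yes (divides q e) = ≤-trans (*-monoˡ-≤ d (≤-trans (≤-reflexive (+-comm _ 1))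
        (*-cancelʳ-< d (multiples d x) q (≤-<-trans (multiples-upper d x) (≤-reflexive e))))) (≤-reflexive (sym e))

multiples-lower : ∀ d x → 0 < d → x < suc (multiples d x) * d
multiples-lower d zero 0<d = ≤-trans 0<d (≤-reflexive (sym (+-identityʳ d)))
multiples-lower d (suc x) 0<d with d ∣? suc x
... | no d∤ = subst (λ c → suc x < suc c * d) (sym (+-identityʳ (multiples d x)))
        (≤∧≢⇒< (multiples-lower d x 0<d) (λ e → d∤ (divides (suc (multiples d x)) e)))
... | yes _ = ≤-trans (+-mono-≤ 0<d (multiples-lower d x 0<d)) (≤-reflexive (cong (λ c → d + (c * d)) (+-comm 1 (multiples d x))))

pr : ℕ → ℕ
pr p = 𝟙 (prime? p)

pr-no : ∀ {p} → ¬ Prime p → pr p ≡ 0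
pr-no = 𝟙-no (prime? _)

-- ∏ of the primes p < y dividing m divides m.
∏primes≤ : ∀ m → 0 < m → ∀ y → 2 ^ ∑ y (λ p → lg p * (pr p * 𝟙 (p ∣? m))) ≤ m
∏primes≤ m 0<m y = ≤-trans (proj₁ (proj₂ (proj₂ (go y)))) (∣⇒≤ {{>-nonZero 0<m}} (proj₁ (proj₂ (go y))))
  where
  F : ℕ → ℕ
  F p = lg p * (pr p * 𝟙 (p ∣? m))
  -- Here d collects the primes below y that divide m. The last component keeps d prime to all later
  -- primes, so the next prime divisor of m still divides m / d.
  go : ∀ y → ∃ λ d → d ∣ m × 2 ^ ∑ y F ≤ d × (∀ p → Prime p → y ≤ p → p ∤ d)
  go zero = 1 , 1∣ m , ≤-refl , λ p pp _ p∣1 → <⇒≱ (prime>1 pp) (∣⇒≤ p∣1)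
  go (suc y) with d , d∣m , le , no-larger ← go y | prime? y | y ∣? m
  ... | no ¬py | _ = d , d∣m , ≤-trans (≤-reflexive (cong (λ z → 2 ^ (∑ y F + z)) (*-zeroʳ (lg y))) ) (≤-trans (≤-reflexive (cong (2 ^_) (+-identityʳ (∑ y F)))) le) ,
                     λ p pp y<p → no-larger p pp (<⇒≤ y<p)
  ... | yes py | no y∤m = d , d∣m , ≤-trans (≤-reflexive (cong (λ z → 2 ^ (∑ y F + z)) (*-zeroʳ (lg y))) ) (≤-trans (≤-reflexive (cong (2 ^_) (+-identityʳ (∑ y F)))) le) ,
                     λ p pp y<p → no-larger p pp (<⇒≤ y<p)
  ... | yes py | yes y∣m = d * y , dy∣m , size , larger
    where
    dy∣m : d * y ∣ m
    dy∣m = subst (d * y ∣_) (trans (*-comm d q) (sym m≡qd)) (*-monoʳ-∣ d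
      (coprime-divisor (prime-coprime py (no-larger y py ≤-refl)) (subst (y ∣_) (trans m≡qd (*-comm q d)) y∣m)))
      where
      q = _∣_.quotient d∣m
      m≡qd : m ≡ q * d
      m≡qd = _∣_.equality d∣m
    size : 2 ^ (∑ y F + lg y * 1) ≤ d * y
    size = ≤-trans (≤-reflexive (trans (cong (λ z → 2 ^ (∑ y F + z)) (*-identityʳ (lg y))) (^-distribˡ-+-* 2 (∑ y F) (lg y))))
      (*-mono-≤ le (lg-lower y (<-trans (s≤s z≤n) (prime>1 py))))
    larger : ∀ p → Prime p → suc y ≤ p → p ∤ d * y
    larger p pp y<p p∣dy with euclidsLemma d y pp p∣dy
    ... | inj₁ p∣d = no-larger p pp (<⇒≤ y<p) p∣d
    ... | inj₂ p∣y = <⇒≢ y<p (sym (prime-∣-prime pp py p∣y))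

valuation : ℕ → ℕ → ℕ → ℕ
valuation J p m = ∑ J (λ a → 𝟙 (p ^ suc a ∣? m))

valuation-mono : ∀ J p {m n} → m ∣ n → valuation J p m ≤ valuation J p n
valuation-mono J p m∣n = ∑-mono J (λ a _ → 𝟙-mono (p ^ suc a ∣? _) (p ^ suc a ∣? _) (λ q → ∣-trans q m∣n))

valuation-step : ∀ J p m → 0 < m → m < p ^ suc J → suc (valuation (suc J) p m) ≤ valuation (suc J) p (p * m)
valuation-step J p m 0<m m< = begin
  suc (valuation J p m + 𝟙 (p ^ suc J ∣? m))
    ≡⟨ cong (λ z → suc (valuation J p m + z)) (𝟙-no (p ^ suc J ∣? m) (>⇒∤ {{>-nonZero 0<m}} m<)) ⟩
  suc (valuation J p m + 0) ≡⟨ cong suc (+-identityʳ _) ⟩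
  1 + valuation J p m ≤⟨ +-mono-≤ (≤-reflexive (sym (𝟙-yes (p ^ 1 ∣? p * m) (subst (_∣ p * m) (sym (*-identityʳ p)) (m∣m*n m)))))
      (∑-mono J (λ a _ → 𝟙-mono (p ^ suc a ∣? m) (p ^ suc (suc a) ∣? p * m) (*-monoʳ-∣ p))) ⟩
  𝟙 (p ^ 1 ∣? p * m) + ∑ J (λ a → 𝟙 (p ^ suc (suc a) ∣? p * m)) ≡⟨ sym (∑-head J (λ a → 𝟙 (p ^ suc a ∣? p * m))) ⟩
  valuation (suc J) p (p * m) ∎
  where open ≤-Reasoning

-- The logarithm of m from its factorisation, with log₂ p rounded up to `suc (lg p)`, so that 2 to
-- this power is at least m. `lg` itself rounds down and serves the opposite estimate.
weight : ℕ → ℕ → ℕ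
weight J m = ∑ (2 ^ J) (λ p → suc (lg p) * (pr p * valuation J p m))

weight-step : ∀ J p m → Prime p → 0 < m → p * m < 2 ^ suc J → weight (suc J) m + suc (lg p) ≤ weight (suc J) (p * m)
weight-step J p m pp 0<m pm< = begin
  weight (suc J) m + suc (lg p) ≡⟨ cong (weight (suc J) m +_) (sym (∑-point (2 ^ suc J) p (suc (lg p)) p<)) ⟩
  weight (suc J) m + ∑ (2 ^ suc J) (λ i → 𝟙 (i ≟ p) * suc (lg p)) ≡⟨ sym (∑-+ (2 ^ suc J) _ _) ⟩
  ∑ (2 ^ suc J) (λ q → suc (lg q) * (pr q * valuation (suc J) q m) + 𝟙 (q ≟ p) * suc (lg p))
    ≤⟨ ∑-mono (2 ^ suc J) (λ q _ → term q) ⟩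
  weight (suc J) (p * m) ∎
  where
  open ≤-Reasoning
  instance
    _ : NonZero m
    _ = >-nonZero 0<m
    _ : NonZero p
    _ = prime⇒nonZero pp
  p< : p < 2 ^ suc J
  p< = ≤-<-trans (m≤m*n p m) pm<
  m< : m < p ^ suc J
  m< = <-≤-trans (≤-<-trans (m≤n*m m p) pm<) (^-monoˡ-≤ (suc J) (prime>1 pp))
  term : ∀ q → suc (lg q) * (pr q * valuation (suc J) q m) + 𝟙 (q ≟ p) * suc (lg p) ≤ suc (lg q) * (pr q * valuation (suc J) q (p * m))
  term q with q ≟ p
  ... | no _ = ≤-trans (≤-reflexive (+-identityʳ _)) (*-monoʳ-≤ (suc (lg q)) (*-monoʳ-≤ (pr q) (valuation-mono (suc J) q (n∣m*n p))))
  ... | yes refl = ≤-trans (≤-reflexive (trans (cong (λ z → suc (lg q) * (z * valuation (suc J) q m) + 1 * suc (lg q)) pr≡1) (shuffle (suc (lg q)) (valuation (suc J) q m))))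
          (≤-trans (*-monoʳ-≤ (suc (lg q)) (valuation-step J q m 0<m m<)) (≤-reflexive (cong (suc (lg q) *_)
            (trans (sym (*-identityˡ _)) (cong (_* valuation (suc J) q (q * m)) (sym pr≡1))))))
    where
    pr≡1 : pr q ≡ 1
    pr≡1 = 𝟙-yes (prime? q) pp
    shuffle : ∀ l v → l * (1 * v) + 1 * l ≡ l * suc v
    shuffle = solve-∀

≤2^weight : ∀ J m → 0 < m → m < 2 ^ suc J → m ≤ 2 ^ weight (suc J) m
≤2^weight J = <-rec _ step
  where
  step : ∀ m → (∀ {n} → n < m → 0 < n → n < 2 ^ suc J → n ≤ 2 ^ weight (suc J) n) → 0 < m → m < 2 ^ suc J → m ≤ 2 ^ weight (suc J) m
  step 1 rec _ _ = 2^-positive (weight (suc J) 1)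
  step m@(suc (suc _)) rec 0<m m< with p , pp , divides n e ← primeDivisor m (s≤s (s≤s z≤n)) = begin
    m ≡⟨ m≡ ⟩
    p * n ≤⟨ *-mono-≤ (<⇒≤ (lg-upper p)) (rec n<m 0<n (<-trans n<m m<)) ⟩
    2 ^ suc (lg p) * 2 ^ weight (suc J) n ≡⟨ sym (^-distribˡ-+-* 2 (suc (lg p)) (weight (suc J) n)) ⟩
    2 ^ (suc (lg p) + weight (suc J) n)
      ≤⟨ ^-monoʳ-≤ 2 (≤-trans (≤-reflexive (+-comm (suc (lg p)) _)) (weight-step J p n pp 0<n (subst (_< 2 ^ suc J) m≡ m<))) ⟩
    2 ^ weight (suc J) (p * n) ≡⟨ cong (λ z → 2 ^ weight (suc J) z) (sym m≡) ⟩
    2 ^ weight (suc J) m ∎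
    where
    open ≤-Reasoning
    m≡ : m ≡ p * n
    m≡ = trans e (*-comm n p)
    0<n : 0 < n
    0<n = n≢0⇒n>0 (λ { refl → contradiction e λ () })
    n<m : n < m
    n<m = <-≤-trans (m<n*m n p {{>-nonZero 0<n}} (prime>1 pp)) (≤-reflexive (sym m≡))
      where
      m<n*m : ∀ m n .{{_ : NonZero m}} → 1 < n → m < n * m
      m<n*m m n 1<n = <-≤-trans (≤-reflexive (cong suc (sym (*-identityˡ m)))) (*-monoˡ-< m 1<n)

-- Mertens' estimates

∑-below : ∀ n m c → ∑ n (λ i → 𝟙 (i <? m) * c) ≤ m * c
∑-below zero m c = z≤n
∑-below (suc n) m c with n <? m
... | no _ = ≤-trans (≤-reflexive (+-identityʳ _)) (∑-below n m c)
... | yes n<m = ≤-trans (+-mono-≤ (∑-≤-const n) (≤-reflexive (+-identityʳ c)))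
        (≤-trans (≤-reflexive (+-comm (n * c) c)) (*-monoˡ-≤ c n<m))
  where
  ∑-≤-const : ∀ n → ∑ n (λ i → 𝟙 (i <? m) * c) ≤ n * c
  ∑-≤-const n = ≤-trans (∑-mono n (λ i _ → ≤-trans (*-monoˡ-≤ c (𝟙≤1 (i <? m))) (≤-reflexive (+-identityʳ c)))) (≤-reflexive (∑-const n c))

-- With q = p₁ + 1 this is the geometric series (q - 1) ∑ x / q^(a+1) = x - x / q^L, multiplied by
-- q^L.
geometric : ∀ p₁ x (c : ℕ → ℕ) → (∀ a → c a * suc p₁ ^ suc a ≤ x) → ∀ L → suc p₁ ^ L * (p₁ * ∑ L c) + x ≤ x * suc p₁ ^ L
geometric p₁ x c bound zero = ≤-reflexive (trans (cong (λ z → z + 0 + x) (*-zeroʳ p₁)) (sym (*-identityʳ x)))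
geometric p₁ x c bound (suc L) = begin
  suc p₁ * q * (p₁ * (∑ L c + c L)) + x ≡⟨ shuffle₁ p₁ q (∑ L c) (c L) x ⟩
  suc p₁ * (q * (p₁ * ∑ L c)) + p₁ * (c L * (suc p₁ * q)) + x
    ≤⟨ +-monoˡ-≤ x (+-monoʳ-≤ (suc p₁ * (q * (p₁ * ∑ L c))) (*-monoʳ-≤ p₁ (bound L))) ⟩
  suc p₁ * (q * (p₁ * ∑ L c)) + p₁ * x + x ≡⟨ shuffle₂ p₁ (q * (p₁ * ∑ L c)) x ⟩
  suc p₁ * (q * (p₁ * ∑ L c) + x) ≤⟨ *-monoʳ-≤ (suc p₁) (geometric p₁ x c bound L) ⟩
  suc p₁ * (x * q) ≡⟨ shuffle₃ p₁ x q ⟩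
  x * (suc p₁ * q) ∎
  where
  open ≤-Reasoning
  q = suc p₁ ^ L
  shuffle₁ : ∀ p q s c x → suc p * q * (p * (s + c)) + x ≡ suc p * (q * (p * s)) + p * (c * (suc p * q)) + x
  shuffle₁ = solve-∀
  shuffle₂ : ∀ p s x → suc p * s + p * x + x ≡ suc p * (s + x)
  shuffle₂ = solve-∀
  shuffle₃ : ∀ p x q → suc p * (x * q) ≡ x * (suc p * q)
  shuffle₃ = solve-∀

geometric-bound : ∀ p₁ x (c : ℕ → ℕ) → (∀ a → c a * suc p₁ ^ suc a ≤ x) → ∀ L → p₁ * ∑ L c ≤ x
geometric-bound p₁ x c bound L = *-cancelˡ-≤ (suc p₁ ^ L) {{m^n≢0 (suc p₁) L}}
  (≤-trans (≤-trans (m≤m+n _ x) (geometric p₁ x c bound L)) (≤-reflexive (*-comm x _)))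

-- harmonic₁ n / harmonic₀ n = 1/79 + … + 1/(78+n).
opaque
  harmonic₀ : ℕ → ℕ
  harmonic₀ zero = 1
  harmonic₀ (suc n) = harmonic₀ n * (79 + n)

  harmonic₁ : ℕ → ℕ
  harmonic₁ zero = 0
  harmonic₁ (suc n) = harmonic₁ n * (79 + n) + harmonic₀ n

  harmonic₀-positive : ∀ n → 0 < harmonic₀ n
  harmonic₀-positive zero = s≤s z≤n
  harmonic₀-positive (suc n) = *-mono-≤ (harmonic₀-positive n) (s≤s z≤n)

  -- The hypothesis bounds each increment of a by K / (E (79 + i)); the increments are summed over
  -- the common denominator `harmonic₀`.
  harmonic-chain : ∀ E K (a : ℕ → ℕ) n → (∀ i → i < n → E * ((79 + i) * a (80 + i)) ≤ E * ((79 + i) * a (79 + i)) + K) →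
    harmonic₀ n * (E * a (79 + n)) ≤ harmonic₀ n * (E * a 79) + K * harmonic₁ n
  harmonic-chain E K a zero _ = m≤m+n _ _
  harmonic-chain E K a (suc n) step = begin
    d * m * (E * a (80 + n)) ≡⟨ shuffle₁ d m E (a (80 + n)) ⟩
    d * (E * (m * a (80 + n))) ≤⟨ *-monoʳ-≤ d (step n ≤-refl) ⟩
    d * (E * (m * a (79 + n)) + K) ≡⟨ shuffle₂ d m E (a (79 + n)) K ⟩
    m * (d * (E * a (79 + n))) + K * d
      ≤⟨ +-monoˡ-≤ (K * d) (*-monoʳ-≤ m (harmonic-chain E K a n (λ i i<n → step i (m<n⇒m<1+n i<n)))) ⟩
    m * (d * (E * a 79) + K * h) + K * d ≡⟨ shuffle₃ d m E (a 79) K h ⟩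
    d * m * (E * a 79) + K * (h * m + d) ∎
    where
    open ≤-Reasoning
    d h m : ℕ
    d = harmonic₀ n
    h = harmonic₁ n
    m = 79 + n
    shuffle₁ : ∀ d m E a → d * m * (E * a) ≡ d * (E * (m * a))
    shuffle₁ = solve-∀
    shuffle₂ : ∀ d m E a K → d * (E * (m * a) + K) ≡ m * (d * (E * a)) + K * d
    shuffle₂ = solve-∀
    shuffle₃ : ∀ d m E a K h → m * (d * (E * a) + K * h) + K * d ≡ d * m * (E * a) + K * (h * m + d)
    shuffle₃ = solve-∀

-- The reciprocals 1/p are represented by I p = Q/p for a common multiple Q of the primes below B.
module Mertens (B Q : ℕ) (0<Q : 0 < Q) (I : ℕ → ℕ) (I-prime : ∀ {p} → Prime p → p < B → p * I p ≡ Q)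
  (I-other : ∀ {p} → ¬ Prime p → I p ≡ 0) where

  S : ℕ → ℕ
  S J = ∑ (2 ^ J) (λ p → lg p * I p)

  -- The prime divisors p < 2^J of any i ≤ x = 2^(ν + J) satisfy ∑ lg p ≤ log₂ i ≤ ν + J; this is
  -- summed over i. Counting multiples of p instead of x / p loses at most one per prime, and 1 ≤
  -- 2^-ν x / p because p < 2^J.
  upper : ∀ ν J → 2 ^ J ≤ B → 2 ^ ν * S J ≤ 2 ^ ν * (Q * (ν + J)) + S J
  upper ν J 2^J≤B = *-cancelˡ-≤ x {{m^n≢0 2 (ν + J)}} (begin
    x * (N * S J) ≡⟨ sym (trans (∑-*ˡ (2 ^ J) x _) (cong (x *_) (∑-*ˡ (2 ^ J) N _))) ⟩
    ∑ (2 ^ J) (λ p → x * (N * (lg p * I p))) ≤⟨ ∑-mono (2 ^ J) term ⟩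
    ∑ (2 ^ J) (λ p → N * Q * (lg p * (pr p * multiples p x)) + x * (lg p * I p)) ≡⟨ ∑-+ (2 ^ J) _ _ ⟩
    ∑ (2 ^ J) (λ p → N * Q * (lg p * (pr p * multiples p x))) + ∑ (2 ^ J) (λ p → x * (lg p * I p))
      ≡⟨ cong₂ _+_ (∑-*ˡ (2 ^ J) (N * Q) _) (∑-*ˡ (2 ^ J) x _) ⟩
    N * Q * ∑ (2 ^ J) (λ p → lg p * (pr p * multiples p x)) + x * S J ≤⟨ +-monoˡ-≤ (x * S J) (*-monoʳ-≤ (N * Q) total) ⟩
    N * Q * (x * (ν + J)) + x * S J ≡⟨ shuffle N Q x (ν + J) (S J) ⟩
    x * (N * (Q * (ν + J)) + S J) ∎)
    where
    open ≤-Reasoning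
    N = 2 ^ ν
    x = 2 ^ (ν + J)
    shuffle : ∀ N Q x j s → N * Q * (x * j) + x * s ≡ x * (N * (Q * j) + s)
    shuffle = solve-∀
    term : ∀ p → p < 2 ^ J → x * (N * (lg p * I p)) ≤ N * Q * (lg p * (pr p * multiples p x)) + x * (lg p * I p)
    term p p<2^J with prime? p
    ... | no ¬pp = ≤-trans (≤-reflexive (trans (cong (λ z → x * (N * (lg p * z))) (I-other ¬pp)) (zeros x N (lg p)))) z≤n
      where
      zeros : ∀ x N l → x * (N * (l * 0)) ≡ 0
      zeros = solve-∀
    ... | yes pp = begin
      x * (N * (lg p * I p)) ≡⟨ shuffle₁ x N (lg p) (I p) ⟩
      lg p * (N * (x * I p)) ≤⟨ *-monoʳ-≤ (lg p) (*-monoʳ-≤ N xI≤) ⟩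
      lg p * (N * (c * Q + Q)) ≡⟨ shuffle₂ (lg p) N c Q ⟩
      N * Q * (lg p * (1 * c)) + lg p * (N * Q) ≤⟨ +-monoʳ-≤ (N * Q * (lg p * (1 * c))) (*-monoʳ-≤ (lg p) NQ≤) ⟩
      N * Q * (lg p * (1 * c)) + lg p * (x * I p) ≡⟨ cong (N * Q * (lg p * (1 * c)) +_) (shuffle₃ (lg p) x (I p)) ⟩
      N * Q * (lg p * (1 * c)) + x * (lg p * I p) ∎
      where
      c = multiples p x
      pI : p * I p ≡ Q
      pI = I-prime pp (<-≤-trans p<2^J 2^J≤B)
      xI≤ : x * I p ≤ c * Q + Q
      xI≤ = begin
        x * I p ≤⟨ *-monoˡ-≤ (I p) (<⇒≤ (multiples-lower p x (<-trans (s≤s z≤n) (prime>1 pp)))) ⟩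
        suc c * p * I p ≡⟨ *-assoc (suc c) p (I p) ⟩
        suc c * (p * I p) ≡⟨ cong (suc c *_) pI ⟩
        Q + c * Q ≡⟨ +-comm Q (c * Q) ⟩
        c * Q + Q ∎
      NQ≤ : N * Q ≤ x * I p
      NQ≤ = begin
        N * Q ≡⟨ cong (N *_) (sym pI) ⟩
        N * (p * I p) ≡⟨ sym (*-assoc N p (I p)) ⟩
        N * p * I p ≤⟨ *-monoˡ-≤ (I p) (*-monoʳ-≤ N (<⇒≤ p<2^J)) ⟩
        N * 2 ^ J * I p ≡⟨ cong (_* I p) (sym (^-distribˡ-+-* 2 ν J)) ⟩
        x * I p ∎
      shuffle₁ : ∀ x N l i → x * (N * (l * i)) ≡ l * (N * (x * i))
      shuffle₁ = solve-∀
      shuffle₂ : ∀ l N c Q → l * (N * (c * Q + Q)) ≡ N * Q * (l * (1 * c)) + l * (N * Q)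
      shuffle₂ = solve-∀
      shuffle₃ : ∀ l x i → l * (x * i) ≡ x * (l * i)
      shuffle₃ = solve-∀
    total : ∑ (2 ^ J) (λ p → lg p * (pr p * multiples p x)) ≤ x * (ν + J)
    total = begin
      ∑ (2 ^ J) (λ p → lg p * (pr p * multiples p x))
        ≡⟨ ∑-cong (2 ^ J) (λ p _ → sym (trans (∑-*ˡ x (lg p) _) (cong (lg p *_) (∑-*ˡ x (pr p) _)))) ⟩
      ∑ (2 ^ J) (λ p → ∑ x (λ i → lg p * (pr p * 𝟙 (p ∣? suc i)))) ≡⟨ ∑-swap (2 ^ J) x _ ⟩
      ∑ x (λ i → ∑ (2 ^ J) (λ p → lg p * (pr p * 𝟙 (p ∣? suc i))))
        ≤⟨ ∑-mono x (λ i i<x → 2^-reflects-≤ _ (ν + J) (≤-trans (∏primes≤ (suc i) (s≤s z≤n) (2 ^ J)) i<x)) ⟩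
      ∑ x (λ _ → ν + J) ≡⟨ ∑-const x (ν + J) ⟩
      x * (ν + J) ∎

  private
    pred2^ : ∀ n → ∃ λ m → suc m ≡ 2 ^ n
    pred2^ n with 2 ^ n | 2^-positive n
    ... | suc m | _ = m , refl

  module _ (J′ c : ℕ) (0<c : 0 < c) (2^J≤B : 2 ^ suc J′ ≤ B) where
    private
      J = suc J′
      N = 2 ^ J
      x = proj₁ (pred2^ J)
      x+1 : suc x ≡ N
      x+1 = proj₂ (pred2^ J)
      Y : ℕ → ℕ
      Y p = ∑ J (λ a → multiples (p ^ suc a) x)
      x≤N : x ≤ N
      x≤N = ≤-trans (n≤1+n x) (≤-reflexive x+1)

      Y-bound : ∀ p₁ → p₁ * Y (suc p₁) ≤ N
      Y-bound p₁ = ≤-trans (geometric-bound p₁ x (λ a → multiples (suc p₁ ^ suc a) x) (λ a → multiples-upper (suc p₁ ^ suc a) x) J) x≤N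

    -- An upper approximation of log₂ (x!), arranged by primes as in Legendre's formula. The choice
    -- x = 2^J - 1 keeps all summands below 2^J.
    weights : ℕ
    weights = ∑ x (λ i → weight J (suc i))

    private
      weights-swap : weights ≡ ∑ N (λ p → suc (lg p) * (pr p * Y p))
      weights-swap = begin
        ∑ x (λ i → ∑ N (λ p → suc (lg p) * (pr p * valuation J p (suc i)))) ≡⟨ ∑-swap x N _ ⟩
        ∑ N (λ p → ∑ x (λ i → suc (lg p) * (pr p * valuation J p (suc i)))) ≡⟨ ∑-cong N (λ p _ → trans (∑-*ˡ x (suc (lg p)) _)
            (cong (suc (lg p) *_) (trans (∑-*ˡ x (pr p) _) (cong (pr p *_) (∑-swap x J _))))) ⟩
        ∑ N (λ p → suc (lg p) * (pr p * Y p)) ∎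
        where open ≡-Reasoning

      -- Primes below 2^c are charged a fixed amount. Above 2^c, replacing `suc (lg p)` by `lg p`
      -- and p - 1 by p costs a factor (c + 1)/c each.
      term : ∀ p → p < N → c * c * Q * (suc (lg p) * (pr p * Y p)) ≤ 𝟙 (p <? 2 ^ c) * (c * c * c * Q * N) + suc c * suc c * N * (lg p * I p)
      term p p<N with prime? p
      ... | no _ = ≤-trans (≤-reflexive (zeros (c * c * Q) (suc (lg p)))) z≤n
        where
        zeros : ∀ a b → a * (b * 0) ≡ 0
        zeros = solve-∀
      ... | yes pp with p <? 2 ^ c
      ...   | yes p<2^c = ≤-trans (≤-trans (*-monoʳ-≤ (c * c * Q) (*-mono-≤ (lg-< {c} (<-trans (s≤s z≤n) (prime>1 pp)) p<2^c) (Y≤N p (prime>1 pp))))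
                            (≤-reflexive (shuffle c Q N))) (m≤m+n _ _)
        where
        Y≤N : ∀ p → 1 < p → 1 * Y p ≤ N
        Y≤N (suc p₁) (s≤s 1≤p₁) = ≤-trans (*-monoˡ-≤ (Y (suc p₁)) 1≤p₁) (Y-bound p₁)
        shuffle : ∀ c Q N → c * c * Q * (c * N) ≡ 1 * (c * c * c * Q * N)
        shuffle = solve-∀
      ...   | no p≮2^c = begin
        c * c * Q * (suc (lg p) * (1 * Y p)) ≡⟨ shuffle₁ c Q (lg p) (Y p) ⟩
        (c * suc (lg p)) * (c * Y p * Q) ≤⟨ *-mono-≤ lgs (cYQ p pp p<N (≤-trans (n<2^n c) (≮⇒≥ p≮2^c))) ⟩
        (suc c * lg p) * (suc c * N * I p) ≡⟨ shuffle₂ c (lg p) N (I p) ⟩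
        suc c * suc c * N * (lg p * I p) ∎
        where
        open ≤-Reasoning
        lgs : c * suc (lg p) ≤ suc c * lg p
        lgs = ≤-trans (≤-reflexive (*-suc c (lg p))) (+-monoˡ-≤ (c * lg p) (lg-≥ (≮⇒≥ p≮2^c)))
        shuffle₁ : ∀ c Q l y → c * c * Q * (suc l * (1 * y)) ≡ (c * suc l) * (c * y * Q)
        shuffle₁ = solve-∀
        shuffle₂ : ∀ c l N i → (suc c * l) * (suc c * N * i) ≡ suc c * suc c * N * (l * i)
        shuffle₂ = solve-∀
        shuffle₃ : ∀ p c y Q → p * (c * y * Q) ≡ c * Q * (p * y)
        shuffle₃ = solve-∀
        shuffle₄ : ∀ c p i N → c * (suc p * i) * N ≡ (c + c * p) * (N * i)
        shuffle₄ = solve-∀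
        shuffle₅ : ∀ c p i N → (p + c * p) * (N * i) ≡ p * (suc c * N * i)
        shuffle₅ = solve-∀
        cYQ : ∀ p → Prime p → p < N → suc c ≤ p → c * Y p * Q ≤ suc c * N * I p
        cYQ zero pp = contradiction pp ¬prime[0]
        cYQ p@(suc p₁) pp p<N c<p = *-cancelˡ-≤ p₁ {{>-nonZero (s≤s⁻¹ (prime>1 pp))}} (begin
          p₁ * (c * Y p * Q) ≡⟨ shuffle₃ p₁ c (Y p) Q ⟩
          c * Q * (p₁ * Y p) ≤⟨ *-monoʳ-≤ (c * Q) (Y-bound p₁) ⟩
          c * Q * N ≡⟨ cong (λ z → c * z * N) (sym (I-prime pp (<-≤-trans p<N 2^J≤B))) ⟩
          c * (suc p₁ * I p) * N ≡⟨ shuffle₄ c p₁ (I p) N ⟩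
          (c + c * p₁) * (N * I p) ≤⟨ *-monoˡ-≤ (N * I p) (+-monoˡ-≤ (c * p₁) (s≤s⁻¹ c<p)) ⟩
          (p₁ + c * p₁) * (N * I p) ≡⟨ shuffle₅ c p₁ (I p) N ⟩
          p₁ * (suc c * N * I p) ∎)

    weights-upper : c * c * Q * weights ≤ 2 ^ c * (c * c * c * Q * N) + suc c * suc c * N * S J
    weights-upper = begin
      c * c * Q * weights ≡⟨ trans (cong (c * c * Q *_) weights-swap) (sym (∑-*ˡ N (c * c * Q) _)) ⟩
      ∑ N (λ p → c * c * Q * (suc (lg p) * (pr p * Y p))) ≤⟨ ∑-mono N term ⟩
      ∑ N (λ p → 𝟙 (p <? 2 ^ c) * (c * c * c * Q * N) + suc c * suc c * N * (lg p * I p)) ≡⟨ ∑-+ N _ _ ⟩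
      ∑ N (λ p → 𝟙 (p <? 2 ^ c) * (c * c * c * Q * N)) + ∑ N (λ p → suc c * suc c * N * (lg p * I p)) ≤⟨ +-mono-≤
          (∑-below N (2 ^ c) (c * c * c * Q * N)) (≤-reflexive (∑-*ˡ N (suc c * suc c * N) _)) ⟩
      2 ^ c * (c * c * c * Q * N) + suc c * suc c * N * S J ∎
      where open ≤-Reasoning

    -- Every i from 2^K up to x has weight at least K, and only the terms below 2^K are given up.
    weights-lower : ∀ K → K ≤ J → N * K ≤ weights + 2 ^ K * K
    weights-lower K K≤J = begin
      N * K ≡⟨ cong (_* K) (sym (trans (cong (λ z → suc z) (m+[n∸m]≡n y≤x)) x+1)) ⟩
      suc (y + l) * K ≡⟨ cong (λ z → (z + l) * K) y+1 ⟩
      (2 ^ K + l) * K ≡⟨ trans (*-distribʳ-+ K (2 ^ K) l) (+-comm (2 ^ K * K) (l * K)) ⟩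
      l * K + 2 ^ K * K ≤⟨ +-monoˡ-≤ (2 ^ K * K) (begin
        l * K ≡⟨ sym (∑-const l K) ⟩
        ∑ l (λ _ → K) ≤⟨ ∑-mono l heavy ⟩
        ∑ l (λ i → weight J (suc (y + i))) ≤⟨ m≤n+m _ (∑ y (λ i → weight J (suc i))) ⟩
        ∑ y (λ i → weight J (suc i)) + ∑ l (λ i → weight J (suc (y + i))) ≡⟨ sym (∑-split y l (λ i → weight J (suc i))) ⟩
        ∑ (y + l) (λ i → weight J (suc i)) ≡⟨ cong (λ z → ∑ z (λ i → weight J (suc i))) (m+[n∸m]≡n y≤x) ⟩
        weights ∎) ⟩
      weights + 2 ^ K * K ∎
      where
      open ≤-Reasoning
      y = proj₁ (pred2^ K)
      y+1 : suc y ≡ 2 ^ K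
      y+1 = proj₂ (pred2^ K)
      y≤x : y ≤ x
      y≤x = s≤s⁻¹ (≤-trans (≤-reflexive y+1) (≤-trans (^-monoʳ-≤ 2 K≤J) (≤-reflexive (sym x+1))))
      l = x ∸ y
      heavy : ∀ i → i < l → K ≤ weight J (suc (y + i))
      heavy i i<l = 2^-reflects-≤ K _ (≤-trans (≤-trans (≤-reflexive (sym y+1)) (s≤s (m≤m+n y i)))
        (≤2^weight J′ (suc (y + i)) (s≤s z≤n) (≤-trans (s≤s (+-monoʳ-< y i<l)) (≤-reflexive (trans (cong suc (m+[n∸m]≡n y≤x)) x+1)))))

  lower : ∀ ν K c → 0 < c → 0 < ν → 2 ^ (ν + K) ≤ B →
    c * c * (Q * (2 ^ ν * K)) ≤ c * c * (Q * K) + 2 ^ c * (c * c * c * Q) * 2 ^ ν + suc c * suc c * (2 ^ ν * S (ν + K))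
  lower (suc ν′) K c 0<c _ 2^J≤B = *-cancelˡ-≤ (2 ^ K) {{m^n≢0 2 K}} (begin
    2 ^ K * (c * c * (Q * (M * K))) ≡⟨ shuffle₁ (2 ^ K) c Q M K ⟩
    c * c * Q * (M * 2 ^ K * K) ≡⟨ cong (λ z → c * c * Q * (z * K)) (sym (^-distribˡ-+-* 2 ν K)) ⟩
    c * c * Q * (2 ^ J * K) ≤⟨ *-monoʳ-≤ (c * c * Q) (weights-lower J′ c 0<c 2^J≤B K (m≤n+m K ν)) ⟩
    c * c * Q * (w + 2 ^ K * K) ≡⟨ *-distribˡ-+ (c * c * Q) w _ ⟩
    c * c * Q * w + c * c * Q * (2 ^ K * K) ≤⟨ +-monoˡ-≤ _ (weights-upper J′ c 0<c 2^J≤B) ⟩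
    2 ^ c * (c * c * c * Q * 2 ^ J) + suc c * suc c * 2 ^ J * S J + c * c * Q * (2 ^ K * K) ≡⟨
      cong (λ z → 2 ^ c * (c * c * c * Q * z) + suc c * suc c * z * S J + c * c * Q * (2 ^ K * K)) (^-distribˡ-+-* 2 ν K) ⟩
    2 ^ c * (c * c * c * Q * (M * 2 ^ K)) + suc c * suc c * (M * 2 ^ K) * S J + c * c * Q * (2 ^ K * K)
      ≡⟨ shuffle₂ (2 ^ c) c Q M (2 ^ K) (S J) K ⟩
    2 ^ K * (c * c * (Q * K) + 2 ^ c * (c * c * c * Q) * M + suc c * suc c * (M * S J)) ∎)
    where
    open ≤-Reasoning
    ν = suc ν′
    J′ = ν′ + K
    J = ν + K
    M = 2 ^ ν
    w = weights J′ c 0<c 2^J≤B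
    shuffle₁ : ∀ k c Q M K → k * (c * c * (Q * (M * K))) ≡ c * c * Q * (M * k * K)
    shuffle₁ = solve-∀
    shuffle₂ : ∀ p c Q M k s K → p * (c * c * c * Q * (M * k)) + suc c * suc c * (M * k) * s + c * c * Q * (k * K) ≡
      k * (c * c * (Q * K) + p * (c * c * c * Q) * M + suc c * suc c * (M * s))
    shuffle₂ = solve-∀

  crude : ∀ J → 0 < J → 2 ^ J ≤ B → S J ≤ 4 * (Q * J)
  crude J 0<J 2^J≤B = +-cancelʳ-≤ (S J) _ _ (begin
    S J + S J ≡⟨ double (S J) ⟩
    2 * S J ≤⟨ upper 1 J 2^J≤B ⟩
    2 * (Q * (1 + J)) + S J ≤⟨ +-monoˡ-≤ (S J) (*-monoʳ-≤ 2 (*-monoʳ-≤ Q (+-monoˡ-≤ J 0<J))) ⟩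
    2 * (Q * (J + J)) + S J ≡⟨ cong (_+ S J) (shuffle Q J) ⟩
    4 * (Q * J) + S J ∎)
    where
    open ≤-Reasoning
    double : ∀ s → s + s ≡ 2 * s
    double = solve-∀
    shuffle : ∀ Q J → 2 * (Q * (J + J)) ≡ 4 * (Q * J)
    shuffle = solve-∀

  -- With ν = 8 E the excess ν is at most J / (2 E), and by `crude` the error 2^-ν S is at most 4 Q
  -- J / 2^(8 E) ≤ Q J / (2 E).
  upper-ε : ∀ E J → 0 < J → 2 * E * (8 * E) ≤ J → 2 ^ J ≤ B → E * S J ≤ suc E * (Q * J)
  upper-ε E J 0<J large 2^J≤B = *-cancelˡ-≤ (2 * P) {{>-nonZero (≤-trans (2^-positive ν) (m≤n*m P 2))}} (begin
    2 * P * (E * S J) ≡⟨ shuffle₁ P E (S J) ⟩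
    2 * E * (P * S J) ≤⟨ *-monoʳ-≤ (2 * E) (upper ν J 2^J≤B) ⟩
    2 * E * (P * (Q * (ν + J)) + S J) ≤⟨ *-monoʳ-≤ (2 * E) (+-monoʳ-≤ _ (crude J 0<J 2^J≤B)) ⟩
    2 * E * (P * (Q * (ν + J)) + 4 * (Q * J)) ≡⟨ shuffle₂ E P Q ν J ⟩
    P * Q * (2 * E * ν) + 8 * E * (Q * J) + 2 * E * P * (Q * J)
      ≤⟨ +-monoˡ-≤ _ (+-mono-≤ (*-monoʳ-≤ (P * Q) large) (*-monoˡ-≤ (Q * J) (<⇒≤ (n<2^n ν)))) ⟩
    P * Q * J + P * (Q * J) + 2 * E * P * (Q * J) ≡⟨ shuffle₃ E P Q J ⟩
    2 * P * (suc E * (Q * J)) ∎)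
    where
    open ≤-Reasoning
    ν = 8 * E
    P = 2 ^ ν
    shuffle₁ : ∀ P E s → 2 * P * (E * s) ≡ 2 * E * (P * s)
    shuffle₁ = solve-∀
    shuffle₂ : ∀ E P Q n J → 2 * E * (P * (Q * (n + J)) + 4 * (Q * J)) ≡ P * Q * (2 * E * n) + 8 * E * (Q * J) + 2 * E * P * (Q * J)
    shuffle₂ = solve-∀
    shuffle₃ : ∀ E P Q J → P * Q * J + P * (Q * J) + 2 * E * P * (Q * J) ≡ 2 * P * (suc E * (Q * J))
    shuffle₃ = solve-∀

  -- Take c = ν = 14 E. After division by c the losses add up to 14 Q J / c: one part from the
  -- truncation K = J - c, twelve from the rounding factor ((c + 1)/c)² with `crude`, and one from
  -- the constants bounded by `large`.
  lower-ε : ∀ E J → 0 < E → 14 * E * (14 * E) + 2 ^ (14 * E) * (14 * E * (14 * E)) ≤ J → 2 ^ J ≤ B → E * (Q * J) ≤ E * S J + Q * J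
  lower-ε E J 0<E large 2^J≤B = *-cancelˡ-≤ 14 (begin
    14 * (E * (Q * J)) ≡⟨ shuffle₁ E Q J ⟩
    c * (Q * J) ≡⟨ cong (λ z → c * (Q * z)) (sym J≡) ⟩
    c * (Q * (c + K)) ≡⟨ shuffle₂ c Q K ⟩
    Q * (c * c) + c * (Q * K) ≤⟨ +-monoʳ-≤ (Q * (c * c)) main ⟩
    Q * (c * c) + (Q * J + P * (c * c) * Q + c * S J + 12 * (Q * J)) ≡⟨ shuffle₃ Q (c * c) J (P * (c * c)) (c * S J) ⟩
    Q * (c * c + P * (c * c)) + c * S J + 13 * (Q * J)
      ≤⟨ +-monoˡ-≤ (13 * (Q * J)) (+-monoˡ-≤ (c * S J) (*-monoʳ-≤ Q large)) ⟩
    Q * J + c * S J + 13 * (Q * J) ≡⟨ shuffle₄ E (Q * J) (S J) ⟩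
    14 * (E * S J + Q * J) ∎)
    where
    open ≤-Reasoning
    c = 14 * E
    P = 2 ^ c
    0<c : 0 < c
    0<c = ≤-trans 0<E (m≤n*m E 14)
    c≤J : c ≤ J
    c≤J = ≤-trans (≤-trans (m≤m*n c c {{>-nonZero 0<c}}) (m≤m+n (c * c) _)) large
    K = J ∸ c
    J≡ : c + K ≡ J
    J≡ = m+[n∸m]≡n c≤J
    shuffle₁ : ∀ E Q J → 14 * (E * (Q * J)) ≡ 14 * E * (Q * J)
    shuffle₁ = solve-∀
    shuffle₂ : ∀ c Q K → c * (Q * (c + K)) ≡ Q * (c * c) + c * (Q * K)
    shuffle₂ = solve-∀
    shuffle₃ : ∀ Q cc J p s → Q * cc + (Q * J + p * Q + s + 12 * (Q * J)) ≡ Q * (cc + p) + s + 13 * (Q * J)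
    shuffle₃ = solve-∀
    shuffle₄ : ∀ E q s → q + 14 * E * s + 13 * q ≡ 14 * (E * s + q)
    shuffle₄ = solve-∀
    shuffle₅ : ∀ c P Q K → c * P * (c * (Q * K)) ≡ c * c * (Q * (P * K))
    shuffle₅ = solve-∀
    shuffle₆ : ∀ c s P → suc c * suc c * (P * s) ≡ P * (c * c * s + c * (2 * s) + s)
    shuffle₆ = solve-∀
    shuffle₇ : ∀ c P Q K s → c * c * (Q * K) + P * (c * c * c * Q) * P + P * (c * c * s + c * (2 * s) + c * s) ≡
      c * (c * Q * K + P * (c * c) * Q * P + P * c * s + P * (3 * s))
    shuffle₇ = solve-∀
    shuffle₈ : ∀ P Q J cc c s → P * (Q * J) + P * cc * Q * P + P * c * s + P * (3 * (4 * (Q * J))) ≡ P * (Q * J + P * cc * Q + c * s + 12 * (Q * J))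
    shuffle₈ = solve-∀
    main : c * (Q * K) ≤ Q * J + P * (c * c) * Q + c * S J + 12 * (Q * J)
    main = *-cancelˡ-≤ (c * P) {{m*n≢0 c P {{>-nonZero 0<c}} {{m^n≢0 2 c}}}} (begin
      c * P * (c * (Q * K)) ≡⟨ shuffle₅ c P Q K ⟩
      c * c * (Q * (P * K)) ≤⟨ lower c K c 0<c 0<c (subst (λ z → 2 ^ z ≤ B) (sym J≡) 2^J≤B) ⟩
      c * c * (Q * K) + P * (c * c * c * Q) * P + suc c * suc c * (P * S (c + K))
        ≡⟨ cong (λ z → c * c * (Q * K) + P * (c * c * c * Q) * P + suc c * suc c * (P * S z)) J≡ ⟩
      c * c * (Q * K) + P * (c * c * c * Q) * P + suc c * suc c * (P * S J)
        ≡⟨ cong (c * c * (Q * K) + P * (c * c * c * Q) * P +_) (shuffle₆ c (S J) P) ⟩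
      c * c * (Q * K) + P * (c * c * c * Q) * P + P * (c * c * S J + c * (2 * S J) + S J) ≤⟨ +-monoʳ-≤ (c * c * (Q * K) + P * (c * c * c * Q) * P)
          (*-monoʳ-≤ P (+-monoʳ-≤ (c * c * S J + c * (2 * S J)) (m≤n*m (S J) c {{>-nonZero 0<c}}))) ⟩
      c * c * (Q * K) + P * (c * c * c * Q) * P + P * (c * c * S J + c * (2 * S J) + c * S J) ≡⟨ shuffle₇ c P Q K (S J) ⟩
      c * (c * Q * K + P * (c * c) * Q * P + P * c * S J + P * (3 * S J)) ≤⟨ *-monoʳ-≤ c (+-mono-≤ (+-monoˡ-≤ (P * c * S J) (+-monoˡ-≤ (P * (c * c) * Q * P)
          (≤-trans (≤-reflexive (*-assoc c Q K)) (*-mono-≤ (<⇒≤ (n<2^n c)) (*-monoʳ-≤ Q (m∸n≤m J c))))))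
          (*-monoʳ-≤ P (*-monoʳ-≤ 3 (crude J (≤-trans 0<c c≤J) 2^J≤B)))) ⟩
      c * (P * (Q * J) + P * (c * c) * Q * P + P * c * S J + P * (3 * (4 * (Q * J))))
        ≡⟨ cong (c *_) (shuffle₈ P Q J (c * c) c (S J)) ⟩
      c * (P * (Q * J + P * (c * c) * Q + c * S J + 12 * (Q * J))) ≡⟨ sym (*-assoc c P _) ⟩
      c * P * (Q * J + P * (c * c) * Q + c * S J + 12 * (Q * J)) ∎)

  A : ℕ → ℕ
  A J = ∑ (2 ^ J) I

  -- For p ≥ 2^lo the reciprocal is at most lg p / (lo p), so one block of ∑ 1/p is controlled by a
  -- difference of `S`.
  piece : ∀ lo hi → lo ≤ hi → lo * A hi + S lo ≤ lo * A lo + S hi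
  piece lo hi lo≤hi = begin
    lo * A hi + S lo ≡⟨ cong (λ z → lo * ∑ z I + S lo) (sym d≡) ⟩
    lo * ∑ (2 ^ lo + d) I + S lo ≡⟨ cong (λ z → lo * z + S lo) (∑-split (2 ^ lo) d I) ⟩
    lo * (A lo + ∑ d (λ i → I (2 ^ lo + i))) + S lo ≡⟨ shuffle lo (A lo) _ (S lo) ⟩
    lo * A lo + (S lo + lo * ∑ d (λ i → I (2 ^ lo + i))) ≡⟨ cong (λ z → lo * A lo + (S lo + z)) (sym (∑-*ˡ d lo _)) ⟩
    lo * A lo + (S lo + ∑ d (λ i → lo * I (2 ^ lo + i))) ≤⟨ +-monoʳ-≤ (lo * A lo) (+-monoʳ-≤ (S lo)
        (∑-mono d (λ i _ → *-monoˡ-≤ (I (2 ^ lo + i)) (lg-≥ {lo} (m≤m+n (2 ^ lo) i))))) ⟩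
    lo * A lo + (S lo + ∑ d (λ i → lg (2 ^ lo + i) * I (2 ^ lo + i)))
      ≡⟨ cong (lo * A lo +_) (sym (∑-split (2 ^ lo) d (λ p → lg p * I p))) ⟩
    lo * A lo + ∑ (2 ^ lo + d) (λ p → lg p * I p) ≡⟨ cong (λ z → lo * A lo + ∑ z (λ p → lg p * I p)) d≡ ⟩
    lo * A lo + S hi ∎
    where
    open ≤-Reasoning
    d = 2 ^ hi ∸ 2 ^ lo
    d≡ : 2 ^ lo + d ≡ 2 ^ hi
    d≡ = m+[n∸m]≡n (^-monoʳ-≤ 2 lo≤hi)
    shuffle : ∀ l a b s → l * (a + b) + s ≡ l * a + (s + l * b)
    shuffle = solve-∀

  module Asymptotic (E J₀ : ℕ) (0<E : 0 < E) (up : ∀ J → J₀ ≤ J → 2 ^ J ≤ B → E * S J ≤ suc E * (Q * J))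
    (low : ∀ J → J₀ ≤ J → 2 ^ J ≤ B → E * (Q * J) ≤ E * S J + Q * J) where

    piece-ε : ∀ lo hi → lo ≤ hi → J₀ ≤ lo → 2 ^ hi ≤ B → E * (lo * A hi) + E * (Q * lo) ≤ E * (lo * A lo) + suc E * (Q * hi) + Q * lo
    piece-ε lo hi lo≤hi J₀≤lo 2^hi≤B = begin
      E * (lo * A hi) + E * (Q * lo) ≤⟨ +-monoʳ-≤ (E * (lo * A hi)) (low lo J₀≤lo (≤-trans (^-monoʳ-≤ 2 lo≤hi) 2^hi≤B)) ⟩
      E * (lo * A hi) + (E * S lo + Q * lo) ≡⟨ shuffle₁ E (lo * A hi) (S lo) (Q * lo) ⟩
      E * (lo * A hi + S lo) + Q * lo ≤⟨ +-monoˡ-≤ (Q * lo) (*-monoʳ-≤ E (piece lo hi lo≤hi)) ⟩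
      E * (lo * A lo + S hi) + Q * lo ≡⟨ cong (_+ Q * lo) (*-distribˡ-+ E (lo * A lo) (S hi)) ⟩
      E * (lo * A lo) + E * S hi + Q * lo
        ≤⟨ +-monoˡ-≤ (Q * lo) (+-monoʳ-≤ (E * (lo * A lo)) (up hi (≤-trans J₀≤lo lo≤hi) 2^hi≤B)) ⟩
      E * (lo * A lo) + suc E * (Q * hi) + Q * lo ∎
      where
      open ≤-Reasoning
      shuffle₁ : ∀ E a s q → E * a + (E * s + q) ≡ E * (a + s) + q
      shuffle₁ = solve-∀

    -- ∑ 1/p over 2^lo ≤ p < 2^hi for lo = ic and hi ≈ (i+1)c is about 1/i.
    step-ε : ∀ i c hi → 0 < c → J₀ ≤ i * c → i * c ≤ hi → suc E * hi ≤ suc E * (suc i * c) + c → i ≤ 99 → 2 ^ hi ≤ B →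
      E * (i * A hi) ≤ E * (i * A (i * c)) + Q * (E + 201)
    step-ε i c hi 0<c J₀≤ ic≤hi hi≤ i≤99 2^hi≤B = *-cancelˡ-≤ c {{>-nonZero 0<c}} (+-cancelʳ-≤ (E * (Q * (i * c))) _ _ (begin
      c * (E * (i * A hi)) + E * (Q * (i * c)) ≡⟨ cong (_+ E * (Q * (i * c))) (shuffle₁ c E i (A hi)) ⟩
      E * (i * c * A hi) + E * (Q * (i * c)) ≤⟨ piece-ε (i * c) hi ic≤hi J₀≤ 2^hi≤B ⟩
      E * (i * c * a) + suc E * (Q * hi) + Q * (i * c) ≡⟨ cong (λ z → E * (i * c * a) + z + Q * (i * c)) (shuffle₂ E Q hi) ⟩
      E * (i * c * a) + Q * (suc E * hi) + Q * (i * c)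
        ≤⟨ +-monoˡ-≤ (Q * (i * c)) (+-monoʳ-≤ (E * (i * c * a)) (*-monoʳ-≤ Q hi≤)) ⟩
      E * (i * c * a) + Q * (suc E * (suc i * c) + c) + Q * (i * c) ≡⟨ shuffle₃ E i c a Q ⟩
      c * (E * (i * a)) + c * Q * (E + (2 + 2 * i)) + E * (Q * (i * c)) ≤⟨ +-monoˡ-≤ (E * (Q * (i * c))) (+-monoʳ-≤ (c * (E * (i * a)))
          (*-monoʳ-≤ (c * Q) (+-monoʳ-≤ E (≤-trans (+-monoʳ-≤ 2 (*-monoʳ-≤ 2 i≤99)) (n≤1+n 200))))) ⟩
      c * (E * (i * a)) + c * Q * (E + 201) + E * (Q * (i * c))
        ≡⟨ cong (_+ E * (Q * (i * c))) (shuffle₄ c (E * (i * a)) Q (E + 201)) ⟩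
      c * (E * (i * a) + Q * (E + 201)) + E * (Q * (i * c)) ∎))
      where
      open ≤-Reasoning
      a = A (i * c)
      shuffle₁ : ∀ c E i a → c * (E * (i * a)) ≡ E * (i * c * a)
      shuffle₁ = solve-∀
      shuffle₂ : ∀ E Q h → suc E * (Q * h) ≡ Q * (suc E * h)
      shuffle₂ = solve-∀
      shuffle₃ : ∀ E i c a Q → E * (i * c * a) + Q * (suc E * (suc i * c) + c) + Q * (i * c) ≡
        c * (E * (i * a)) + c * Q * (E + (2 + 2 * i)) + E * (Q * (i * c))
      shuffle₃ = solve-∀
      shuffle₄ : ∀ c x Q e → c * x + c * Q * e ≡ c * (x + Q * e)
      shuffle₄ = solve-∀

    -- Twenty-one short blocks give 1/79 + ... + 1/99 ≈ 0.23706 up to the factor (E + 201)/E, and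
    -- `numeric` keeps the product below 19/80 = 0.2375.
    reciprocal-sum : 80 * (E + 201) * harmonic₁ 21 ≤ 19 * harmonic₀ 21 * E →
      ∀ c b → J₀ ≤ c → 100 * suc E ≤ c → 100 * c ≤ b → b ≤ 100 * c + 100 → 2 ^ b ≤ B → 80 * A b ≤ 80 * A (79 * c) + 19 * Q
    reciprocal-sum numeric c b J₀≤c E≤c lo hi 2^b≤B = *-cancelˡ-≤ (d * E) {{m*n≢0 d E {{d≢0}} {{>-nonZero 0<E}}}} (begin
      d * E * (80 * A b) ≡⟨ shuffle₁ d E (A b) ⟩
      80 * (d * (E * A b)) ≤⟨ *-monoʳ-≤ 80 (harmonic-chain E (Q * (E + 201)) a 21 step) ⟩
      80 * (d * (E * A (79 * c)) + Q * (E + 201) * h) ≡⟨ shuffle₂ d E (A (79 * c)) Q (E + 201) h ⟩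
      d * E * (80 * A (79 * c)) + Q * (80 * (E + 201) * h) ≤⟨ +-monoʳ-≤ (d * E * (80 * A (79 * c))) (*-monoʳ-≤ Q numeric) ⟩
      d * E * (80 * A (79 * c)) + Q * (19 * d * E) ≡⟨ shuffle₃ d E (A (79 * c)) Q ⟩
      d * E * (80 * A (79 * c) + 19 * Q) ∎)
      where
      open ≤-Reasoning
      d h : ℕ
      d = harmonic₀ 21
      h = harmonic₁ 21
      d≢0 : NonZero d
      d≢0 = >-nonZero (harmonic₀-positive 21)
      shuffle₁ : ∀ d E a → d * E * (80 * a) ≡ 80 * (d * (E * a))
      shuffle₁ = solve-∀
      shuffle₂ : ∀ d E a Q e h → 80 * (d * (E * a) + Q * e * h) ≡ d * E * (80 * a) + Q * (80 * e * h)
      shuffle₂ = solve-∀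
      shuffle₃ : ∀ d E a Q → d * E * (80 * a) + Q * (19 * d * E) ≡ d * E * (80 * a + 19 * Q)
      shuffle₃ = solve-∀
      -- The last node is b instead of 100 c; its excess of at most 100 fits into the tolerance of
      -- `step-ε`.
      a : ℕ → ℕ
      a i with i ≟ 100
      ... | yes _ = A b
      ... | no _ = A (i * c)
      a-inner : ∀ i → i ≢ 100 → a i ≡ A (i * c)
      a-inner i ne with i ≟ 100
      ... | yes e = contradiction e ne
      ... | no _ = refl
      0<c : 0 < c
      0<c = ≤-trans (s≤s z≤n) E≤c
      J₀≤ : ∀ i → J₀ ≤ (79 + i) * c
      J₀≤ i = ≤-trans J₀≤c (m≤m+n c _)
      step : ∀ i → i < 21 → E * ((79 + i) * a (80 + i)) ≤ E * ((79 + i) * a (79 + i)) + Q * (E + 201)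
      step i i<21 = subst (λ z → E * ((79 + i) * a (80 + i)) ≤ E * ((79 + i) * z) + Q * (E + 201)) (sym (a-inner (79 + i) (<⇒≢ 79+i<100))) (cases (80 + i ≟ 100))
        where
        79+i<100 : 79 + i < 100
        79+i<100 = +-monoʳ-< 79 i<21
        cases : Dec (80 + i ≡ 100) → E * ((79 + i) * a (80 + i)) ≤ E * ((79 + i) * A ((79 + i) * c)) + Q * (E + 201)
        cases (no ne) = subst (λ z → E * ((79 + i) * z) ≤ E * ((79 + i) * A ((79 + i) * c)) + Q * (E + 201)) (sym (a-inner (80 + i) ne))
          (step-ε (79 + i) c ((80 + i) * c) 0<c (J₀≤ i) (*-monoˡ-≤ c (n≤1+n (79 + i))) (m≤m+n _ c) (s≤s⁻¹ 79+i<100)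
            (≤-trans (^-monoʳ-≤ 2 (≤-trans (*-monoˡ-≤ c 79+i<100) lo)) 2^b≤B))
        cases (yes e) = subst (λ z → E * ((79 + i) * z) ≤ E * ((79 + i) * A ((79 + i) * c)) + Q * (E + 201)) (sym (cong a e))
          (step-ε (79 + i) c b 0<c (J₀≤ i) (≤-trans (*-monoˡ-≤ c (<⇒≤ 79+i<100)) lo)
            (≤-trans (*-monoʳ-≤ (suc E) hi) (≤-trans (≤-reflexive (trans (*-distribˡ-+ (suc E) (100 * c) 100) (cong (λ z → suc E * (z * c) + suc E * 100) (sym e))))
              (+-monoʳ-≤ _ (≤-trans (≤-reflexive (*-comm (suc E) 100)) E≤c)))) (s≤s⁻¹ 79+i<100) 2^b≤B)

    -- Without a prime in between, `S` would be equal at both ends, but it is Q J up to a relative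
    -- error 1/E and `gap` separates the two values.
    prime-between : ∀ lo hi → J₀ ≤ lo → lo ≤ hi → suc E * lo + hi < E * hi → 2 ^ hi ≤ B → ∃ λ p → Prime p × 2 ^ lo ≤ p × p < 2 ^ hi
    prime-between lo hi J₀≤lo lo≤hi gap 2^hi≤B = find (∑-positive d {λ i → lg (2 ^ lo + i) * I (2 ^ lo + i)} positive)
      where
      d = 2 ^ hi ∸ 2 ^ lo
      d≡ : 2 ^ lo + d ≡ 2 ^ hi
      d≡ = m+[n∸m]≡n (^-monoʳ-≤ 2 lo≤hi)
      S-split : S hi ≡ S lo + ∑ d (λ i → lg (2 ^ lo + i) * I (2 ^ lo + i))
      S-split = trans (cong (λ z → ∑ z (λ p → lg p * I p)) (sym d≡)) (∑-split (2 ^ lo) d (λ p → lg p * I p))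
      positive : 0 < ∑ d (λ i → lg (2 ^ lo + i) * I (2 ^ lo + i))
      positive = n≢0⇒n>0 (λ e → <⇒≱ (*-monoʳ-< Q {{>-nonZero 0<Q}} gap) (begin
        Q * (E * hi) ≡⟨ shuffle₂ Q E hi ⟩
        E * (Q * hi) ≤⟨ low hi (≤-trans J₀≤lo lo≤hi) 2^hi≤B ⟩
        E * S hi + Q * hi ≡⟨ cong (λ z → E * z + Q * hi) (trans S-split (trans (cong (S lo +_) e) (+-identityʳ (S lo)))) ⟩
        E * S lo + Q * hi ≤⟨ +-monoˡ-≤ (Q * hi) (up lo J₀≤lo (≤-trans (^-monoʳ-≤ 2 lo≤hi) 2^hi≤B)) ⟩
        suc E * (Q * lo) + Q * hi ≡⟨ shuffle₃ Q E lo hi ⟩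
        Q * (suc E * lo + hi) ∎))
        where
        open ≤-Reasoning
        shuffle₂ : ∀ Q E h → Q * (E * h) ≡ E * (Q * h)
        shuffle₂ = solve-∀
        shuffle₃ : ∀ Q E l h → suc E * (Q * l) + Q * h ≡ Q * (suc E * l + h)
        shuffle₃ = solve-∀
      find : (∃ λ i → i < d × 0 < lg (2 ^ lo + i) * I (2 ^ lo + i)) → ∃ λ p → Prime p × 2 ^ lo ≤ p × p < 2 ^ hi
      find (i , i<d , pos) with prime? (2 ^ lo + i)
      ... | yes pp = 2 ^ lo + i , pp , m≤m+n _ i , <-≤-trans (+-monoʳ-< (2 ^ lo) i<d) (≤-reflexive d≡)
      ... | no ¬pp = contradiction (trans (cong (lg (2 ^ lo + i) *_) (I-other ¬pp)) (*-zeroʳ (lg (2 ^ lo + i)))) (>⇒≢ pos)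

-- Counting periodic functions

coprime-* : ∀ {a b c} → Coprime a b → Coprime a c → Coprime a (b * c)
coprime-* {a} {b} {c} ab ac {d} (d∣a , d∣bc) = ac (d∣a , coprime-divisor db d∣bc)
  where
  db : Coprime d b
  db (e∣d , e∣b) = ab (∣-trans e∣d d∣a , e∣b)

%-≡⇒∣ : ∀ q .{{_ : NonZero q}} m n → m ≤ n → m % q ≡ n % q → q ∣ n ∸ m
%-≡⇒∣ q m n m≤n e = divides (n / q ∸ m / q) (begin
  n ∸ m ≡⟨ cong₂ _∸_ (m≡m%n+[m/n]*n n q) (m≡m%n+[m/n]*n m q) ⟩
  (n % q + n / q * q) ∸ (m % q + m / q * q) ≡⟨ cong (λ z → (n % q + n / q * q) ∸ (z + m / q * q)) e ⟩
  (n % q + n / q * q) ∸ (n % q + m / q * q) ≡⟨ [m+n]∸[m+o]≡n∸o (n % q) _ _ ⟩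
  n / q * q ∸ m / q * q ≡⟨ sym (*-distribʳ-∸ q (n / q) (m / q)) ⟩
  (n / q ∸ m / q) * q ∎)
  where open ≡-Reasoning

∑-blocks : ∀ q d f → ∑ (q * d) f ≡ ∑ q (λ j → ∑ d (λ x → f (j * d + x)))
∑-blocks zero d f = refl
∑-blocks (suc q) d f = trans (cong (λ n → ∑ n f) (+-comm d (q * d))) (trans (∑-split (q * d) d f) (cong (_+ ∑ d (λ x → f (q * d + x))) (∑-blocks q d f)))

∑-fibre≤1 : ∀ n (h : ℕ → ℕ) c → (∀ i j → i < n → j < n → h i ≡ h j → i ≡ j) → ∑ n (λ j → 𝟙 (h j ≟ c)) ≤ 1
∑-fibre≤1 zero h c inj = z≤n
∑-fibre≤1 (suc n) h c inj with h n ≟ c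
... | no _ = ≤-trans (≤-reflexive (+-identityʳ _)) (∑-fibre≤1 n h c (λ i j i<n j<n → inj i j (m<n⇒m<1+n i<n) (m<n⇒m<1+n j<n)))
... | yes e = ≤-reflexive (cong (_+ 1) (∑-zero n (λ i i<n → 𝟙-no (h i ≟ c) (λ e′ → <⇒≢ i<n (inj i n (m<n⇒m<1+n i<n) ≤-refl (trans e′ (sym e)))))))

∑-full : ∀ n (N : ℕ → ℕ) → (∀ c → c < n → N c ≤ 1) → ∑ n N ≡ n → ∀ c → c < n → N c ≡ 1
∑-full (suc n) N le e c c<1+n with c ≟ n
... | yes refl = ≤-antisym (le n ≤-refl) (+-cancelˡ-≤ n 1 (N n) (≤-trans (≤-reflexive (trans (+-comm n 1) (sym e))) (+-monoˡ-≤ (N n) ∑≤)))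
  where
  ∑≤ : ∑ n N ≤ n
  ∑≤ = ≤-trans (∑-mono n (λ i i<n → le i (m<n⇒m<1+n i<n))) (≤-reflexive (trans (∑-const n 1) (*-identityʳ n)))
... | no c≢n = ∑-full n N (λ i i<n → le i (m<n⇒m<1+n i<n)) ∑≡ c (≤∧≢⇒< (s≤s⁻¹ c<1+n) c≢n)
  where
  ∑≤ : ∑ n N ≤ n
  ∑≤ = ≤-trans (∑-mono n (λ i i<n → le i (m<n⇒m<1+n i<n))) (≤-reflexive (trans (∑-const n 1) (*-identityʳ n)))
  ∑≡ : ∑ n N ≡ n
  ∑≡ = ≤-antisym ∑≤ (+-cancelʳ-≤ 1 n (∑ n N) (≤-trans (≤-reflexive (trans (+-comm n 1) (sym e))) (+-monoʳ-≤ (∑ n N) (le n ≤-refl))))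

∑-permute : ∀ n (h : ℕ → ℕ) (b : ℕ → ℕ) → (∀ i → i < n → h i < n) → (∀ i j → i < n → j < n → h i ≡ h j → i ≡ j) →
  ∑ n (λ j → b (h j)) ≡ ∑ n b
∑-permute n h b bounded inj = begin
  ∑ n (λ j → b (h j)) ≡⟨ ∑-cong n (λ j j<n → sym (trans (∑-cong n (λ c _ → cong₂ _*_ (𝟙-sym c (h j)) refl)) (value j j<n))) ⟩
  ∑ n (λ j → ∑ n (λ c → 𝟙 (h j ≟ c) * b c)) ≡⟨ ∑-swap n n _ ⟩
  ∑ n (λ c → ∑ n (λ j → 𝟙 (h j ≟ c) * b c))
    ≡⟨ ∑-cong n (λ c _ → trans (∑-cong n (λ j _ → *-comm (𝟙 (h j ≟ c)) (b c))) (∑-*ˡ n (b c) _)) ⟩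
  ∑ n (λ c → b c * N c) ≡⟨ ∑-cong n (λ c c<n → trans (cong (b c *_) (∑-full n N (λ c _ → ∑-fibre≤1 n h c inj) total c c<n)) (*-identityʳ (b c))) ⟩
  ∑ n b ∎
  where
  open ≡-Reasoning
  N : ℕ → ℕ
  N c = ∑ n (λ j → 𝟙 (h j ≟ c))
  𝟙-sym : ∀ c x → 𝟙 (x ≟ c) ≡ 𝟙 (c ≟ x)
  𝟙-sym c x = ≤-antisym (𝟙-mono (x ≟ c) (c ≟ x) sym) (𝟙-mono (c ≟ x) (x ≟ c) sym)
  value : ∀ j → j < n → ∑ n (λ c → 𝟙 (c ≟ h j) * b c) ≡ b (h j)
  value j j<n = trans (∑-cong n (λ c _ → same c)) (∑-point n (h j) (b (h j)) (bounded j j<n))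
    where
    same : ∀ c → 𝟙 (c ≟ h j) * b c ≡ 𝟙 (c ≟ h j) * b (h j)
    same c with c ≟ h j
    ... | yes refl = refl
    ... | no _ = refl
  total : ∑ n N ≡ n
  total = trans (sym (∑-swap n n (λ j c → 𝟙 (h j ≟ c)))) (trans (∑-cong n (λ j j<n → trans (∑-cong n (λ c _ → trans (𝟙-sym c (h j)) (sym (*-identityʳ _))))
    (∑-point n (h j) 1 (bounded j j<n)))) (trans (∑-const n 1) (*-identityʳ n)))

record Periodic (d w : ℕ) (f : ℕ → ℕ) : Set where
  field
    period>0 : 0 < d
    periodic : ∀ i → f (i + d) ≡ f i
    total    : ∑ d f ≡ w

  shifts : ∀ k i → f (k * d + i) ≡ f i
  shifts zero i = refl
  shifts (suc k) i = trans (cong f (trans (+-assoc d (k * d) i) (+-comm d (k * d + i)))) (trans (periodic (k * d + i)) (shifts k i))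

  private
    instance
      d≢0 : NonZero d
      d≢0 = >-nonZero period>0

  -- Full periods contribute exactly w each; the incomplete one contributes between 0 and w, which
  -- is the whole error of the density w / d.
  count-split : ∀ X → ∃ λ c → c ≤ w × ∑ X f ≡ X / d * w + c
  count-split X = ∑ (X % d) f , ≤-trans (∑-≤-extend f (<⇒≤ (m%n<n X d))) (≤-reflexive total) , (begin
    ∑ X f ≡⟨ cong (λ n → ∑ n f) (trans (m≡m%n+[m/n]*n X d) (+-comm (X % d) (X / d * d))) ⟩
    ∑ (X / d * d + X % d) f ≡⟨ ∑-split (X / d * d) (X % d) f ⟩
    ∑ (X / d * d) f + ∑ (X % d) (λ i → f (X / d * d + i)) ≡⟨ cong₂ _+_
        (trans (∑-blocks (X / d) d f) (trans (∑-cong (X / d) (λ j _ → trans (∑-cong d (λ x _ → shifts j x)) total)) (∑-const (X / d) w)))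
        (∑-cong (X % d) (λ i _ → shifts (X / d) i)) ⟩
    X / d * w + ∑ (X % d) f ∎)
    where open ≡-Reasoning

  count-lower : ∀ X → X * w ≤ ∑ X f * d + w * d
  count-lower X with c , c≤w , e ← count-split X = begin
    X * w ≡⟨ cong (_* w) (m≡m%n+[m/n]*n X d) ⟩
    (X % d + X / d * d) * w ≡⟨ shuffle (X % d) (X / d) d w ⟩
    X / d * w * d + w * (X % d)
      ≤⟨ +-mono-≤ (*-monoˡ-≤ d (≤-trans (m≤m+n _ c) (≤-reflexive (sym e)))) (*-monoʳ-≤ w (<⇒≤ (m%n<n X d))) ⟩
    ∑ X f * d + w * d ∎
    where
    open ≤-Reasoning
    shuffle : ∀ r q d w → (r + q * d) * w ≡ q * w * d + w * r
    shuffle = solve-∀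

  count-upper : ∀ X → ∑ X f * d ≤ X * w + w * d
  count-upper X with c , c≤w , e ← count-split X = begin
    ∑ X f * d ≡⟨ cong (_* d) e ⟩
    (X / d * w + c) * d ≡⟨ shuffle (X / d) w c d ⟩
    X / d * d * w + c * d ≤⟨ +-mono-≤ (*-monoˡ-≤ w (≤-trans (m≤n+m _ (X % d)) (≤-reflexive (sym (m≡m%n+[m/n]*n X d))))) (*-monoˡ-≤ d c≤w) ⟩
    X * w + w * d ∎
    where
    open ≤-Reasoning
    shuffle : ∀ q w c d → (q * w + c) * d ≡ q * d * w + c * d
    shuffle = solve-∀

open Periodic

-- Chinese remainder theorem, as a count.
periodic-* : ∀ {d w f q v b} → Coprime q d → Periodic d w f → Periodic q v b → Periodic (d * q) (w * v) (λ i → f i * b i)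
periodic-* {d} {w} {f} {q} {v} {b} cop F G = record
  { period>0 = *-mono-≤ (period>0 F) (period>0 G)
  ; periodic = λ i → cong₂ _*_
      (trans (cong f (trans (+-comm i (d * q)) (cong (_+ i) (*-comm d q)))) (shifts F q i))
      (trans (cong b (+-comm i (d * q))) (shifts G d i))
  ; total = begin
      ∑ (d * q) (λ i → f i * b i) ≡⟨ cong (λ n → ∑ n (λ i → f i * b i)) (*-comm d q) ⟩
      ∑ (q * d) (λ i → f i * b i) ≡⟨ ∑-blocks q d _ ⟩
      ∑ q (λ j → ∑ d (λ x → f (j * d + x) * b (j * d + x)))
        ≡⟨ ∑-cong q (λ j _ → ∑-cong d (λ x _ → cong (_* b (j * d + x)) (shifts F j x))) ⟩
      ∑ q (λ j → ∑ d (λ x → f x * b (j * d + x))) ≡⟨ ∑-swap q d _ ⟩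
      ∑ d (λ x → ∑ q (λ j → f x * b (j * d + x)))
        ≡⟨ ∑-cong d (λ x _ → trans (∑-*ˡ q (f x) _) (trans (cong (f x *_) (row x)) (*-comm (f x) v))) ⟩
      ∑ d (λ x → v * f x) ≡⟨ trans (∑-*ˡ d v f) (cong (v *_) (total F)) ⟩
      v * w ≡⟨ *-comm v w ⟩
      w * v ∎
  }
  where
  open ≡-Reasoning
  instance
    q≢0 : NonZero q
    q≢0 = >-nonZero (period>0 G)
  -- As q is prime to d, the numbers x + j d for j < q run through all residues modulo q.
  row : ∀ x → ∑ q (λ j → b (j * d + x)) ≡ v
  row x = trans (∑-cong q (λ j _ → reduce (j * d + x))) (trans (∑-permute q (λ j → (j * d + x) % q) b (λ j _ → m%n<n (j * d + x) q) inj) (total G))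
    where
    reduce : ∀ i → b i ≡ b (i % q)
    reduce i = trans (cong b (trans (m≡m%n+[m/n]*n i q) (+-comm (i % q) (i / q * q)))) (shifts G (i / q) (i % q))
    ordered : ∀ i j → i < j → j < q → (i * d + x) % q ≢ (j * d + x) % q
    ordered i j i<j j<q e = <⇒≱ (≤-<-trans (m∸n≤m j i) j<q) (∣⇒≤ {{>-nonZero (m<n⇒0<n∸m i<j)}} (coprime-divisor cop
      (subst (q ∣_) (trans ([m+o]∸[n+o] (j * d) (i * d) x) (trans (sym (*-distribʳ-∸ d j i)) (*-comm (j ∸ i) d)))
        (%-≡⇒∣ q (i * d + x) (j * d + x) (+-monoˡ-≤ x (*-monoˡ-≤ d (<⇒≤ i<j))) e))))
      where
      [m+o]∸[n+o] : ∀ m n o → (m + o) ∸ (n + o) ≡ m ∸ n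
      [m+o]∸[n+o] m n o = trans (cong₂ _∸_ (+-comm m o) (+-comm n o)) ([m+n]∸[m+o]≡n∸o o m n)
    inj : ∀ i j → i < q → j < q → (i * d + x) % q ≡ (j * d + x) % q → i ≡ j
    inj i j i<q j<q e with <-cmp i j
    ... | tri< i<j _ _ = contradiction e (ordered i j i<j j<q)
    ... | tri≈ _ i≡j _ = i≡j
    ... | tri> _ _ j<i = contradiction (sym e) (ordered j i j<i i<q)

-- Brun's sieve

pick : {P : Set} → Dec P → ℕ → ℕ → ℕ
pick (yes _) a b = a
pick (no _) a b = b

-- V / P is the density ∏ (1 - ω/q); Δl and Δu are P times the losses of the truncated lower and upper bounds, where
-- the (2j+2)-nd sieving index must lie below y (j+1); Rl and Ru bound the remainder terms.
module Sieve (q ω : ℕ → ℕ) (ω<q : ∀ m → ω m < q m) (y : ℕ → ℕ) where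

  P V : ℕ → ℕ
  P zero = 1
  P (suc m) = q m * P m
  V zero = 1
  V (suc m) = (q m ∸ ω m) * V m

  V-step : ∀ m → V (suc m) + ω m * V m ≡ q m * V m
  V-step m = trans (sym (*-distribʳ-+ (V m) (q m ∸ ω m) (ω m))) (cong (_* V m) (m∸n+n≡m (<⇒≤ (ω<q m))))

  Δl Δu : ℕ → ℕ → ℕ
  Δl j zero = 0
  Δl j (suc m) = q m * Δl j m + ω m * Δu j m
  Δu j zero = 0
  Δu j (suc m) = q m * Δu j m + ω m * pick (m <? y (suc j)) (Δl (suc j) m) (V m)

  Rl Ru : ℕ → ℕ → ℕ
  Rl j zero = 1
  Rl j (suc m) = Rl j m + ω m * Ru j m
  Ru j zero = 1
  Ru j (suc m) = Ru j m + ω m * pick (m <? y (suc j)) (Rl (suc j) m) 0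

  module Count (bad : ℕ → ℕ → ℕ) (bad≤1 : ∀ m i → bad m i ≤ 1) (bad-periodic : ∀ m → Periodic (q m) (ω m) (bad m))
    (pairwise : ∀ i m → i < m → Coprime (q i) (q m)) (X : ℕ) where

    good : ℕ → ℕ → ℕ
    good zero i = 1
    good (suc m) i = good m i * (1 ∸ bad m i)

    sift : (ℕ → ℕ) → ℕ → ℕ
    sift f m = ∑ X (λ i → f i * good m i)

    sift-step : ∀ f m → sift f m ≡ sift f (suc m) + sift (λ i → f i * bad m i) m
    sift-step f m = trans (∑-cong X (λ i _ → pointwise (f i) (good m i) (bad m i) (bad≤1 m i))) (∑-+ X _ _)
      where
      pointwise : ∀ f g b → b ≤ 1 → f * g ≡ f * (g * (1 ∸ b)) + f * b * g
      pointwise f g zero _ = identity f g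
        where
        identity : ∀ f g → f * g ≡ f * (g * 1) + f * 0 * g
        identity = solve-∀
      pointwise f g (suc zero) _ = identity f g
        where
        identity : ∀ f g → f * g ≡ f * (g * 0) + f * 1 * g
        identity = solve-∀
      pointwise f g (suc (suc b)) (s≤s ())

    Clear : ℕ → ℕ → Set
    Clear m d = ∀ i → i < m → Coprime (q i) d

    clear-pred : ∀ {m d} → Clear (suc m) d → Clear m d
    clear-pred cl i i<m = cl i (m<n⇒m<1+n i<m)

    clear-* : ∀ {m d} → Clear (suc m) d → Clear m (d * q m)
    clear-* {m} cl i i<m = coprime-* (cl i (m<n⇒m<1+n i<m)) (pairwise i m i<m)

    extend : ∀ {m d w f} → Clear (suc m) d → Periodic d w f → Periodic (d * q m) (w * ω m) (λ i → f i * bad m i)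
    extend {m} cl F = periodic-* (cl m ≤-refl) F (bad-periodic m)

    -- Buchstab's identity `sift-step`: a lower bound uses an upper bound for the subtracted term
    -- and vice versa. The statement is made for every periodic f because the subtracted term is the
    -- same problem for f times `bad m`; `Clear` keeps the moduli coprime.
    lower : ∀ j m {d w f} → Clear m d → Periodic d w f → X * w * V m ≤ sift f m * (d * P m) + X * w * Δl j m + w * d * P m * Rl j m
    upper : ∀ j m {d w f} → Clear m d → Periodic d w f → sift f m * (d * P m) ≤ X * w * (V m + Δu j m) + w * d * P m * Ru j m

    lower j zero {d} {w} {f} cl F = begin
      X * w * 1 ≡⟨ *-identityʳ (X * w) ⟩
      X * w ≤⟨ Periodic.count-lower F X ⟩
      ∑ X f * d + w * d ≡⟨ cong (λ z → z * d + w * d) (∑-cong X (λ i _ → sym (*-identityʳ (f i)))) ⟩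
      sift f 0 * d + w * d ≡⟨ shuffle (sift f 0) d w X ⟩
      sift f 0 * (d * 1) + X * w * 0 + w * d * 1 * 1 ∎
      where
      open ≤-Reasoning
      shuffle : ∀ s d w X → s * d + w * d ≡ s * (d * 1) + X * w * 0 + w * d * 1 * 1
      shuffle = solve-∀
    lower j (suc m) {d} {w} {f} cl F = +-cancelʳ-≤ (X * w * ω m * V m) _ _ (begin
      X * w * V (suc m) + X * w * ω m * V m
        ≡⟨ trans (shuffle₁ (X * w) (V (suc m)) (ω m) (V m)) (cong (X * w *_) (V-step m)) ⟩
      X * w * (q m * V m) ≡⟨ shuffle₂ (X * w) (q m) (V m) ⟩
      q m * (X * w * V m) ≤⟨ *-monoʳ-≤ (q m) (lower j m (clear-pred cl) F) ⟩
      q m * (sift f m * (d * P m) + X * w * Δl j m + w * d * P m * Rl j m)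
        ≡⟨ cong (λ z → q m * (z * (d * P m) + X * w * Δl j m + w * d * P m * Rl j m)) (sift-step f m) ⟩
      q m * ((s₁ + s₂) * (d * P m) + X * w * Δl j m + w * d * P m * Rl j m)
        ≡⟨ shuffle₃ (q m) s₁ s₂ d (P m) (X * w) (Δl j m) (w * d) (Rl j m) ⟩
      s₂ * (d * q m * P m) + (s₁ * (d * (q m * P m)) + X * w * (q m * Δl j m) + w * d * (q m * P m) * Rl j m)
        ≤⟨ +-monoˡ-≤ _ (upper j m (clear-* cl) (extend cl F)) ⟩
      X * (w * ω m) * (V m + Δu j m) + w * ω m * (d * q m) * P m * Ru j m + (s₁ * (d * (q m * P m)) + X * w * (q m * Δl j m) + w * d * (q m * P m) * Rl j m)
        ≡⟨ shuffle₄ X w (ω m) (V m) (Δu j m) d (q m) (P m) (Ru j m) s₁ (Δl j m) (Rl j m) ⟩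
      s₁ * (d * (q m * P m)) + X * w * (q m * Δl j m + ω m * Δu j m) + w * d * (q m * P m) * (Rl j m + ω m * Ru j m) + X * w * ω m * V m ∎)
      where
      open ≤-Reasoning
      s₁ s₂ : ℕ
      s₁ = sift f (suc m)
      s₂ = sift (λ i → f i * bad m i) m
      shuffle₁ : ∀ a v o u → a * v + a * o * u ≡ a * (v + o * u)
      shuffle₁ = solve-∀
      shuffle₂ : ∀ a b c → a * (b * c) ≡ b * (a * c)
      shuffle₂ = solve-∀
      shuffle₃ : ∀ q s t d P a D e R → q * ((s + t) * (d * P) + a * D + e * P * R) ≡
        t * (d * q * P) + (s * (d * (q * P)) + a * (q * D) + e * (q * P) * R)
      shuffle₃ = solve-∀
      shuffle₄ : ∀ X w o V U d q P R s D L → X * (w * o) * (V + U) + w * o * (d * q) * P * R + (s * (d * (q * P)) + X * w * (q * D) + w * d * (q * P) * L) ≡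
        s * (d * (q * P)) + X * w * (q * D + o * U) + w * d * (q * P) * (L + o * R) + X * w * o * V
      shuffle₄ = solve-∀

    upper j zero {d} {w} {f} cl F = begin
      sift f 0 * (d * 1) ≡⟨ cong₂ _*_ (∑-cong X (λ i _ → *-identityʳ (f i))) (*-identityʳ d) ⟩
      ∑ X f * d ≤⟨ Periodic.count-upper F X ⟩
      X * w + w * d ≡⟨ shuffle X w d ⟩
      X * w * (1 + 0) + w * d * 1 * 1 ∎
      where
      open ≤-Reasoning
      shuffle : ∀ X w d → X * w + w * d ≡ X * w * (1 + 0) + w * d * 1 * 1
      shuffle = solve-∀
    upper j (suc m) {d} {w} {f} cl F = cases (m <? y (suc j))
      where
      open ≤-Reasoning
      s₁ s₂ : ℕ
      s₁ = sift f (suc m)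
      s₂ = sift (λ i → f i * bad m i) m
      shuffle₁ : ∀ s t d q P → s * (d * (q * P)) + t * (d * q * P) ≡ q * ((s + t) * (d * P))
      shuffle₁ = solve-∀
      shuffle₂ : ∀ a q V U e P R → q * (a * (V + U) + e * P * R) ≡ a * (q * V) + a * (q * U) + e * (q * P) * R
      shuffle₂ = solve-∀
      common : s₁ * (d * (q m * P m)) + s₂ * (d * q m * P m) ≤ X * w * (V (suc m) + ω m * V m) + X * w * (q m * Δu j m) + w * d * (q m * P m) * Ru j m
      common = begin
        s₁ * (d * (q m * P m)) + s₂ * (d * q m * P m) ≡⟨ shuffle₁ s₁ s₂ d (q m) (P m) ⟩
        q m * ((s₁ + s₂) * (d * P m)) ≡⟨ cong (λ z → q m * (z * (d * P m))) (sym (sift-step f m)) ⟩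
        q m * (sift f m * (d * P m)) ≤⟨ *-monoʳ-≤ (q m) (upper j m (clear-pred cl) F) ⟩
        q m * (X * w * (V m + Δu j m) + w * d * P m * Ru j m)
          ≡⟨ shuffle₂ (X * w) (q m) (V m) (Δu j m) (w * d) (P m) (Ru j m) ⟩
        X * w * (q m * V m) + X * w * (q m * Δu j m) + w * d * (q m * P m) * Ru j m
          ≡⟨ cong (λ z → X * w * z + X * w * (q m * Δu j m) + w * d * (q m * P m) * Ru j m) (sym (V-step m)) ⟩
        X * w * (V (suc m) + ω m * V m) + X * w * (q m * Δu j m) + w * d * (q m * P m) * Ru j m ∎
      cases : (b : Dec (m < y (suc j))) → s₁ * (d * (q m * P m)) ≤ X * w * (V (suc m) + (q m * Δu j m + ω m * pick b (Δl (suc j) m) (V m))) +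
        w * d * (q m * P m) * (Ru j m + ω m * pick b (Rl (suc j) m) 0)
      -- Truncation: for m ≥ y (j + 1) the subtracted term is replaced by 0, which loses its main
      -- term ω m · V m but adds no remainder.
      cases (no _) = begin
        s₁ * (d * (q m * P m)) ≤⟨ m≤m+n _ _ ⟩
        s₁ * (d * (q m * P m)) + s₂ * (d * q m * P m) ≤⟨ common ⟩
        X * w * (V (suc m) + ω m * V m) + X * w * (q m * Δu j m) + w * d * (q m * P m) * Ru j m
          ≡⟨ shuffle₃ (X * w) (V (suc m)) (ω m) (V m) (q m * Δu j m) (w * d * (q m * P m)) (Ru j m) ⟩
        X * w * (V (suc m) + (q m * Δu j m + ω m * V m)) + w * d * (q m * P m) * (Ru j m + ω m * 0) ∎
        where
        shuffle₃ : ∀ a v o u D e R → a * (v + o * u) + a * D + e * R ≡ a * (v + (D + o * u)) + e * (R + o * 0)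
        shuffle₃ = solve-∀
      cases (yes _) = +-cancelʳ-≤ (s₂ * (d * q m * P m)) _ _ (begin
        s₁ * (d * (q m * P m)) + s₂ * (d * q m * P m) ≤⟨ common ⟩
        X * w * (V (suc m) + ω m * V m) + X * w * (q m * Δu j m) + w * d * (q m * P m) * Ru j m
          ≡⟨ shuffle₃ X w (V (suc m)) (ω m) (V m) (q m * Δu j m) (w * d * (q m * P m) * Ru j m) ⟩
        X * (w * ω m) * V m + (X * w * (V (suc m) + q m * Δu j m) + w * d * (q m * P m) * Ru j m)
          ≤⟨ +-monoˡ-≤ _ (lower (suc j) m (clear-* cl) (extend cl F)) ⟩
        s₂ * (d * q m * P m) + X * (w * ω m) * L + w * ω m * (d * q m) * P m * R + (X * w * (V (suc m) + q m * Δu j m) + w * d * (q m * P m) * Ru j m)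
          ≡⟨ shuffle₄ (s₂ * (d * q m * P m)) X w (ω m) L d (q m) (P m) R (V (suc m)) (q m * Δu j m) (Ru j m) ⟩
        X * w * (V (suc m) + (q m * Δu j m + ω m * L)) + w * d * (q m * P m) * (Ru j m + ω m * R) + s₂ * (d * q m * P m) ∎)
        where
        L R : ℕ
        L = Δl (suc j) m
        R = Rl (suc j) m
        shuffle₃ : ∀ X w v o u D e → X * w * (v + o * u) + X * w * D + e ≡ X * (w * o) * u + (X * w * (v + D) + e)
        shuffle₃ = solve-∀
        shuffle₄ : ∀ s X w o L d q P R v D U → s + X * (w * o) * L + w * o * (d * q) * P * R + (X * w * (v + D) + w * d * (q * P) * U) ≡
          X * w * (v + (D + o * L)) + w * d * (q * P) * (U + o * R) + s
        shuffle₄ = solve-∀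

-- Inequalities for (1 + 1/j)^j and (2j)!

dbl : ℕ → ℕ
dbl zero = 0
dbl (suc n) = suc (suc (dbl n))

dbl≡ : ∀ n → dbl n ≡ n + n
dbl≡ zero = refl
dbl≡ (suc n) = cong suc (trans (cong suc (dbl≡ n)) (sym (+-suc n n)))

^-dbl : ∀ a n → a ^ dbl n ≡ (a * a) ^ n
^-dbl a zero = refl
^-dbl a (suc n) = trans (cong (λ z → a * (a * z)) (^-dbl a n)) (sym (*-assoc a a _))

-- (1 + 1/j)^k ≤ 1 + y + y²/2 + y³/4 for y = k/j ≤ 1; the right side is 11/4 at y = 1.
compound-bound : ∀ j k → k ≤ j → 4 * (j * j * j) * suc j ^ k ≤ j ^ k * (4 * (j * j * j) + 4 * k * (j * j) + 2 * (k * k) * j + k * k * k)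
compound-bound j zero _ = ≤-reflexive (identity (j * j * j) (j * j) j)
  where
  identity : ∀ c b a → 4 * c * 1 ≡ 1 * (4 * c + 4 * 0 * b + 2 * (0 * 0) * a + 0 * 0 * 0)
  identity = solve-∀
compound-bound j (suc k) k<j = begin
  4 * (j * j * j) * (suc j * suc j ^ k) ≡⟨ shuffle₁ (4 * (j * j * j)) (suc j) (suc j ^ k) ⟩
  suc j * (4 * (j * j * j) * suc j ^ k) ≤⟨ *-monoʳ-≤ (suc j) (compound-bound j k (<⇒≤ k<j)) ⟩
  suc j * (j ^ k * (4 * (j * j * j) + 4 * k * (j * j) + 2 * (k * k) * j + k * k * k))
    ≡⟨ shuffle₂ j (j ^ k) (4 * (j * j * j) + 4 * k * (j * j) + 2 * (k * k) * j) k ⟩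
  j ^ k * (suc j * (4 * (j * j * j) + 4 * k * (j * j) + 2 * (k * k) * j) + j * (k * k * k) + k * (k * k)) ≤⟨
    *-monoʳ-≤ (j ^ k) (+-monoʳ-≤ (suc j * (4 * (j * j * j) + 4 * k * (j * j) + 2 * (k * k) * j) + j * (k * k * k)) (*-monoˡ-≤ (k * k) (<⇒≤ k<j))) ⟩
  j ^ k * (suc j * (4 * (j * j * j) + 4 * k * (j * j) + 2 * (k * k) * j) + j * (k * k * k) + j * (k * k))
    ≤⟨ *-monoʳ-≤ (j ^ k) (m≤m+n _ (2 * (j * j) + 3 * (j * k) + j)) ⟩
  j ^ k * (suc j * (4 * (j * j * j) + 4 * k * (j * j) + 2 * (k * k) * j) + j * (k * k * k) + j * (k * k) + (2 * (j * j) + 3 * (j * k) + j))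
    ≡⟨ cong (j ^ k *_) (shuffle₃ j k) ⟩
  j ^ k * (j * (4 * (j * j * j) + 4 * suc k * (j * j) + 2 * (suc k * suc k) * j + suc k * suc k * suc k))
    ≡⟨ shuffle₄ (j ^ k) j _ ⟩
  j * j ^ k * (4 * (j * j * j) + 4 * suc k * (j * j) + 2 * (suc k * suc k) * j + suc k * suc k * suc k) ∎
  where
  open ≤-Reasoning
  shuffle₁ : ∀ a b c → a * (b * c) ≡ b * (a * c)
  shuffle₁ = solve-∀
  shuffle₂ : ∀ j p s k → suc j * (p * (s + k * k * k)) ≡ p * (suc j * s + j * (k * k * k) + k * (k * k))
  shuffle₂ = solve-∀
  shuffle₃ : ∀ j k → suc j * (4 * (j * j * j) + 4 * k * (j * j) + 2 * (k * k) * j) + j * (k * k * k) + j * (k * k) + (2 * (j * j) + 3 * (j * k) + j) ≡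
    j * (4 * (j * j * j) + 4 * suc k * (j * j) + 2 * (suc k * suc k) * j + suc k * suc k * suc k)
  shuffle₃ = solve-∀
  shuffle₄ : ∀ p j s → p * (j * s) ≡ j * p * s
  shuffle₄ = solve-∀

e<11/4 : ∀ j → 0 < j → 4 * suc j ^ j ≤ 11 * j ^ j
e<11/4 j 0<j = *-cancelˡ-≤ (j * j * j) {{m*n≢0 (j * j) j {{m*n≢0 j j {{j≢0}} {{j≢0}}}} {{j≢0}}}} (begin
  j * j * j * (4 * suc j ^ j) ≡⟨ shuffle₁ (j * j * j) (suc j ^ j) ⟩
  4 * (j * j * j) * suc j ^ j ≤⟨ compound-bound j j ≤-refl ⟩
  j ^ j * (4 * (j * j * j) + 4 * j * (j * j) + 2 * (j * j) * j + j * j * j) ≡⟨ shuffle₂ (j ^ j) j ⟩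
  j * j * j * (11 * j ^ j) ∎)
  where
  open ≤-Reasoning
  j≢0 : NonZero j
  j≢0 = >-nonZero 0<j
  shuffle₁ : ∀ c x → c * (4 * x) ≡ 4 * c * x
  shuffle₁ = solve-∀
  shuffle₂ : ∀ p j → p * (4 * (j * j * j) + 4 * j * (j * j) + 2 * (j * j) * j + j * j * j) ≡ j * j * j * (11 * p)
  shuffle₂ = solve-∀

-- From j to j + 1 the quotient j^(2j) / (2j)! grows by at most (11/4)² (j + 1) / (2 (2j + 1)),
-- which is below 2 from j = 9 on; the true rate tends to (e/2)² ≈ 1.85. The first nine values are
-- evaluated.
factorial-bound : ∀ j → 0 < j → 4 * j ^ dbl j ≤ 2 ^ j * dbl j !
factorial-bound j 0<j with j ≤? 9
... | yes j≤9 = small j 0<j j≤9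
  where
  small : ∀ j → 0 < j → j ≤ 9 → 4 * j ^ dbl j ≤ 2 ^ j * dbl j !
  small 1 _ _ = ≤ᵇ⇒≤ _ _ tt
  small 2 _ _ = ≤ᵇ⇒≤ _ _ tt
  small 3 _ _ = ≤ᵇ⇒≤ _ _ tt
  small 4 _ _ = ≤ᵇ⇒≤ _ _ tt
  small 5 _ _ = ≤ᵇ⇒≤ _ _ tt
  small 6 _ _ = ≤ᵇ⇒≤ _ _ tt
  small 7 _ _ = ≤ᵇ⇒≤ _ _ tt
  small 8 _ _ = ≤ᵇ⇒≤ _ _ tt
  small 9 _ _ = ≤ᵇ⇒≤ _ _ tt
  small (suc (suc (suc (suc (suc (suc (suc (suc (suc (suc _)))))))))) _ (s≤s (s≤s (s≤s (s≤s (s≤s (s≤s (s≤s (s≤s (s≤s ())))))))))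
factorial-bound (suc j) 0<j | no j≰9 = begin
  4 * (suc j * (suc j * suc j ^ dbl j)) ≤⟨ core ⟩
  2 * 2 * suc (dbl j) * suc j * (4 * j ^ dbl j)
    ≤⟨ *-monoʳ-≤ (2 * 2 * suc (dbl j) * suc j) (factorial-bound j (≤-trans (s≤s z≤n) 9≤j)) ⟩
  2 * 2 * suc (dbl j) * suc j * (2 ^ j * dbl j !) ≡⟨ shuffle₁ (suc (dbl j)) j (2 ^ j) (dbl j !) ⟩
  2 * 2 ^ j * ((2 + (j + j)) * (suc (dbl j) * dbl j !))
    ≡⟨ cong (λ z → 2 * 2 ^ j * ((2 + z) * (suc (dbl j) * dbl j !))) (sym (dbl≡ j)) ⟩
  2 * 2 ^ j * (suc (suc (dbl j)) * (suc (dbl j) * dbl j !)) ∎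
  where
  open ≤-Reasoning
  9≤j : 9 ≤ j
  9≤j = s≤s⁻¹ (≰⇒> j≰9)
  shuffle₁ : ∀ d j p f → 2 * 2 * d * suc j * (p * f) ≡ 2 * p * ((2 + (j + j)) * (d * f))
  shuffle₁ = solve-∀
  x z : ℕ
  x = suc j ^ j
  z = j ^ j
  sq : ∀ a → a ^ dbl j ≡ a ^ j * a ^ j
  sq a = trans (cong (a ^_) (dbl≡ j)) (^-distribˡ-+-* a j j)
  shuffle₂ : ∀ s x → 4 * (4 * (s * (s * (x * x)))) ≡ s * s * (4 * x * (4 * x))
  shuffle₂ = solve-∀
  shuffle₃ : ∀ j z → suc j * suc j * (11 * z * (11 * z)) ≡ suc j * (z * z) * (121 * j + 121)
  shuffle₃ = solve-∀
  shuffle₄ : ∀ j z → suc j * (z * z) * (121 * j + (7 * j + 64)) ≡ 4 * (2 * 2 * suc (j + j) * suc j * (4 * (z * z)))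
  shuffle₄ = solve-∀
  core : 4 * (suc j * (suc j * suc j ^ dbl j)) ≤ 2 * 2 * suc (dbl j) * suc j * (4 * j ^ dbl j)
  core = *-cancelˡ-≤ 4 (begin
    4 * (4 * (suc j * (suc j * suc j ^ dbl j))) ≡⟨ cong (λ t → 4 * (4 * (suc j * (suc j * t)))) (sq (suc j)) ⟩
    4 * (4 * (suc j * (suc j * (x * x)))) ≡⟨ shuffle₂ (suc j) x ⟩
    suc j * suc j * (4 * x * (4 * x))
      ≤⟨ *-monoʳ-≤ (suc j * suc j) (*-mono-≤ (e<11/4 j (≤-trans (s≤s z≤n) 9≤j)) (e<11/4 j (≤-trans (s≤s z≤n) 9≤j))) ⟩
    suc j * suc j * (11 * z * (11 * z)) ≡⟨ shuffle₃ j z ⟩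
    suc j * (z * z) * (121 * j + 121)
      ≤⟨ *-monoʳ-≤ (suc j * (z * z)) (+-monoʳ-≤ (121 * j) (≤-trans (m≤m+n 121 6) (+-monoˡ-≤ 64 (*-monoʳ-≤ 7 9≤j)))) ⟩
    suc j * (z * z) * (121 * j + (7 * j + 64)) ≡⟨ shuffle₄ j z ⟩
    4 * (2 * 2 * suc (j + j) * suc j * (4 * (z * z)))
      ≡⟨ cong₂ (λ s t → 4 * (2 * 2 * suc s * suc j * (4 * t))) (sym (dbl≡ j)) (sym (sq j)) ⟩
    4 * (2 * 2 * suc (dbl j) * suc j * (4 * j ^ dbl j)) ∎)

bernoulli : ∀ a b k → a ^ suc k + suc k * (a ^ k * b) ≤ (a + b) ^ suc k
bernoulli a b zero = ≤-reflexive (identity a b)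
  where
  identity : ∀ a b → a * 1 + 1 * (1 * b) ≡ (a + b) * 1
  identity = solve-∀
bernoulli a b (suc k) = begin
  a * a ^ suc k + suc (suc k) * (a ^ suc k * b) ≤⟨ m≤m+n _ (b * (suc k * (a ^ k * b))) ⟩
  a * a ^ suc k + suc (suc k) * (a ^ suc k * b) + b * (suc k * (a ^ k * b)) ≡⟨ shuffle a b k (a ^ k) ⟩
  (a + b) * (a ^ suc k + suc k * (a ^ k * b)) ≤⟨ *-monoʳ-≤ (a + b) (bernoulli a b k) ⟩
  (a + b) * (a + b) ^ suc k ∎
  where
  open ≤-Reasoning
  shuffle : ∀ a b k p → a * (a * p) + suc (suc k) * (a * p * b) + b * (suc k * (p * b)) ≡ (a + b) * (a * p + suc k * (p * b))
  shuffle = solve-∀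

^-distribʳ-* : ∀ n a b → (a * b) ^ n ≡ a ^ n * b ^ n
^-distribʳ-* zero a b = refl
^-distribʳ-* (suc n) a b = trans (cong (a * b *_) (^-distribʳ-* n a b)) (shuffle a b (a ^ n) (b ^ n))
  where
  shuffle : ∀ a b c d → a * b * (c * d) ≡ a * c * (b * d)
  shuffle = solve-∀

-- Truncation losses as elementary symmetric functions

module Loss (q ω : ℕ → ℕ) (ω<q : ∀ m → ω m < q m) (y : ℕ → ℕ) where

  open Sieve q ω ω<q y

  q>0 : ∀ m → 0 < q m
  q>0 m = ≤-<-trans z≤n (ω<q m)

  P>0 : ∀ m → 0 < P m
  P>0 zero = s≤s z≤n
  P>0 (suc m) = *-mono-≤ (q>0 m) (P>0 m)

  V>0 : ∀ m → 0 < V m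
  V>0 zero = s≤s z≤n
  V>0 (suc m) = *-mono-≤ (m<n⇒0<n∸m (ω<q m)) (V>0 m)

  V-mono : ∀ m → V (suc m) ≤ q m * V m
  V-mono m = *-monoˡ-≤ (V m) (m∸n≤m (q m) (ω m))

  -- F Y k m = P m · V(Y)/P(Y) · e_k(ω i / q i : Y ≤ i < m), with V(Y)/P(Y) replaced by V(m)/P(m) for m < Y.
  F : ℕ → ℕ → ℕ → ℕ
  F Y zero zero = 1
  F Y zero (suc m) = pick (m <? Y) (V (suc m)) (q m * F Y zero m)
  F Y (suc k) zero = 0
  F Y (suc k) (suc m) = q m * F Y (suc k) m + pick (m <? Y) 0 (ω m * F Y k m)

  V≤F : ∀ Y m → V m ≤ F Y 0 m
  V≤F Y zero = ≤-refl
  V≤F Y (suc m) with m <? Y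
  ... | yes _ = ≤-refl
  ... | no _ = ≤-trans (V-mono m) (*-monoʳ-≤ (q m) (V≤F Y m))

  F-V : ∀ Y m → m ≤ Y → F Y 0 m ≡ V m
  F-V Y zero _ = refl
  F-V Y (suc m) m<Y with m <? Y
  ... | yes _ = refl
  ... | no m≮Y = contradiction m<Y m≮Y

  F-zero : ∀ Y k m → m ≤ Y → F Y (suc k) m ≡ 0
  F-zero Y k zero _ = refl
  F-zero Y k (suc m) m<Y with m <? Y
  ... | yes _ = trans (+-identityʳ _) (trans (cong (q m *_) (F-zero Y k m (<⇒≤ m<Y))) (*-zeroʳ (q m)))
  ... | no m≮Y = contradiction m<Y m≮Y

  F-step : ∀ Y k m → q m * F Y (suc (suc k)) m + ω m * F Y (suc k) m ≤ F Y (suc (suc k)) (suc m)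
  F-step Y k m with m <? Y
  ... | yes m<Y = ≤-reflexive (cong (q m * F Y (suc (suc k)) m +_) (trans (cong (ω m *_) (F-zero Y k m (<⇒≤ m<Y))) (*-zeroʳ (ω m))))
  ... | no _ = ≤-refl

  -- One summand per level: products of k, k + 2, k + 4, ... indices that are at least y (j + 1), y
  -- (j + 2), y (j + 3), ...; `I` is the number of levels.
  G : ℕ → ℕ → ℕ → ℕ → ℕ
  G zero j k m = 0
  G (suc I) j k m = F (y (suc j)) k m + G I (suc j) (suc (suc k)) m

  G-step : ∀ I j k m → q m * G I j (suc (suc k)) m + ω m * G I j (suc k) m ≤ G I j (suc (suc k)) (suc m)
  G-step zero j k m = ≤-reflexive (identity (q m) (ω m))
    where
    identity : ∀ a b → a * 0 + b * 0 ≡ 0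
    identity = solve-∀
  G-step (suc I) j k m = ≤-trans (≤-reflexive (shuffle (q m) (ω m) (F (y (suc j)) (suc (suc k)) m) _ (F (y (suc j)) (suc k) m) _))
      (+-mono-≤ (F-step (y (suc j)) k m) (G-step I (suc j) (suc (suc k)) m))
    where
    shuffle : ∀ q o a b c d → q * (a + b) + o * (c + d) ≡ (q * a + o * c) + (q * b + o * d)
    shuffle = solve-∀

  G-scale : ∀ I j k m → q m * G I j (suc k) m ≤ G I j (suc k) (suc m)
  G-scale zero j k m = ≤-reflexive (*-zeroʳ (q m))
  G-scale (suc I) j k m = ≤-trans (≤-reflexive (*-distribˡ-+ (q m) (F (y (suc j)) (suc k) m) _)) (+-mono-≤ (m≤m+n _ _) (G-scale I (suc j) (suc (suc k)) m))

  -- Indices are chosen in decreasing order, so a product dropped because its last index is at least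
  -- Y has all its indices at least Y. It carries V m / P m for that last index m, which is at most
  -- V Y / P Y. Each level uses up an index, so m levels suffice.
  Δl≤G : ∀ I j m → m ≤ I → Δl j m ≤ G I j 2 m
  Δu≤G : ∀ I j m → m ≤ I → Δu j m ≤ G I j 1 m
  Δl≤G I j zero _ = z≤n
  Δl≤G I j (suc m) m<I = ≤-trans (+-mono-≤ (*-monoʳ-≤ (q m) (Δl≤G I j m (<⇒≤ m<I))) (*-monoʳ-≤ (ω m) (Δu≤G I j m (<⇒≤ m<I)))) (G-step I j 0 m)
  Δu≤G I j zero _ = z≤n
  Δu≤G (suc I) j (suc m) m<I with m <? y (suc j)
  ... | yes m<Y = begin
    q m * Δu j m + ω m * Δl (suc j) m
      ≤⟨ +-mono-≤ (*-monoʳ-≤ (q m) (Δu≤G (suc I) j m (<⇒≤ m<I))) (*-monoʳ-≤ (ω m) (Δl≤G I (suc j) m (s≤s⁻¹ m<I))) ⟩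
    q m * (F Y 1 m + G I (suc j) 3 m) + ω m * G I (suc j) 2 m
      ≡⟨ shuffle (q m) (F Y 1 m) (G I (suc j) 3 m) (ω m * G I (suc j) 2 m) ⟩
    q m * F Y 1 m + 0 + (q m * G I (suc j) 3 m + ω m * G I (suc j) 2 m)
      ≤⟨ +-monoʳ-≤ (q m * F Y 1 m + 0) (G-step I (suc j) 1 m) ⟩
    q m * F Y 1 m + 0 + G I (suc j) 3 (suc m) ∎
    where
    open ≤-Reasoning
    Y = y (suc j)
    shuffle : ∀ q a b c → q * (a + b) + c ≡ q * a + 0 + (q * b + c)
    shuffle = solve-∀
  ... | no _ = begin
    q m * Δu j m + ω m * V m ≤⟨ +-mono-≤ (*-monoʳ-≤ (q m) (Δu≤G (suc I) j m (<⇒≤ m<I))) (*-monoʳ-≤ (ω m) (V≤F Y m)) ⟩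
    q m * (F Y 1 m + G I (suc j) 3 m) + ω m * F Y 0 m ≡⟨ shuffle (q m) (F Y 1 m) (G I (suc j) 3 m) (ω m * F Y 0 m) ⟩
    q m * F Y 1 m + ω m * F Y 0 m + q m * G I (suc j) 3 m
      ≤⟨ +-monoʳ-≤ (q m * F Y 1 m + ω m * F Y 0 m) (G-scale I (suc j) 2 m) ⟩
    q m * F Y 1 m + ω m * F Y 0 m + G I (suc j) 3 (suc m) ∎
    where
    open ≤-Reasoning
    Y = y (suc j)
    shuffle : ∀ q a b c → q * (a + b) + c ≡ q * a + c + q * b
    shuffle = solve-∀

  -- P m times the sum of ω i / q i over Y ≤ i < m.
  Gs : ℕ → ℕ → ℕ
  Gs Y zero = 0
  Gs Y (suc m) = q m * Gs Y m + pick (m <? Y) 0 (ω m * P m)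

  Gs-zero : ∀ Y m → m ≤ Y → Gs Y m ≡ 0
  Gs-zero Y zero _ = refl
  Gs-zero Y (suc m) m<Y with m <? Y
  ... | yes _ = trans (+-identityʳ _) (trans (cong (q m *_) (Gs-zero Y m (<⇒≤ m<Y))) (*-zeroʳ (q m)))
  ... | no m≮Y = contradiction m<Y m≮Y

  -- The inequality e_k ≤ e_1^k / k! for elementary symmetric functions, by adding one variable at a
  -- time with `bernoulli`.
  elementary : ∀ Y k m → k ! * F Y k m * P m ^ k ≤ F Y 0 m * Gs Y m ^ k
  elementary Y zero m = ≤-reflexive (cong (_* 1) (*-identityˡ (F Y 0 m)))
  elementary Y (suc k) zero = ≤-trans (≤-reflexive (cong (_* 1 ^ suc k) (*-zeroʳ (suc k !)))) z≤n
  elementary Y (suc k) (suc m) = cases (m <? Y)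
    where
    open ≤-Reasoning
    cases : (b : Dec (m < Y)) → suc k ! * (q m * F Y (suc k) m + pick b 0 (ω m * F Y k m)) * (q m * P m) ^ suc k ≤
      pick b (V (suc m)) (q m * F Y 0 m) * (q m * Gs Y m + pick b 0 (ω m * P m)) ^ suc k
    cases (yes m<Y) = ≤-trans (≤-reflexive (trans (cong (λ t → suc k ! * (q m * t + 0) * (q m * P m) ^ suc k) (F-zero Y k m (<⇒≤ m<Y)))
      (zeros (suc k !) (q m) ((q m * P m) ^ suc k)))) z≤n
      where
      zeros : ∀ a b c → a * (b * 0 + 0) * c ≡ 0
      zeros = solve-∀
    cases (no _) = begin
      suc k * f * (Q * F₁ + O * F₀) * (Q * p) ^ suc k
        ≡⟨ cong (λ t → suc k * f * (Q * F₁ + O * F₀) * (Q * p * t)) (^-distribʳ-* k Q p) ⟩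
      suc k * f * (Q * F₁ + O * F₀) * (Q * p * (Q ^ k * p ^ k)) ≡⟨ shuffle₁ k f Q F₁ O F₀ p (Q ^ k) (p ^ k) ⟩
      Q * (Q * Q ^ k) * (suc k * f * F₁ * (p * p ^ k)) + suc k * (O * p * (Q * Q ^ k)) * (f * F₀ * p ^ k) ≤⟨ +-mono-≤
        (*-monoʳ-≤ (Q * (Q * Q ^ k)) (elementary Y (suc k) m)) (*-monoʳ-≤ (suc k * (O * p * (Q * Q ^ k))) (elementary Y k m)) ⟩
      Q * (Q * Q ^ k) * (Z * (g * g ^ k)) + suc k * (O * p * (Q * Q ^ k)) * (Z * g ^ k)
        ≡⟨ shuffle₂ k Q (Q ^ k) Z g (g ^ k) (O * p) ⟩
      Q * Z * (Q * g * (Q ^ k * g ^ k) + suc k * (Q ^ k * g ^ k * (O * p)))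
        ≡⟨ cong (λ t → Q * Z * (Q * g * t + suc k * (t * (O * p)))) (sym (^-distribʳ-* k Q g)) ⟩
      Q * Z * ((Q * g) ^ suc k + suc k * ((Q * g) ^ k * (O * p))) ≤⟨ *-monoʳ-≤ (Q * Z) (bernoulli (Q * g) (O * p) k) ⟩
      Q * Z * (Q * g + O * p) ^ suc k ∎
      where
      f Q O F₁ F₀ p g Z : ℕ
      f = k !
      Q = q m
      O = ω m
      F₁ = F Y (suc k) m
      F₀ = F Y k m
      p = P m
      g = Gs Y m
      Z = F Y 0 m
      shuffle₁ : ∀ k f Q F₁ O F₀ p a b → suc k * f * (Q * F₁ + O * F₀) * (Q * p * (a * b)) ≡
        Q * (Q * a) * (suc k * f * F₁ * (p * b)) + suc k * (O * p * (Q * a)) * (f * F₀ * b)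
      shuffle₁ = solve-∀
      shuffle₂ : ∀ k Q a Z g b o → Q * (Q * a) * (Z * (g * b)) + suc k * (o * (Q * a)) * (Z * b) ≡ Q * Z * (Q * g * (a * b) + suc k * (a * b * o))
      shuffle₂ = solve-∀

-- Geometric decay of the losses and size of the remainder

budget : (ℕ → ℕ) → ℕ → ℕ → ℕ
budget e zero j = 0
budget e (suc n) j = e j + e (suc j) + 4 + budget e n (suc j)

module Levels (q ω : ℕ → ℕ) (ω<q : ∀ m → ω m < q m) (y : ℕ → ℕ) where

  open Sieve q ω ω<q y
  open Loss q ω ω<q y

  module _ (antitone : ∀ j → y (suc j) ≤ y j) (sparse : ∀ j m → y j ≤ m → 132 * ω m ≤ q m)
    (level : ∀ j m → m ≤ y j → 40 * Gs (y (suc j)) m ≤ 19 * P m)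
    (levels : ∀ j → 40 * Gs (y j) (y 0) ≤ 19 * (j * P (y 0))) where

    -- With G = ∑ ω/q, the bound ∏ (1 - ω/q) ≥ (399/400 - G/2)², for the constants κ₁ = 399, κ₂ = 200, κ₃ = 400².
    module Ratio (κ₁ κ₂ κ₃ κ₄ κ₅ : ℕ) (κ₁²≤κ₃ : κ₁ * κ₁ ≤ κ₃) (κ₄+κ₅≡κ₁ : κ₄ + κ₅ ≡ κ₁) (1+κ₁≡2κ₂ : suc κ₁ ≡ 2 * κ₂) (κ₂≤κ₂² : κ₂ ≤ κ₂ * κ₂)
      (sparse′ : ∀ j m → y j ≤ m → κ₂ * κ₂ * ω m ≤ κ₄ * q m) (level′ : ∀ j m → m ≤ y j → κ₂ * Gs (y (suc j)) m ≤ κ₅ * P m) where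

      -- A new factor has to satisfy 1 - ω/q ≥ (A′ / (q A))², which after expansion is `middle`.
      -- There κ₁ bounds the linear term, and the extra 1 in `suc κ₁ ≡ 2 * κ₂` pays for the square
      -- of `c`.
      ratio-square : ∀ j m → m ≤ y j → ∃ λ A → A + κ₂ * Gs (y (suc j)) m ≡ κ₁ * P m × F (y (suc j)) 0 m * (A * A) ≤ κ₃ * (P m * P m) * V m
      ratio-square j zero _ = κ₁ , trans (cong (κ₁ +_) (*-zeroʳ κ₂)) (trans (+-identityʳ κ₁) (sym (*-identityʳ κ₁))) ,
        ≤-trans (≤-reflexive (*-identityˡ _)) (≤-trans κ₁²≤κ₃ (≤-reflexive (sym (trans (*-identityʳ _) (*-identityʳ κ₃)))))
      ratio-square j (suc m) m<y = cases (m <? y (suc j))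
        where
        open ≤-Reasoning
        Y Q O p g v W : ℕ
        Y = y (suc j)
        Q = q m
        O = ω m
        p = P m
        g = Gs Y m
        v = V m
        W = Q ∸ O
        W+O : W + O ≡ Q
        W+O = m∸n+n≡m (<⇒≤ (ω<q m))
        cases : (b : Dec (m < Y)) → ∃ λ A → A + κ₂ * (Q * g + pick b 0 (O * p)) ≡ κ₁ * (Q * p) ×
          pick b (W * v) (Q * F Y 0 m) * (A * A) ≤ κ₃ * (Q * p * (Q * p)) * (W * v)
        cases (yes m<Y) = κ₁ * (Q * p) , trans (cong (λ t → κ₁ * (Q * p) + κ₂ * (Q * t + 0)) (Gs-zero Y m (<⇒≤ m<Y))) (zeros (κ₁ * (Q * p)) κ₂ Q) , (begin
          W * v * (κ₁ * (Q * p) * (κ₁ * (Q * p))) ≡⟨ shuffle κ₁ (W * v) (Q * p) ⟩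
          κ₁ * κ₁ * (Q * p * (Q * p)) * (W * v) ≤⟨ *-monoˡ-≤ (W * v) (*-monoˡ-≤ (Q * p * (Q * p)) κ₁²≤κ₃) ⟩
          κ₃ * (Q * p * (Q * p)) * (W * v) ∎)
          where
          zeros : ∀ a k q → a + k * (q * 0 + 0) ≡ a
          zeros = solve-∀
          shuffle : ∀ c w p → w * (c * p * (c * p)) ≡ c * c * (p * p) * w
          shuffle = solve-∀
        cases (no m≮Y) = A′ , A′-eq , (begin
          Q * f * (A′ * A′) ≤⟨ *-monoʳ-≤ (Q * f) square ⟩
          Q * f * (Q * W * (A * A)) ≡⟨ shuffle₁ Q f W (A * A) ⟩
          Q * Q * W * (f * (A * A)) ≤⟨ *-monoʳ-≤ (Q * Q * W) (proj₂ (proj₂ ih)) ⟩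
          Q * Q * W * (κ₃ * (p * p) * v) ≡⟨ shuffle₂ κ₃ Q W p v ⟩
          κ₃ * (Q * p * (Q * p)) * (W * v) ∎)
          where
          ih = ratio-square j m (<⇒≤ m<y)
          A f c : ℕ
          A = proj₁ ih
          f = F Y 0 m
          c = κ₂ * (O * p)
          A-eq : A + κ₂ * g ≡ κ₁ * p
          A-eq = proj₁ (proj₂ ih)
          κ₄p≤A : κ₄ * p ≤ A
          κ₄p≤A = +-cancelʳ-≤ (κ₂ * g) _ _ (≤-trans (+-monoʳ-≤ (κ₄ * p) (level′ j m (<⇒≤ m<y)))
            (≤-reflexive (trans (sym (*-distribʳ-+ p κ₄ κ₅)) (trans (cong (_* p) κ₄+κ₅≡κ₁) (sym A-eq)))))
          A≤κ₁p : A ≤ κ₁ * p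
          A≤κ₁p = ≤-trans (m≤m+n A (κ₂ * g)) (≤-reflexive A-eq)
          κ₂c≤QA : κ₂ * κ₂ * (O * p) ≤ Q * A
          κ₂c≤QA = begin
            κ₂ * κ₂ * (O * p) ≡⟨ sym (*-assoc (κ₂ * κ₂) O p) ⟩
            κ₂ * κ₂ * O * p ≤⟨ *-monoˡ-≤ p (sparse′ (suc j) m (≮⇒≥ m≮Y)) ⟩
            κ₄ * Q * p ≡⟨ shuffle κ₄ Q p ⟩
            Q * (κ₄ * p) ≤⟨ *-monoʳ-≤ Q κ₄p≤A ⟩
            Q * A ∎
            where
            shuffle : ∀ a b p → a * b * p ≡ b * (a * p)
            shuffle = solve-∀
          c≤QA : c ≤ Q * A
          c≤QA = ≤-trans (*-monoˡ-≤ (O * p) κ₂≤κ₂²) κ₂c≤QA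
          A′ : ℕ
          A′ = Q * A ∸ c
          A′+c : A′ + c ≡ Q * A
          A′+c = m∸n+n≡m c≤QA
          A′-eq : A′ + κ₂ * (Q * g + O * p) ≡ κ₁ * (Q * p)
          A′-eq = trans (shuffle₃ κ₂ A′ (Q * g) (O * p)) (trans (cong (_+ κ₂ * (Q * g)) A′+c) (trans (shuffle₄ κ₂ Q A g) (trans (cong (Q *_) A-eq) (shuffle₅ κ₁ Q p))))
            where
            shuffle₃ : ∀ t a g o → a + t * (g + o) ≡ a + t * o + t * g
            shuffle₃ = solve-∀
            shuffle₄ : ∀ t q a g → q * a + t * (q * g) ≡ q * (a + t * g)
            shuffle₄ = solve-∀
            shuffle₅ : ∀ t q p → q * (t * p) ≡ t * (q * p)
            shuffle₅ = solve-∀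
          middle : Q * O * (A * A) + c * c ≤ 2 * (c * (Q * A))
          middle = begin
            Q * O * (A * A) + c * c ≤⟨ +-mono-≤ (*-monoʳ-≤ (Q * O) (*-monoˡ-≤ A A≤κ₁p)) (≤-reflexive (shuffle₆ κ₂ (O * p))) ⟩
            Q * O * (κ₁ * p * A) + O * p * (κ₂ * κ₂ * (O * p))
              ≤⟨ +-monoʳ-≤ (Q * O * (κ₁ * p * A)) (*-monoʳ-≤ (O * p) κ₂c≤QA) ⟩
            Q * O * (κ₁ * p * A) + O * p * (Q * A) ≡⟨ shuffle₇ κ₁ Q O p A ⟩
            suc κ₁ * (O * p * (Q * A)) ≡⟨ cong (_* (O * p * (Q * A))) 1+κ₁≡2κ₂ ⟩
            2 * κ₂ * (O * p * (Q * A)) ≡⟨ shuffle₈ κ₂ (O * p) (Q * A) ⟩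
            2 * (c * (Q * A)) ∎
            where
            shuffle₆ : ∀ k x → k * x * (k * x) ≡ x * (k * k * x)
            shuffle₆ = solve-∀
            shuffle₇ : ∀ k Q O p A → Q * O * (k * p * A) + O * p * (Q * A) ≡ suc k * (O * p * (Q * A))
            shuffle₇ = solve-∀
            shuffle₈ : ∀ k x z → 2 * k * (x * z) ≡ 2 * (k * x * z)
            shuffle₈ = solve-∀
          square : A′ * A′ ≤ Q * W * (A * A)
          square = +-cancelʳ-≤ (Q * O * (A * A) + c * c) _ _ (begin
            A′ * A′ + (Q * O * (A * A) + c * c) ≤⟨ +-monoʳ-≤ (A′ * A′) middle ⟩
            A′ * A′ + 2 * (c * (Q * A)) ≡⟨ cong (λ t → A′ * A′ + 2 * (c * t)) (sym A′+c) ⟩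
            A′ * A′ + 2 * (c * (A′ + c)) ≡⟨ shuffle₈ A′ c ⟩
            (A′ + c) * (A′ + c) + c * c ≡⟨ cong (λ t → t * t + c * c) A′+c ⟩
            Q * A * (Q * A) + c * c ≡⟨ cong (λ t → Q * A * (t * A) + c * c) (sym W+O) ⟩
            Q * A * ((W + O) * A) + c * c ≡⟨ shuffle₉ Q A W O (c * c) ⟩
            Q * W * (A * A) + (Q * O * (A * A) + c * c) ∎)
            where
            shuffle₈ : ∀ a c → a * a + 2 * (c * (a + c)) ≡ (a + c) * (a + c) + c * c
            shuffle₈ = solve-∀
            shuffle₉ : ∀ Q A W O c → Q * A * ((W + O) * A) + c ≡ Q * W * (A * A) + (Q * O * (A * A) + c)
            shuffle₉ = solve-∀
          shuffle₁ : ∀ Q f W a → Q * f * (Q * W * a) ≡ Q * Q * W * (f * a)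
          shuffle₁ = solve-∀
          shuffle₂ : ∀ t Q W p v → Q * Q * W * (t * (p * p) * v) ≡ t * (Q * p * (Q * p)) * (W * v)
          shuffle₂ = solve-∀

      ratio-at : ∀ j → κ₄ * κ₄ * F (y (suc j)) 0 (y j) ≤ κ₃ * V (y j)
      ratio-at j = *-cancelˡ-≤ (p * p) {{m*n≢0 p p {{p≢0}} {{p≢0}}}} (begin
        p * p * (κ₄ * κ₄ * f) ≡⟨ shuffle₁ κ₄ p f ⟩
        f * (κ₄ * p * (κ₄ * p)) ≤⟨ *-monoʳ-≤ f (*-mono-≤ κ₄p≤A κ₄p≤A) ⟩
        f * (A * A) ≤⟨ proj₂ (proj₂ r) ⟩
        κ₃ * (p * p) * V (y j) ≡⟨ shuffle₂ κ₃ p (V (y j)) ⟩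
        p * p * (κ₃ * V (y j)) ∎)
        where
        open ≤-Reasoning
        r = ratio-square j (y j) ≤-refl
        p f A g : ℕ
        p = P (y j)
        f = F (y (suc j)) 0 (y j)
        A = proj₁ r
        g = Gs (y (suc j)) (y j)
        p≢0 : NonZero p
        p≢0 = >-nonZero (P>0 (y j))
        κ₄p≤A : κ₄ * p ≤ A
        κ₄p≤A = +-cancelʳ-≤ (κ₂ * g) _ _ (≤-trans (+-monoʳ-≤ (κ₄ * p) (level′ j (y j) ≤-refl))
          (≤-reflexive (trans (sym (*-distribʳ-+ p κ₄ κ₅)) (trans (cong (_* p) κ₄+κ₅≡κ₁) (sym (proj₁ (proj₂ r)))))))
        shuffle₁ : ∀ k p f → p * p * (k * k * f) ≡ f * (k * p * (k * p))
        shuffle₁ = solve-∀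
        shuffle₂ : ∀ k p v → k * (p * p) * v ≡ p * p * (k * v)
        shuffle₂ = solve-∀

    -- With G ≤ 19/40 the bound is (399/400 - 19/80)² = (304/400)² = (19/25)² = 361/625. The 132 of
    -- `sparse` comes from 200² ≤ 304 · 132.
    ratio-level : ∀ j → 361 * F (y (suc j)) 0 (y j) ≤ 625 * V (y j)
    ratio-level j = reduce (F (y (suc j)) 0 (y j)) (V (y j)) (Ratio.ratio-at 399 200 160000 304 95 (≤ᵇ⇒≤ (399 * 399) 160000 tt) refl refl (≤ᵇ⇒≤ 200 (200 * 200) tt) sparse′ level′ j)
      where
      reduce : ∀ f v → 304 * 304 * f ≤ 160000 * v → 361 * f ≤ 625 * v
      reduce f v h = *-cancelˡ-≤ 256 (≤-trans (≤-reflexive (sym (*-assoc 256 361 f))) (≤-trans h (≤-reflexive (*-assoc 256 625 v))))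
      sparse′ : ∀ j m → y j ≤ m → 200 * 200 * ω m ≤ 304 * q m
      sparse′ j m le = ≤-trans (*-monoˡ-≤ (ω m) (≤ᵇ⇒≤ (200 * 200) (304 * 132) tt))
        (≤-trans (≤-reflexive (*-assoc 304 132 (ω m))) (*-monoʳ-≤ 304 (sparse j m le)))
      level′ : ∀ j m → m ≤ y j → 200 * Gs (y (suc j)) m ≤ 95 * P m
      level′ j m le = ≤-trans (≤-reflexive (*-assoc 5 40 (Gs (y (suc j)) m))) (≤-trans (*-monoʳ-≤ 5 (level j m le)) (≤-reflexive (sym (*-assoc 5 19 (P m)))))

    ratio-above : ∀ j i → 361 * F (y (suc j)) 0 (i + y j) ≤ 625 * F (y j) 0 (i + y j)
    ratio-above j zero = ≤-trans (ratio-level j) (≤-reflexive (cong (625 *_) (sym (F-V (y j) (y j) ≤-refl))))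
    ratio-above j (suc i) = cases (i + y j <? y (suc j)) (i + y j <? y j)
      where
      m = i + y j
      cases : (a : Dec (m < y (suc j))) (b : Dec (m < y j)) → 361 * pick a (V (suc m)) (q m * F (y (suc j)) 0 m) ≤ 625 * pick b (V (suc m)) (q m * F (y j) 0 m)
      cases (yes lt) _ = contradiction (≤-trans (antitone j) (m≤n+m (y j) i)) (<⇒≱ lt)
      cases (no _) (yes lt) = contradiction (m≤n+m (y j) i) (<⇒≱ lt)
      cases (no _) (no _) = ≤-trans (≤-reflexive (*-swap 361 (q m) _)) (≤-trans (*-monoʳ-≤ (q m) (ratio-above j i)) (≤-reflexive (*-swap (q m) 625 _)))

    y-top : ∀ j → y j ≤ y 0
    y-top zero = ≤-refl
    y-top (suc j) = ≤-trans (antitone j) (y-top j)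

    ratio : ∀ j → 361 ^ j * F (y j) 0 (y 0) ≤ 625 ^ j * V (y 0)
    ratio zero = ≤-reflexive (cong (1 *_) (F-V (y 0) (y 0) ≤-refl))
    ratio (suc j) = begin
      361 * 361 ^ j * F (y (suc j)) 0 (y 0) ≡⟨ swap 361 (361 ^ j) _ ⟩
      361 ^ j * (361 * F (y (suc j)) 0 (y 0))
        ≤⟨ *-monoʳ-≤ (361 ^ j) (subst (λ m → 361 * F (y (suc j)) 0 m ≤ 625 * F (y j) 0 m) (m∸n+n≡m (y-top j)) (ratio-above j (y 0 ∸ y j))) ⟩
      361 ^ j * (625 * F (y j) 0 (y 0)) ≡⟨ swap′ (361 ^ j) 625 _ ⟩
      625 * (361 ^ j * F (y j) 0 (y 0)) ≤⟨ *-monoʳ-≤ 625 (ratio j) ⟩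
      625 * (625 ^ j * V (y 0)) ≡⟨ sym (*-assoc 625 (625 ^ j) _) ⟩
      625 * 625 ^ j * V (y 0) ∎
      where
      open ≤-Reasoning
      swap : ∀ a b c → a * b * c ≡ b * (a * c)
      swap = solve-∀
      swap′ : ∀ a b c → a * (b * c) ≡ b * (a * c)
      swap′ = solve-∀

    combine : ∀ a f F p F₀ g b c t → 0 < f → 0 < p → f * F * p ≤ F₀ * g → a * g ≤ b * c * p → 4 * c ≤ t * f → 4 * a * F ≤ F₀ * b * t
    combine a f F p F₀ g b c t 0<f 0<p h₁ h₂ h₃ = *-cancelˡ-≤ (f * p) {{m*n≢0 f p {{>-nonZero 0<f}} {{>-nonZero 0<p}}}} (begin
      f * p * (4 * a * F) ≡⟨ shuffle₁ a f F p ⟩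
      4 * a * (f * F * p) ≤⟨ *-monoʳ-≤ (4 * a) h₁ ⟩
      4 * a * (F₀ * g) ≡⟨ shuffle₂ a F₀ g ⟩
      4 * F₀ * (a * g) ≤⟨ *-monoʳ-≤ (4 * F₀) h₂ ⟩
      4 * F₀ * (b * c * p) ≡⟨ shuffle₃ F₀ b c p ⟩
      F₀ * b * p * (4 * c) ≤⟨ *-monoʳ-≤ (F₀ * b * p) h₃ ⟩
      F₀ * b * p * (t * f) ≡⟨ shuffle₄ F₀ b p t f ⟩
      f * p * (F₀ * b * t) ∎)
      where
      open ≤-Reasoning
      shuffle₁ : ∀ a f F p → f * p * (4 * a * F) ≡ 4 * a * (f * F * p)
      shuffle₁ = solve-∀
      shuffle₂ : ∀ a F g → 4 * a * (F * g) ≡ 4 * F * (a * g)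
      shuffle₂ = solve-∀
      shuffle₃ : ∀ F b c p → 4 * F * (b * c * p) ≡ F * b * p * (4 * c)
      shuffle₃ = solve-∀
      shuffle₄ : ∀ F b p t f → F * b * p * (t * f) ≡ f * p * (F * b * t)
      shuffle₄ = solve-∀

    -- The three estimates `levels`, `factorial-bound` and `ratio` multiply to ((19/40)² · 2 ·
    -- 625/361)^j / 4 = (25/32)^j / 4.
    term-bound : ∀ j → 0 < j → 4 * 32 ^ j * F (y j) (dbl j) (y 0) ≤ 25 ^ j * V (y 0)
    term-bound j 0<j = *-cancelˡ-≤ (50 ^ j) {{m^n≢0 50 j}} (begin
      50 ^ j * (4 * 32 ^ j * f) ≡⟨ trans (shuffle₁ (50 ^ j) (32 ^ j) f) (cong (λ t → 4 * t * f) (trans (sym (^-distribʳ-* j 50 32)) (sym (^-dbl 40 j)))) ⟩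
      4 * 40 ^ dbl j * f ≤⟨ combine (40 ^ dbl j) (dbl j !) f (P (y 0) ^ dbl j) F₀ (Gs (y j) (y 0) ^ dbl j) (19 ^ dbl j) (j ^ dbl j) (2 ^ j)
          (!-positive (dbl j)) (m^n>0 (P (y 0)) {{>-nonZero (P>0 (y 0))}} (dbl j)) (elementary (y j) (dbl j) (y 0)) powers (factorial-bound j 0<j) ⟩
      F₀ * 19 ^ dbl j * 2 ^ j ≡⟨ cong (λ t → F₀ * t * 2 ^ j) (^-dbl 19 j) ⟩
      F₀ * 361 ^ j * 2 ^ j ≡⟨ shuffle₂ F₀ (361 ^ j) (2 ^ j) ⟩
      2 ^ j * (361 ^ j * F₀) ≤⟨ *-monoʳ-≤ (2 ^ j) (ratio j) ⟩
      2 ^ j * (625 ^ j * V (y 0))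
        ≡⟨ trans (sym (*-assoc (2 ^ j) (625 ^ j) _)) (cong (_* V (y 0)) (trans (sym (^-distribʳ-* j 2 625)) (^-distribʳ-* j 50 25))) ⟩
      50 ^ j * 25 ^ j * V (y 0) ≡⟨ *-assoc (50 ^ j) (25 ^ j) _ ⟩
      50 ^ j * (25 ^ j * V (y 0)) ∎)
      where
      open ≤-Reasoning
      f F₀ : ℕ
      f = F (y j) (dbl j) (y 0)
      F₀ = F (y j) 0 (y 0)
      !-positive : ∀ n → 0 < n !
      !-positive n = >-nonZero⁻¹ (n !) {{n !≢0}}
      powers : 40 ^ dbl j * Gs (y j) (y 0) ^ dbl j ≤ 19 ^ dbl j * j ^ dbl j * P (y 0) ^ dbl j
      powers = begin
        40 ^ dbl j * Gs (y j) (y 0) ^ dbl j ≡⟨ sym (^-distribʳ-* (dbl j) 40 _) ⟩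
        (40 * Gs (y j) (y 0)) ^ dbl j ≤⟨ ^-monoˡ-≤ (dbl j) (levels j) ⟩
        (19 * (j * P (y 0))) ^ dbl j
          ≡⟨ trans (^-distribʳ-* (dbl j) 19 _) (trans (cong (19 ^ dbl j *_) (^-distribʳ-* (dbl j) j _)) (sym (*-assoc (19 ^ dbl j) _ _))) ⟩
        19 ^ dbl j * j ^ dbl j * P (y 0) ^ dbl j ∎
      shuffle₁ : ∀ a b f → a * (4 * b * f) ≡ 4 * (a * b) * f
      shuffle₁ = solve-∀
      shuffle₂ : ∀ a b c → a * b * c ≡ c * (b * a)
      shuffle₂ = solve-∀

    -- The tail of the geometric series with terms (25/32)^i / 4 from i = j + 1 on; at j = 0 it is
    -- 25/28, short of 1.
    G-bound : ∀ I j → 28 * 32 ^ j * G I j (dbl (suc j)) (y 0) ≤ 25 ^ suc j * V (y 0)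
    G-bound zero j = ≤-trans (≤-reflexive (*-zeroʳ (28 * 32 ^ j))) z≤n
    G-bound (suc I) j = *-cancelˡ-≤ 32 (begin
      32 * (28 * 32 ^ j * (f + g)) ≡⟨ shuffle₁ (32 ^ j) f g ⟩
      7 * (4 * 32 ^ suc j * f) + 28 * 32 ^ suc j * g
        ≤⟨ +-mono-≤ (*-monoʳ-≤ 7 (term-bound (suc j) (s≤s z≤n))) (G-bound I (suc j)) ⟩
      7 * (25 ^ suc j * V (y 0)) + 25 * 25 ^ suc j * V (y 0) ≡⟨ shuffle₂ (25 ^ suc j) (V (y 0)) ⟩
      32 * (25 ^ suc j * V (y 0)) ∎)
      where
      open ≤-Reasoning
      f g : ℕ
      f = F (y (suc j)) (dbl (suc j)) (y 0)
      g = G I (suc j) (dbl (suc (suc j))) (y 0)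
      shuffle₁ : ∀ p f g → 32 * (28 * p * (f + g)) ≡ 7 * (4 * (32 * p) * f) + 28 * (32 * p) * g
      shuffle₁ = solve-∀
      shuffle₂ : ∀ p v → 7 * (p * v) + 25 * p * v ≡ 32 * (p * v)
      shuffle₂ = solve-∀

    loss-bound : 28 * Δl 0 (y 0) ≤ 25 * V (y 0)
    loss-bound = ≤-trans (*-monoʳ-≤ 28 (Δl≤G (y 0) 0 (y 0) ≤-refl)) (G-bound (y 0) 0)

  module _ (ω≤2 : ∀ m → ω m ≤ 2) where

    R≤3^ : ∀ j m → Rl j m ≤ 3 ^ m × Ru j m ≤ 3 ^ m
    R≤3^ j zero = ≤-refl , ≤-refl
    R≤3^ j (suc m) = step (proj₁ (R≤3^ j m)) (proj₂ (R≤3^ j m)) , step (proj₂ (R≤3^ j m)) (picked (m <? y (suc j)))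
      where
      step : ∀ {a b} → a ≤ 3 ^ m → b ≤ 3 ^ m → a + ω m * b ≤ 3 * 3 ^ m
      step a≤ b≤ = +-mono-≤ a≤ (*-mono-≤ (ω≤2 m) b≤)
      picked : (b : Dec (m < y (suc j))) → pick b (Rl (suc j) m) 0 ≤ 3 ^ m
      picked (yes _) = proj₁ (R≤3^ (suc j) m)
      picked (no _) = z≤n

    Rl-bound : ∀ j C m → (∀ i → Ru j i ≤ C) → Rl j m ≤ suc (2 * m) * C
    Rl-bound j C zero h = ≤-trans (h 0) (≤-reflexive (sym (+-identityʳ C)))
    Rl-bound j C (suc m) h = ≤-trans (+-mono-≤ (Rl-bound j C m h) (*-mono-≤ (ω≤2 m) (h m))) (≤-reflexive (shuffle m C))
      where
      shuffle : ∀ m C → suc (2 * m) * C + 2 * C ≡ suc (2 * suc m) * C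
      shuffle = solve-∀

    Ru-bound : ∀ j C → (∀ i → i ≤ y (suc j) → Rl (suc j) i ≤ C) → ∀ m → Ru j m ≤ suc (2 * y (suc j)) * C
    Ru-bound j C h m = ≤-trans (clipped m) (*-monoˡ-≤ C (s≤s (*-monoʳ-≤ 2 (m⊓n≤n m (y (suc j))))))
      where
      Y = y (suc j)
      clipped : ∀ m → Ru j m ≤ suc (2 * (m ⊓ Y)) * C
      clipped zero = ≤-trans (h 0 z≤n) (≤-reflexive (sym (+-identityʳ C)))
      clipped (suc m) = cases (m <? Y)
        where
        cases : (b : Dec (m < Y)) → Ru j m + ω m * pick b (Rl (suc j) m) 0 ≤ suc (2 * (suc m ⊓ Y)) * C
        cases (no m≮Y) = ≤-trans (≤-reflexive (trans (cong (Ru j m +_) (*-zeroʳ (ω m))) (+-identityʳ (Ru j m))))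
          (≤-trans (clipped m) (*-monoˡ-≤ C (s≤s (*-monoʳ-≤ 2 (⊓-monoˡ-≤ Y (n≤1+n m))))))
        cases (yes m<Y) = ≤-trans (+-mono-≤ (≤-trans (clipped m) (≤-reflexive (cong (λ t → suc (2 * t) * C) (m≤n⇒m⊓n≡m (<⇒≤ m<Y)))))
          (*-mono-≤ (ω≤2 m) (h m (<⇒≤ m<Y)))) (≤-reflexive (trans (shuffle m C) (cong (λ t → suc (2 * t) * C) (sym (m≤n⇒m⊓n≡m m<Y)))))
          where
          shuffle : ∀ m C → suc (2 * m) * C + 2 * C ≡ suc (2 * suc m) * C
          shuffle = solve-∀

    module _ (e : ℕ → ℕ) (y≡ : ∀ j → y j ≡ 2 ^ e j) where

      factor : ∀ j m → m ≤ y j → suc (2 * m) ≤ 2 ^ (e j + 2)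
      factor j m m≤y = begin
        suc (2 * m) ≤⟨ s≤s (*-monoʳ-≤ 2 m≤) ⟩
        suc (2 * x) ≤⟨ +-monoˡ-≤ (2 * x) (m^n>0 2 (e j)) ⟩
        x + 2 * x ≤⟨ m≤m+n _ x ⟩
        x + 2 * x + x ≡⟨ shuffle x ⟩
        x * 2 ^ 2 ≡⟨ sym (^-distribˡ-+-* 2 (e j) 2) ⟩
        2 ^ (e j + 2) ∎
        where
        open ≤-Reasoning
        x = 2 ^ e j
        m≤ : m ≤ x
        m≤ = ≤-trans m≤y (≤-reflexive (y≡ j))
        shuffle : ∀ x → x + 2 * x + x ≡ x * 4
        shuffle = solve-∀

      -- A level contributes two indices, hence factors 1 + 2 y j and 1 + 2 y (j + 1), whose
      -- exponents `budget` adds up. After n levels all indices lie below y (n + j), and the bound 3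
      -- per index is used.
      remainder-bound : ∀ n j m → m ≤ y j → Rl j m ≤ 2 ^ budget e n j * 3 ^ y (n + j)
      remainder-bound zero j m m≤y = ≤-trans (proj₁ (R≤3^ j m)) (≤-trans (^-monoʳ-≤ 3 m≤y) (≤-reflexive (sym (+-identityʳ _))))
      remainder-bound (suc n) j m m≤y = begin
        Rl j m ≤⟨ Rl-bound j (suc (2 * y (suc j)) * C) m (Ru-bound j C (λ i i≤ → remainder-bound n (suc j) i i≤)) ⟩
        suc (2 * m) * (suc (2 * y (suc j)) * C)
          ≤⟨ *-mono-≤ (factor j m m≤y) (*-monoˡ-≤ C (factor (suc j) (y (suc j)) ≤-refl)) ⟩
        2 ^ (e j + 2) * (2 ^ (e (suc j) + 2) * (2 ^ budget e n (suc j) * 3 ^ y (n + suc j)))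
          ≡⟨ shuffle (2 ^ (e j + 2)) (2 ^ (e (suc j) + 2)) (2 ^ budget e n (suc j)) (3 ^ y (n + suc j)) ⟩
        2 ^ (e j + 2) * 2 ^ (e (suc j) + 2) * 2 ^ budget e n (suc j) * 3 ^ y (n + suc j)
          ≡⟨ cong₂ _*_ powers (cong (λ t → 3 ^ y t) (+-suc n j)) ⟩
        2 ^ budget e (suc n) j * 3 ^ y (suc n + j) ∎
        where
        open ≤-Reasoning
        C = 2 ^ budget e n (suc j) * 3 ^ y (n + suc j)
        shuffle : ∀ a b c d → a * (b * (c * d)) ≡ a * b * c * d
        shuffle = solve-∀
        exponents : ∀ a b c → a + 2 + (b + 2) + c ≡ a + b + 4 + c
        exponents = solve-∀
        powers : 2 ^ (e j + 2) * 2 ^ (e (suc j) + 2) * 2 ^ budget e n (suc j) ≡ 2 ^ budget e (suc n) j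
        powers = trans (cong (_* 2 ^ budget e n (suc j)) (sym (^-distribˡ-+-* 2 (e j + 2) (e (suc j) + 2))))
          (trans (sym (^-distribˡ-+-* 2 (e j + 2 + (e (suc j) + 2)) (budget e n (suc j)))) (cong (2 ^_) (exponents (e j) (e (suc j)) (budget e n (suc j)))))

-- The sieve thresholds

opaque
  unfolding harmonic₀ harmonic₁

  -- Small relative errors are needed since 1/79 + ... + 1/99 ≈ 0.23706 is close to 19/80; 201 / E₀
  -- uses about half of the room.
  E₀ : ℕ
  E₀ = 200000

  E₀-harmonic : 80 * (E₀ + 201) * harmonic₁ 21 ≤ 19 * harmonic₀ 21 * E₀
  E₀-harmonic = ≤ᵇ⇒≤ _ _ tt

  E₀-large : 10000 ≤ E₀
  E₀-large = ≤ᵇ⇒≤ 10000 200000 tt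

0<E₀ : 0 < E₀
0<E₀ = ≤-trans (s≤s z≤n) E₀-large

-- The size conditions of `upper-ε` and `lower-ε`, added.
J₀ : ℕ
J₀ = suc (2 * E₀ * (8 * E₀)) + (14 * E₀ * (14 * E₀) + 2 ^ (14 * E₀) * (14 * E₀ * (14 * E₀)))

opaque
  -- Exponent of the threshold 2^a₀ below which the sieve is not truncated.
  a₀ : ℕ
  a₀ = 100 * (J₀ + 100 * suc E₀)

  J₀+E₀≤a₀/100 : J₀ + 100 * suc E₀ ≤ a₀ / 100
  J₀+E₀≤a₀/100 = ≤-reflexive (sym (trans (cong (_/ 100) (*-comm 100 (J₀ + 100 * suc E₀))) (m*n/n≡m (J₀ + 100 * suc E₀) 100)))

  a₀-large : 10000 ≤ a₀
  a₀-large = ≤-trans (≤-trans E₀-large (≤-trans (n≤1+n E₀) (≤-trans (m≤n*m (suc E₀) 100) (m≤n+m (100 * suc E₀) J₀)))) (m≤n*m (J₀ + 100 * suc E₀) 100)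

module Reciprocals (e₀ : ℕ) where

  Q : ℕ
  Q = (2 ^ e₀) !

  0<Q : 0 < Q
  0<Q = >-nonZero⁻¹ Q {{(2 ^ e₀) !≢0}}

  I : ℕ → ℕ
  I zero = 0
  I p@(suc _) = pr p * (Q / p)

  I-prime : ∀ {p} → Prime p → p < 2 ^ e₀ → p * I p ≡ Q
  I-prime {zero} pp _ = contradiction pp ¬prime[0]
  I-prime {p@(suc p′)} pp p< = trans (cong (λ t → p * (t * (Q / p))) (𝟙-yes (prime? p) pp)) (trans (cong (p *_) (+-identityʳ (Q / p))) (m*[n/m]≡n p∣Q))
    where
    p∣Q : p ∣ Q
    p∣Q = ∣-trans (m∣m*n (p′ !)) (m≤n⇒m!∣n! (<⇒≤ p<))

  I-other : ∀ {p} → ¬ Prime p → I p ≡ 0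
  I-other {zero} _ = refl
  I-other {p@(suc _)} ¬pp = cong (_* (Q / p)) (pr-no ¬pp)

  open Mertens (2 ^ e₀) Q 0<Q I I-prime I-other public

  private
    2^≤ : ∀ {J} → J ≤ e₀ → 2 ^ J ≤ 2 ^ e₀
    2^≤ = ^-monoʳ-≤ 2

    up : ∀ J → J₀ ≤ J → 2 ^ J ≤ 2 ^ e₀ → E₀ * S J ≤ suc E₀ * (Q * J)
    up J J₀≤J = upper-ε E₀ J (≤-trans (s≤s z≤n) J₀≤J) (≤-trans (≤-trans (n≤1+n _) (m≤m+n _ _)) J₀≤J)

    low : ∀ J → J₀ ≤ J → 2 ^ J ≤ 2 ^ e₀ → E₀ * (Q * J) ≤ E₀ * S J + Q * J
    low J J₀≤J = lower-ε E₀ J 0<E₀ (≤-trans (m≤n+m _ (suc (2 * E₀ * (8 * E₀)))) J₀≤J)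

    module As = Asymptotic E₀ J₀ 0<E₀ up low

  recip : ∀ b → a₀ ≤ b → b ≤ e₀ → 80 * A b ≤ 80 * A (79 * (b / 100)) + 19 * Q
  recip b a₀≤b b≤e₀ = As.reciprocal-sum E₀-harmonic (b / 100) b (≤-trans (m≤m+n _ _) big) (≤-trans (m≤n+m _ J₀) big)
      (≤-trans (≤-reflexive (*-comm 100 (b / 100))) (m/n*n≤m b 100))
      (≤-trans (≤-reflexive (trans (m≡m%n+[m/n]*n b 100) (+-comm (b % 100) _))) (+-mono-≤ (≤-reflexive (*-comm (b / 100) 100)) (<⇒≤ (m%n<n b 100))))
      (2^≤ b≤e₀)
    where
    big : J₀ + 100 * suc E₀ ≤ b / 100
    big = ≤-trans J₀+E₀≤a₀/100 (/-monoˡ-≤ 100 a₀≤b)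

  primeIn : ∀ lo → J₀ ≤ lo → lo ≤ e₀ → suc E₀ * lo + e₀ < E₀ * e₀ → ∃ λ p → Prime p × 2 ^ lo ≤ p × p < 2 ^ e₀
  primeIn lo J₀≤lo lo≤e₀ gap = As.prime-between lo e₀ J₀≤lo lo≤e₀ gap ≤-refl

  A-mono : ∀ {i j} → i ≤ j → A i ≤ A j
  A-mono i≤j = ∑-≤-extend I (^-monoʳ-≤ 2 i≤j)

-- About 0.79 b, rounded to the left end 79 c that `reciprocal-sum` uses with c = b / 100.
step : ℕ → ℕ
step b = a₀ ⊔ 79 * (b / 100)

module Exponents (e₀ : ℕ) (a₀≤e₀ : a₀ ≤ e₀) where

  e : ℕ → ℕ
  e zero = e₀
  e (suc j) = step (e j)

  a₀≤e : ∀ j → a₀ ≤ e j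
  a₀≤e zero = a₀≤e₀
  a₀≤e (suc j) = m≤m⊔n a₀ _

  79/100≤ : ∀ b → 100 * (79 * (b / 100)) ≤ 79 * b
  79/100≤ b = ≤-trans (≤-reflexive (shuffle (b / 100))) (*-monoʳ-≤ 79 (m/n*n≤m b 100))
    where
    shuffle : ∀ c → 100 * (79 * c) ≡ 79 * (c * 100)
    shuffle = solve-∀

  step≤ : ∀ b → a₀ ≤ b → step b ≤ b
  step≤ b a₀≤b = ⊔-lub a₀≤b (*-cancelˡ-≤ 100 (≤-trans (79/100≤ b) (*-monoˡ-≤ b (m≤m+n 79 21))))

  e-antitone : ∀ j → e (suc j) ≤ e j
  e-antitone j = step≤ (e j) (a₀≤e j)

  e≤e₀ : ∀ j → e j ≤ e₀
  e≤e₀ zero = ≤-refl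
  e≤e₀ (suc j) = ≤-trans (e-antitone j) (e≤e₀ j)

  open Reciprocals e₀

  A-level : ∀ j → 80 * A (e j) ≤ 80 * A (e (suc j)) + 19 * Q
  A-level j = ≤-trans (recip (e j) (a₀≤e j) (e≤e₀ j)) (+-monoˡ-≤ (19 * Q) (*-monoʳ-≤ 80 (A-mono (m≤n⊔m a₀ _))))

  A-levels : ∀ j → 80 * A e₀ ≤ 80 * A (e j) + 19 * (j * Q)
  A-levels zero = m≤m+n _ _
  A-levels (suc j) = ≤-trans (A-levels j) (≤-trans (+-monoˡ-≤ (19 * (j * Q)) (A-level j)) (≤-reflexive (shuffle (80 * A (e (suc j))) Q j)))
    where
    shuffle : ∀ a Q j → a + 19 * Q + 19 * (j * Q) ≡ a + 19 * (suc j * Q)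
    shuffle = solve-∀

  -- While e shrinks by 0.79, the sums e j + e (j + 1) form a geometric series with total 1.79 /
  -- 0.21 = 179/21 times e j. The 84 n collects the 4 per level, and 42 a₀ absorbs the last step,
  -- where the ratio may fail. Every step with ratio 0.79 lowers e by at least 1000, which bounds n.
  depth : ∀ v j → e j ≡ v → ∃ λ n → e (n + j) ≡ a₀ × 21 * budget e n j ≤ 179 * e j + 84 * n + 42 * a₀ × 1000 * n ≤ e j + 1000
  depth = <-rec _ go
    where
    open ≤-Reasoning
    go : ∀ v → (∀ {w} → w < v → ∀ j → e j ≡ w → ∃ λ n → e (n + j) ≡ a₀ × 21 * budget e n j ≤ 179 * e j + 84 * n + 42 * a₀ × 1000 * n ≤ e j + 1000) →
      ∀ j → e j ≡ v → ∃ λ n → e (n + j) ≡ a₀ × 21 * budget e n j ≤ 179 * e j + 84 * n + 42 * a₀ × 1000 * n ≤ e j + 1000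
    go v rec j refl with e j ≟ a₀ | e (suc j) ≟ a₀
    ... | yes p | _ = 0 , p , z≤n , z≤n
    ... | no _ | yes p = 1 , p , short , m≤n+m 1000 (e j)
      where
      short : 21 * (e j + e (suc j) + 4 + 0) ≤ 179 * e j + 84 * 1 + 42 * a₀
      short = begin
        21 * (e j + e (suc j) + 4 + 0) ≡⟨ cong (λ t → 21 * (e j + t + 4 + 0)) p ⟩
        21 * (e j + a₀ + 4 + 0) ≤⟨ m≤m+n _ (158 * e j + 21 * a₀) ⟩
        21 * (e j + a₀ + 4 + 0) + (158 * e j + 21 * a₀) ≡⟨ shuffle (e j) a₀ ⟩
        179 * e j + 84 * 1 + 42 * a₀ ∎
        where
        shuffle : ∀ e a → 21 * (e + a + 4 + 0) + (158 * e + 21 * a) ≡ 179 * e + 84 * 1 + 42 * a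
        shuffle = solve-∀
    ... | no _ | no ne = suc n , trans (cong e (sym (+-suc n j))) (proj₁ (proj₂ ih)) , sum , count
      where
      e₁ : ℕ
      e₁ = e (suc j)
      100e₁≤79e : 100 * e₁ ≤ 79 * e j
      100e₁≤79e with ⊔-sel a₀ (79 * (e j / 100))
      ... | inj₁ q = contradiction q ne
      ... | inj₂ q = ≤-trans (≤-reflexive (cong (100 *_) q)) (79/100≤ (e j))
      drop : e₁ + 1000 ≤ e j
      drop = *-cancelˡ-≤ 100 (begin
        100 * (e₁ + 1000) ≡⟨ *-distribˡ-+ 100 e₁ 1000 ⟩
        100 * e₁ + 100 * 1000 ≤⟨ +-mono-≤ 100e₁≤79e (≤-trans (*-monoˡ-≤ 10000 (m≤m+n 10 11)) (*-monoʳ-≤ 21 (≤-trans a₀-large (a₀≤e j)))) ⟩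
        79 * e j + 21 * e j ≡⟨ sym (*-distribʳ-+ (e j) 79 21) ⟩
        100 * e j ∎)
      ih = rec (<-≤-trans (m<m+n e₁ (s≤s z≤n)) drop) (suc j) refl
      n : ℕ
      n = proj₁ ih
      sum : 21 * (e j + e₁ + 4 + budget e n (suc j)) ≤ 179 * e j + 84 * suc n + 42 * a₀
      sum = begin
        21 * (e j + e₁ + 4 + budget e n (suc j)) ≡⟨ shuffle₁ (e j) e₁ (budget e n (suc j)) ⟩
        21 * e j + 21 * e₁ + 84 + 21 * budget e n (suc j) ≤⟨ +-monoʳ-≤ (21 * e j + 21 * e₁ + 84) (proj₁ (proj₂ (proj₂ ih))) ⟩
        21 * e j + 21 * e₁ + 84 + (179 * e₁ + 84 * n + 42 * a₀) ≡⟨ shuffle₂ (e j) e₁ n (42 * a₀) ⟩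
        21 * e j + 2 * (100 * e₁) + 84 * suc n + 42 * a₀
          ≤⟨ +-monoˡ-≤ (42 * a₀) (+-monoˡ-≤ (84 * suc n) (+-monoʳ-≤ (21 * e j) (*-monoʳ-≤ 2 100e₁≤79e))) ⟩
        21 * e j + 2 * (79 * e j) + 84 * suc n + 42 * a₀ ≡⟨ shuffle₃ (e j) (84 * suc n) (42 * a₀) ⟩
        179 * e j + 84 * suc n + 42 * a₀ ∎
        where
        shuffle₁ : ∀ a b c → 21 * (a + b + 4 + c) ≡ 21 * a + 21 * b + 84 + 21 * c
        shuffle₁ = solve-∀
        shuffle₂ : ∀ a b n c → 21 * a + 21 * b + 84 + (179 * b + 84 * n + c) ≡ 21 * a + 2 * (100 * b) + 84 * suc n + c
        shuffle₂ = solve-∀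
        shuffle₃ : ∀ a b c → 21 * a + 2 * (79 * a) + b + c ≡ 179 * a + b + c
        shuffle₃ = solve-∀
      count : 1000 * suc n ≤ e j + 1000
      count = begin
        1000 * suc n ≡⟨ *-suc 1000 n ⟩
        1000 + 1000 * n ≤⟨ +-monoʳ-≤ 1000 (proj₂ (proj₂ (proj₂ ih))) ⟩
        1000 + (e₁ + 1000) ≤⟨ +-monoʳ-≤ 1000 drop ⟩
        1000 + e j ≡⟨ +-comm 1000 (e j) ⟩
        e j + 1000 ∎

-- The sieve problem

∑-unique : ∀ n {P : ℕ → Set} (P? : ∀ i → Dec (P i)) → (∀ i j → i < j → j < n → P i → ¬ P j) → ∑ n (λ i → 𝟙 (P? i)) ≤ 1
∑-unique zero P? excl = z≤n
∑-unique (suc n) P? excl with P? n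
... | no _ = ≤-trans (≤-reflexive (+-identityʳ _)) (∑-unique n P? (λ i j i<j j<n → excl i j i<j (m<n⇒m<1+n j<n)))
... | yes p = ≤-reflexive (cong (_+ 1) (∑-zero n (λ i i<n → 𝟙-no (P? i) (λ q → excl i n i<n ≤-refl q p))))

-- The cost of the indices below 2^a₀: the factorial bounds their moduli, the power of 3 their
-- remainder.
constant : ℕ
constant = (2 ^ a₀) ! * 3 ^ (2 ^ a₀)

module SieveProblem (e₀ : ℕ) (a₀≤e₀ : a₀ ≤ e₀) (k : ℕ) (k-prime : Prime k) (2<k : 2 < k) (N : ℕ) (2∣N : 2 ∣ N) (t₀ X : ℕ) where

  open Exponents e₀ a₀≤e₀
  open Reciprocals e₀ using (Q; 0<Q; I; I-prime; A)

  Active : ℕ → Set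
  Active m = Prime m × m < k

  active? : ∀ m → Dec (Active m)
  active? m = prime? m ×-dec m <? k

  -- m ∣ N - k² t, for t = t₀ + i, written without subtraction.
  form : ℕ → ℕ → ℕ
  form m i = N + (m ∸ 1) * (k * k * (t₀ + i))

  Bad : ℕ → ℕ → Set
  Bad m i = m ∣ t₀ + i ⊎ m ∣ form m i

  bad? : ∀ m i → Dec (Bad m i)
  bad? m i = (m ∣? t₀ + i) ⊎-dec (m ∣? form m i)

  -- Inactive indices get modulus 1 and no bad residue, so the sieve runs over all integers and its
  -- thresholds are sizes of primes.
  qᵈ : ∀ m → Dec (Active m) → ℕ
  qᵈ m (yes _) = m
  qᵈ m (no _) = 1

  badᵈ : ∀ m → Dec (Active m) → ℕ → ℕ
  badᵈ m (yes _) i = 𝟙 (bad? m i)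
  badᵈ m (no _) i = 0

  ωᵈ : ∀ m → Dec (Active m) → ℕ
  ωᵈ m d = ∑ (qᵈ m d) (badᵈ m d)

  q ω : ℕ → ℕ
  q m = qᵈ m (active? m)
  ω m = ωᵈ m (active? m)

  bad : ℕ → ℕ → ℕ
  bad m = badᵈ m (active? m)

  bad≤1 : ∀ m i → bad m i ≤ 1
  bad≤1 m i with active? m
  ... | yes _ = 𝟙≤1 (bad? m i)
  ... | no _ = z≤n

  form-shift : ∀ m i j → form m (i + j) ≡ form m i + (m ∸ 1) * (k * k * j)
  form-shift m i j = shuffle N (m ∸ 1) (k * k) t₀ i j
    where
    shuffle : ∀ N m k t i j → N + m * (k * (t + (i + j))) ≡ N + m * (k * (t + i)) + m * (k * j)
    shuffle = solve-∀

  ω-periodicᵈ : ∀ m d → Periodic (qᵈ m d) (ωᵈ m d) (badᵈ m d)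
  ω-periodicᵈ m (no _) = record { period>0 = s≤s z≤n ; periodic = λ _ → refl ; total = refl }
  ω-periodicᵈ m (yes (pm , _)) = record
    { period>0 = <-trans (s≤s z≤n) (prime>1 pm)
    ; periodic = λ i → ≤-antisym (𝟙-mono (bad? m (i + m)) (bad? m i) (down i)) (𝟙-mono (bad? m i) (bad? m (i + m)) (up i))
    ; total = refl
    }
    where
    m∣extra : m ∣ (m ∸ 1) * (k * k * m)
    m∣extra = ∣n⇒∣m*n (m ∸ 1) (n∣m*n (k * k))
    down : ∀ i → Bad m (i + m) → Bad m i
    down i (inj₁ h) = inj₁ (∣m+n∣m⇒∣n (subst (m ∣_) (trans (sym (+-assoc t₀ i m)) (+-comm (t₀ + i) m)) h) ∣-refl)
    down i (inj₂ h) = inj₂ (∣m+n∣m⇒∣n (subst (m ∣_) (trans (form-shift m i m) (+-comm (form m i) _)) h) m∣extra)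
    up : ∀ i → Bad m i → Bad m (i + m)
    up i (inj₁ h) = inj₁ (subst (m ∣_) (+-assoc t₀ i m) (∣m∣n⇒∣m+n h ∣-refl))
    up i (inj₂ h) = inj₂ (subst (m ∣_) (sym (form-shift m i m)) (∣m∣n⇒∣m+n h m∣extra))

  small∤ : ∀ {m n} → 0 < n → n < m → m ∤ n
  small∤ 0<n n<m = >⇒∤ {{>-nonZero 0<n}} n<m

  -- Modulo m the form is N - k² t, and it is injective in t because m < k does not divide the prime
  -- k.
  form-unique : ∀ {m} → Active m → ∀ i j → i < j → j < m → m ∣ form m i → m ∤ form m j
  form-unique {m} (pm , m<k) i j i<j j<m h h′ = excluded (∣m+n∣m⇒∣n (subst (m ∣_) (trans (cong (form m) (sym (m+[n∸m]≡n (<⇒≤ i<j)))) (form-shift m i (j ∸ i))) h′) h)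
    where
    excluded : m ∤ (m ∸ 1) * (k * k * (j ∸ i))
    excluded d with euclidsLemma (m ∸ 1) (k * k * (j ∸ i)) pm d
    ... | inj₁ d₁ = small∤ (m<n⇒0<n∸m (prime>1 pm)) (≤-reflexive (m+[n∸m]≡n (<⇒≤ (prime>1 pm)))) d₁
    ... | inj₂ d₂ with euclidsLemma (k * k) (j ∸ i) pm d₂
    ...   | inj₂ d₄ = small∤ (m<n⇒0<n∸m i<j) (≤-<-trans (m∸n≤m j i) j<m) d₄
    ...   | inj₁ d₃ = <⇒≢ m<k (prime-∣-prime pm k-prime ([ (λ x → x) , (λ x → x) ]′ (euclidsLemma k k pm d₃)))

  translate-unique : ∀ m i j → i < j → j < m → m ∣ t₀ + i → m ∤ t₀ + j
  translate-unique m i j i<j j<m h h′ = small∤ (m<n⇒0<n∸m i<j) (≤-<-trans (m∸n≤m j i) j<m)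
    (∣m+n∣m⇒∣n (subst (m ∣_) (trans (cong (t₀ +_) (sym (m+[n∸m]≡n (<⇒≤ i<j)))) (sym (+-assoc t₀ i (j ∸ i)))) h′) h)

  ω≤2ᵈ : ∀ m d → ωᵈ m d ≤ 2
  ω≤2ᵈ m (no _) = z≤n
  ω≤2ᵈ m (yes act) = ≤-trans (∑-mono m (λ i _ → split i)) (≤-trans (≤-reflexive (∑-+ m _ _))
      (+-mono-≤ (∑-unique m (λ i → m ∣? t₀ + i) (translate-unique m)) (∑-unique m (λ i → m ∣? form m i) (form-unique act))))
    where
    split : ∀ i → 𝟙 (bad? m i) ≤ 𝟙 (m ∣? t₀ + i) + 𝟙 (m ∣? form m i)
    split i with bad? m i
    ... | no _ = z≤n
    ... | yes (inj₁ h) = ≤-trans (≤-reflexive (sym (𝟙-yes (m ∣? t₀ + i) h))) (m≤m+n _ _)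
    ... | yes (inj₂ h) = ≤-trans (≤-reflexive (sym (𝟙-yes (m ∣? form m i) h))) (m≤n+m _ _)

  ω≤2 : ∀ m → ω m ≤ 2
  ω≤2 m = ω≤2ᵈ m (active? m)

  -- N is even and k is odd, so N - k² t is even only together with t: at the prime 2 there is one
  -- bad residue, not two.
  even-good : ∀ i → 2 ∤ t₀ + i → 𝟙 (bad? 2 i) ≡ 0
  even-good i odd = 𝟙-no (bad? 2 i) excluded
    where
    2∤k : 2 ∤ k
    2∤k d = <⇒≢ 2<k (prime-∣-prime prime[2] k-prime d)
    excluded : ¬ Bad 2 i
    excluded (inj₁ d) = odd d
    excluded (inj₂ d) with euclidsLemma (k * k) (t₀ + i) prime[2] (subst (2 ∣_) (+-identityʳ _) (∣m+n∣m⇒∣n d 2∣N))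
    ... | inj₂ d′ = odd d′
    ... | inj₁ d′ = [ 2∤k , 2∤k ]′ (euclidsLemma k k prime[2] d′)

  ω<qᵈ : ∀ m d → ωᵈ m d < qᵈ m d
  ω<qᵈ m (no _) = s≤s z≤n
  ω<qᵈ m (yes act@(pm , _)) with m ≟ 2
  ... | no m≢2 = ≤-<-trans (ω≤2ᵈ m (yes act)) (≤∧≢⇒< (prime>1 pm) (λ p → m≢2 (sym p)))
  ... | yes refl = s≤s (both (2 ∣? t₀ + 0))
    where
    both : Dec (2 ∣ t₀ + 0) → 0 + 𝟙 (bad? 2 0) + 𝟙 (bad? 2 1) ≤ 1
    both (no odd) = ≤-trans (≤-reflexive (cong (λ t → t + 𝟙 (bad? 2 1)) (even-good 0 odd))) (𝟙≤1 (bad? 2 1))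
    both (yes even) = ≤-trans (≤-reflexive (trans (cong (𝟙 (bad? 2 0) +_) (even-good 1 odd)) (+-identityʳ _))) (𝟙≤1 (bad? 2 0))
      where
      odd : 2 ∤ t₀ + 1
      odd d = small∤ (s≤s z≤n) (s≤s (s≤s z≤n)) (∣m+n∣m⇒∣n d (subst (2 ∣_) (+-identityʳ t₀) even))

  ω<q : ∀ m → ω m < q m
  ω<q m = ω<qᵈ m (active? m)

  pairwise : ∀ i m → i < m → Coprime (q i) (q m)
  pairwise i m i<m = cases (active? i) (active? m)
    where
    cases : (d : Dec (Active i)) (d′ : Dec (Active m)) → Coprime (qᵈ i d) (qᵈ m d′)
    cases (no _) _ = Coprime.1-coprimeTo _
    cases (yes _) (no _) = Coprime.sym (Coprime.1-coprimeTo _)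
    cases (yes (pi , _)) (yes (pm , _)) = prime-coprime pi (λ d → <⇒≢ i<m (prime-∣-prime pi pm d))

  y : ℕ → ℕ
  y j = 2 ^ e j

  open Sieve q ω ω<q y
  open Loss q ω ω<q y
  open Levels q ω ω<q y
  open Count bad bad≤1 (λ m → ω-periodicᵈ m (active? m)) pairwise X

  sparse : ∀ j m → y j ≤ m → 132 * ω m ≤ q m
  sparse j m y≤m = cases (active? m)
    where
    264≤m : 264 ≤ m
    264≤m = ≤-trans (≤-trans (≤-trans (≤ᵇ⇒≤ 264 10000 tt) (≤-trans a₀-large (a₀≤e j))) (<⇒≤ (n<2^n (e j)))) y≤m
    cases : (d : Dec (Active m)) → 132 * ωᵈ m d ≤ qᵈ m d
    cases (no _) = z≤n
    cases (yes act) = ≤-trans (*-monoʳ-≤ 132 (ω≤2ᵈ m (yes act))) 264≤m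

  ωQ≤2qI : ∀ m → m < 2 ^ e₀ → ω m * Q ≤ 2 * (q m * I m)
  ωQ≤2qI m m< = cases (active? m)
    where
    cases : (d : Dec (Active m)) → ωᵈ m d * Q ≤ 2 * (qᵈ m d * I m)
    cases (no _) = z≤n
    cases (yes act) = *-mono-≤ (ω≤2ᵈ m (yes act)) (≤-reflexive (sym (I-prime (proj₁ act) m<)))

  Gs-reciprocals : ∀ Y i → i + Y ≤ 2 ^ e₀ → Gs Y (i + Y) * Q + 2 * (P (i + Y) * ∑ Y I) ≤ 2 * (P (i + Y) * ∑ (i + Y) I)
  Gs-reciprocals Y zero _ = ≤-reflexive (cong (λ t → t * Q + 2 * (P Y * ∑ Y I)) (Gs-zero Y Y ≤-refl))
  Gs-reciprocals Y (suc i) le = cases (i + Y <? Y)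
    where
    open ≤-Reasoning
    m = i + Y
    cases : (b : Dec (m < Y)) → (q m * Gs Y m + pick b 0 (ω m * P m)) * Q + 2 * (q m * P m * ∑ Y I) ≤ 2 * (q m * P m * (∑ m I + I m))
    cases (yes lt) = contradiction (m≤n+m Y i) (<⇒≱ lt)
    cases (no _) = begin
      (q m * Gs Y m + ω m * P m) * Q + 2 * (q m * P m * ∑ Y I) ≡⟨ shuffle₁ (q m) (Gs Y m) (ω m) (P m) Q (∑ Y I) ⟩
      q m * (Gs Y m * Q + 2 * (P m * ∑ Y I)) + P m * (ω m * Q)
        ≤⟨ +-mono-≤ (*-monoʳ-≤ (q m) (Gs-reciprocals Y i (<⇒≤ le))) (*-monoʳ-≤ (P m) (ωQ≤2qI m le)) ⟩
      q m * (2 * (P m * ∑ m I)) + P m * (2 * (q m * I m)) ≡⟨ shuffle₂ (q m) (P m) (∑ m I) (I m) ⟩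
      2 * (q m * P m * (∑ m I + I m)) ∎
      where
      shuffle₁ : ∀ q g o p Q s → (q * g + o * p) * Q + 2 * (q * p * s) ≡ q * (g * Q + 2 * (p * s)) + p * (o * Q)
      shuffle₁ = solve-∀
      shuffle₂ : ∀ q p s i → q * (2 * (p * s)) + p * (2 * (q * i)) ≡ 2 * (q * p * (s + i))
      shuffle₂ = solve-∀

  Gs-bound : ∀ Y m c → Y ≤ m → m ≤ 2 ^ e₀ → 80 * ∑ m I ≤ 80 * ∑ Y I + 19 * (c * Q) → 40 * Gs Y m ≤ 19 * (c * P m)
  Gs-bound Y m c Y≤m m≤ h = *-cancelʳ-≤ _ _ Q {{>-nonZero 0<Q}} (+-cancelʳ-≤ (80 * (P m * ∑ Y I)) _ _ (begin
    40 * Gs Y m * Q + 80 * (P m * ∑ Y I) ≡⟨ shuffle₁ (Gs Y m) Q (P m * ∑ Y I) ⟩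
    40 * (Gs Y m * Q + 2 * (P m * ∑ Y I)) ≤⟨ *-monoʳ-≤ 40 recips ⟩
    40 * (2 * (P m * ∑ m I)) ≡⟨ shuffle₂ (P m) (∑ m I) ⟩
    P m * (80 * ∑ m I) ≤⟨ *-monoʳ-≤ (P m) h ⟩
    P m * (80 * ∑ Y I + 19 * (c * Q)) ≡⟨ shuffle₃ (P m) (∑ Y I) c Q ⟩
    19 * (c * P m) * Q + 80 * (P m * ∑ Y I) ∎))
    where
    open ≤-Reasoning
    recips : Gs Y m * Q + 2 * (P m * ∑ Y I) ≤ 2 * (P m * ∑ m I)
    recips = subst (λ z → Gs Y z * Q + 2 * (P z * ∑ Y I) ≤ 2 * (P z * ∑ z I)) (m∸n+n≡m Y≤m)
      (Gs-reciprocals Y (m ∸ Y) (≤-trans (≤-reflexive (m∸n+n≡m Y≤m)) m≤))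
    shuffle₁ : ∀ g Q s → 40 * g * Q + 80 * s ≡ 40 * (g * Q + 2 * s)
    shuffle₁ = solve-∀
    shuffle₂ : ∀ p s → 40 * (2 * (p * s)) ≡ p * (80 * s)
    shuffle₂ = solve-∀
    shuffle₃ : ∀ p s c Q → p * (80 * s + 19 * (c * Q)) ≡ 19 * (c * p) * Q + 80 * (p * s)
    shuffle₃ = solve-∀

  level : ∀ j m → m ≤ y j → 40 * Gs (y (suc j)) m ≤ 19 * P m
  level j m m≤y with ≤-total m (y (suc j))
  ... | inj₁ m≤ = ≤-trans (≤-reflexive (trans (cong (40 *_) (Gs-zero (y (suc j)) m m≤)) (*-zeroʳ 40))) z≤n
  ... | inj₂ y≤m = ≤-trans (Gs-bound (y (suc j)) m 1 y≤m (≤-trans m≤y (^-monoʳ-≤ 2 (e≤e₀ j)))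
          (≤-trans (*-monoʳ-≤ 80 (∑-≤-extend I m≤y)) (≤-trans (A-level j) (≤-reflexive (cong (λ t → 80 * A (e (suc j)) + 19 * t) (sym (*-identityˡ Q)))))))
          (≤-reflexive (cong (19 *_) (*-identityˡ (P m))))

  levels : ∀ j → 40 * Gs (y j) (y 0) ≤ 19 * (j * P (y 0))
  levels j = Gs-bound (y j) (y 0) j (^-monoʳ-≤ 2 (e≤e₀ j)) ≤-refl (A-levels j)

  antitone : ∀ j → y (suc j) ≤ y j
  antitone j = ^-monoʳ-≤ 2 (e-antitone j)

  F-scale : ∀ Y i → F Y 0 (i + Y) * P Y ≡ V Y * P (i + Y)
  F-scale Y zero = cong (_* P Y) (F-V Y Y ≤-refl)
  F-scale Y (suc i) = cases (i + Y <? Y)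
    where
    m = i + Y
    cases : (b : Dec (m < Y)) → pick b (V (suc m)) (q m * F Y 0 m) * P Y ≡ V Y * (q m * P m)
    cases (yes lt) = contradiction (m≤n+m Y i) (<⇒≱ lt)
    cases (no _) = trans (*-assoc (q m) _ _) (trans (cong (q m *_) (F-scale Y i)) (*-swap (q m) (V Y) (P m)))

  q≤ : ∀ m → q m ≤ suc m
  q≤ m with active? m
  ... | yes _ = n≤1+n m
  ... | no _ = s≤s z≤n

  P≤! : ∀ m → P m ≤ m !
  P≤! zero = ≤-refl
  P≤! (suc m) = *-mono-≤ (q≤ m) (P≤! m)

  n : ℕ
  n = proj₁ (depth e₀ 0 refl)

  e-n : e (n + 0) ≡ a₀
  e-n = proj₁ (proj₂ (depth e₀ 0 refl))

  z : ℕ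
  z = y 0

  P≤F : P z ≤ F (y n) 0 z * (2 ^ a₀) !
  P≤F = begin
    P z ≤⟨ m≤n*m (P z) (V (y n)) {{>-nonZero (V>0 (y n))}} ⟩
    V (y n) * P z ≡⟨ sym (subst (λ t → F (y n) 0 t * P (y n) ≡ V (y n) * P t) (m∸n+n≡m (^-monoʳ-≤ 2 (e≤e₀ n))) (F-scale (y n) (z ∸ y n))) ⟩
    F (y n) 0 z * P (y n) ≤⟨ *-monoʳ-≤ (F (y n) 0 z) (≤-trans (P≤! (y n)) (≤-reflexive (cong (λ t → (2 ^ t) !) e-n′))) ⟩
    F (y n) 0 z * (2 ^ a₀) ! ∎
    where
    open ≤-Reasoning
    e-n′ : e n ≡ a₀
    e-n′ = trans (cong e (sym (+-identityʳ n))) e-n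

  R≤ : Rl 0 z ≤ 2 ^ budget e n 0 * 3 ^ (2 ^ a₀)
  R≤ = ≤-trans (remainder-bound ω≤2 e (λ _ → refl) n 0 z ≤-refl) (≤-reflexive (cong (λ t → 2 ^ budget e n 0 * 3 ^ (2 ^ t)) e-n))

  one : ℕ → ℕ
  one _ = 1

  one-periodic : Periodic 1 1 one
  one-periodic = record { period>0 = s≤s z≤n ; periodic = λ _ → refl ; total = refl }

  main-inequality : X * V z ≤ sift one z * P z + X * Δl 0 z + P z * Rl 0 z
  main-inequality = subst₂ _≤_ (shuffle₁ X (V z)) (shuffle₂ (sift one z) (P z) X (Δl 0 z) (Rl 0 z))
    (lower 0 z (λ i _ → Coprime.sym (Coprime.1-coprimeTo _)) one-periodic)
    where
    shuffle₁ : ∀ X V → X * 1 * V ≡ X * V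
    shuffle₁ = solve-∀
    shuffle₂ : ∀ s p X D R → s * (1 * p) + X * 1 * D + 1 * 1 * p * R ≡ s * p + X * D + p * R
    shuffle₂ = solve-∀

  -- Without survivors at least 3/28 of the main term X V is covered by the remainder P R. As
  -- 625/361 < 2, `ratio` bounds P / V by 2^n (2^a₀)!; the factor 2^n is affordable because n is at
  -- most about e₀ / 1000.
  sift-empty : sift one z ≡ 0 → 3 * X ≤ 28 * constant * 2 ^ (n + budget e n 0)
  sift-empty empty = *-cancelˡ-≤ (361 ^ n * V z) {{m*n≢0 (361 ^ n) (V z) {{m^n≢0 361 n}} {{>-nonZero (V>0 z)}}}} (begin
    361 ^ n * V z * (3 * X) ≡⟨ shuffle₁ (361 ^ n) (V z) X ⟩
    361 ^ n * (3 * (X * V z)) ≤⟨ *-monoʳ-≤ (361 ^ n) 3XV≤28PR ⟩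
    361 ^ n * (28 * (P z * Rl 0 z)) ≤⟨ *-monoʳ-≤ (361 ^ n) (*-monoʳ-≤ 28 (*-mono-≤ P≤F R≤)) ⟩
    361 ^ n * (28 * (F (y n) 0 z * (2 ^ a₀) ! * (2 ^ budget e n 0 * 3 ^ (2 ^ a₀))))
      ≡⟨ shuffle₂ (361 ^ n) (F (y n) 0 z) ((2 ^ a₀) !) (2 ^ budget e n 0) (3 ^ (2 ^ a₀)) ⟩
    361 ^ n * F (y n) 0 z * (28 * constant * 2 ^ budget e n 0)
      ≤⟨ *-monoˡ-≤ _ (≤-trans (ratio antitone sparse level levels n) (*-monoˡ-≤ (V z) 625^≤)) ⟩
    2 ^ n * 361 ^ n * V z * (28 * constant * 2 ^ budget e n 0)
      ≡⟨ shuffle₃ (2 ^ n) (361 ^ n) (V z) (28 * constant) (2 ^ budget e n 0) ⟩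
    361 ^ n * V z * (28 * constant * (2 ^ n * 2 ^ budget e n 0))
      ≡⟨ cong (λ t → 361 ^ n * V z * (28 * constant * t)) (sym (^-distribˡ-+-* 2 n (budget e n 0))) ⟩
    361 ^ n * V z * (28 * constant * 2 ^ (n + budget e n 0)) ∎)
    where
    open ≤-Reasoning
    625^≤ : 625 ^ n ≤ 2 ^ n * 361 ^ n
    625^≤ = ≤-trans (^-monoˡ-≤ n (≤ᵇ⇒≤ 625 722 tt)) (≤-reflexive (^-distribʳ-* n 2 361))
    shuffle₁ : ∀ a v X → a * v * (3 * X) ≡ a * (3 * (X * v))
    shuffle₁ = solve-∀
    shuffle₂ : ∀ a f c b d → a * (28 * (f * c * (b * d))) ≡ a * f * (28 * (c * d) * b)
    shuffle₂ = solve-∀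
    shuffle₃ : ∀ a b v c d → a * b * v * (c * d) ≡ b * v * (c * (a * d))
    shuffle₃ = solve-∀
    3XV≤28PR : 3 * (X * V z) ≤ 28 * (P z * Rl 0 z)
    3XV≤28PR = +-cancelˡ-≤ (25 * (X * V z)) _ _ (begin
      25 * (X * V z) + 3 * (X * V z) ≡⟨ sym (*-distribʳ-+ (X * V z) 25 3) ⟩
      28 * (X * V z) ≤⟨ *-monoʳ-≤ 28 main-inequality ⟩
      28 * (sift one z * P z + X * Δl 0 z + P z * Rl 0 z) ≡⟨ cong (λ t → 28 * (t * P z + X * Δl 0 z + P z * Rl 0 z)) empty ⟩
      28 * (0 * P z + X * Δl 0 z + P z * Rl 0 z) ≡⟨ shuffle₄ X (Δl 0 z) (P z * Rl 0 z) ⟩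
      X * (28 * Δl 0 z) + 28 * (P z * Rl 0 z) ≤⟨ +-monoˡ-≤ _ (*-monoʳ-≤ X (loss-bound antitone sparse level levels)) ⟩
      X * (25 * V z) + 28 * (P z * Rl 0 z) ≡⟨ cong (_+ 28 * (P z * Rl 0 z)) (swap X (V z)) ⟩
      25 * (X * V z) + 28 * (P z * Rl 0 z) ∎)
      where
      shuffle₄ : ∀ X d r → 28 * (0 + X * d + r) ≡ X * (28 * d) + 28 * r
      shuffle₄ = solve-∀
      swap : ∀ X v → X * (25 * v) ≡ 25 * (X * v)
      swap = solve-∀

  good-sound : ∀ M i → 0 < good M i → ∀ m → m < M → Active m → ¬ Bad m i
  good-sound (suc M) i pos m m<1+M act bd with m ≟ M
  ... | no m≢M = good-sound M i (n≢0⇒n>0 (λ z → >⇒≢ pos (cong (_* (1 ∸ bad M i)) z))) m (≤∧≢⇒< (s≤s⁻¹ m<1+M) m≢M) act bd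
  ... | yes refl = >⇒≢ pos (trans (cong (λ t → good M i * (1 ∸ t)) bad≡1) (*-zeroʳ (good M i)))
    where
    bad≡1ᵈ : (d : Dec (Active M)) → badᵈ M d i ≡ 1
    bad≡1ᵈ (yes _) = 𝟙-yes (bad? M i) bd
    bad≡1ᵈ (no ¬act) = contradiction act ¬act
    bad≡1 : bad M i ≡ 1
    bad≡1 = bad≡1ᵈ (active? M)

  sifted : k ≤ 2 ^ e₀ → 28 * constant * 2 ^ (n + budget e n 0) < 3 * X → ∃ λ i → i < X × (∀ m → Prime m → m < k → m ∤ t₀ + i × m ∤ form m i)
  sifted k≤ large = i , proj₁ (proj₂ found) , λ m pm m<k → (λ d → clean m pm m<k (inj₁ d)) , (λ d → clean m pm m<k (inj₂ d))
    where
    found : ∃ λ i → i < X × 0 < 1 * good z i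
    found = ∑-positive X (n≢0⇒n>0 (λ empty → <⇒≱ large (sift-empty empty)))
    i : ℕ
    i = proj₁ found
    clean : ∀ m → Prime m → m < k → ¬ Bad m i
    clean m pm m<k = good-sound z i (subst (0 <_) (*-identityˡ (good z i)) (proj₂ (proj₂ found))) m (<-≤-trans m<k k≤) (pm , m<k)

  -- 179/21 is about 8.524; the difference to 8.53 takes up the terms linear in n.
  sifting-exponent : 100 * (n + budget e n 0) ≤ 853 * e₀ + (1000 + 200 * a₀)
  sifting-exponent = *-cancelˡ-≤ 21 (begin
    21 * (100 * (n + budget e n 0)) ≡⟨ shuffle₁ n (budget e n 0) ⟩
    2100 * n + 100 * (21 * budget e n 0) ≤⟨ +-monoʳ-≤ (2100 * n) (*-monoʳ-≤ 100 (proj₁ (proj₂ (proj₂ (depth e₀ 0 refl))))) ⟩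
    2100 * n + 100 * (179 * e₀ + 84 * n + 42 * a₀) ≤⟨ m≤m+n _ (500 * n) ⟩
    2100 * n + 100 * (179 * e₀ + 84 * n + 42 * a₀) + 500 * n ≡⟨ shuffle₂ n e₀ a₀ ⟩
    11 * (1000 * n) + (17900 * e₀ + 4200 * a₀)
      ≤⟨ +-monoˡ-≤ (17900 * e₀ + 4200 * a₀) (*-monoʳ-≤ 11 (proj₂ (proj₂ (proj₂ (depth e₀ 0 refl))))) ⟩
    11 * (e₀ + 1000) + (17900 * e₀ + 4200 * a₀) ≤⟨ m≤m+n _ (2 * e₀ + 10000) ⟩
    11 * (e₀ + 1000) + (17900 * e₀ + 4200 * a₀) + (2 * e₀ + 10000) ≡⟨ shuffle₃ e₀ a₀ ⟩
    21 * (853 * e₀ + (1000 + 200 * a₀)) ∎)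
    where
    open ≤-Reasoning
    shuffle₁ : ∀ n b → 21 * (100 * (n + b)) ≡ 2100 * n + 100 * (21 * b)
    shuffle₁ = solve-∀
    shuffle₂ : ∀ n e a → 2100 * n + 100 * (179 * e + 84 * n + 42 * a) + 500 * n ≡ 11 * (1000 * n) + (17900 * e + 4200 * a)
    shuffle₂ = solve-∀
    shuffle₃ : ∀ e a → 11 * (e + 1000) + (17900 * e + 4200 * a) + (2 * e + 10000) ≡ 21 * (853 * e + (1000 + 200 * a))
    shuffle₃ = solve-∀

-- The choice of parameters

rough⇒coprimeBelow : ∀ {k n} → (∀ p → Prime p → p < k → p ∤ n) → CoprimeBelow k n
rough⇒coprimeBelow {k} {n} rough m 0<m m<k {d} (d∣n , d∣m) = cases (d ≟ 1)
  where
  0<d : 0 < d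
  0<d = n≢0⇒n>0 (λ { refl → <⇒≢ 0<m (sym (0∣⇒≡0 d∣m)) })
  cases : Dec (d ≡ 1) → d ≡ 1
  cases (yes e) = e
  cases (no d≢1) with p , pp , p∣d ← primeDivisor d (≤∧≢⇒< 0<d (λ e → d≢1 (sym e))) =
    contradiction (∣-trans p∣d d∣n) (rough p pp (≤-<-trans (∣⇒≤ {{>-nonZero 0<m}} (∣-trans p∣d d∣m)) m<k))

prime⇒coprimeBelow : ∀ {k} → Prime k → CoprimeBelow k k
prime⇒coprimeBelow pk = rough⇒coprimeBelow (λ p pp p<k p∣k → <⇒≢ p<k (prime-∣-prime pp pk p∣k))

power-compare : ∀ p q {n r} a b → n ≤ 2 ^ a → 2 ^ b ≤ r → p * a ≤ q * b → n ^ p ≤ r ^ q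
power-compare p q {n} {r} a b n≤ ≤r h = begin
  n ^ p ≤⟨ ^-monoˡ-≤ p n≤ ⟩
  (2 ^ a) ^ p ≡⟨ trans (^-*-assoc 2 a p) (cong (2 ^_) (*-comm a p)) ⟩
  2 ^ (p * a) ≤⟨ ^-monoʳ-≤ 2 h ⟩
  2 ^ (q * b) ≡⟨ sym (trans (^-*-assoc 2 b q) (cong (2 ^_) (*-comm b q))) ⟩
  (2 ^ b) ^ q ≤⟨ ^-monoˡ-≤ q ≤r ⟩
  r ^ q ∎
  where open ≤-Reasoning

-- The length k² t + N is even; δ = 1 adjoins the point at infinity of ℤ/N and gives the odd lengths.
codeFor : ∀ {k t N r} → Prime k → 3 + r ≤ k → r * 2 ≤ k → (∀ p → Prime p → p < k → p ∤ t × p ∤ N) →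
  0 < t → 0 < N → r < N → r * (2 * (k * k)) ≤ N → N + 1 ≤ t → ∀ δ → δ ≤ 1 → Code (Fin (k * k * t + (N + δ))) r
codeFor {k} {t} {N} {r} pk 3+r≤k r*2≤k clean 0<t 0<N r<N rW≤N N<t δ δ≤1 =
  Design.designCode {{prime⇒nonZero pk}} {{>-nonZero 0<t}} (prime⇒coprimeBelow pk) roughᵗ 3+r≤k r*2≤k (≤-trans (+-monoʳ-≤ N δ≤1) N<t) (rest δ δ≤1)
  where
  roughᵗ : CoprimeBelow k t
  roughᵗ = rough⇒coprimeBelow (λ p pp p<k → proj₁ (clean p pp p<k))
  roughᴺ : CoprimeBelow k N
  roughᴺ = rough⇒coprimeBelow (λ p pp p<k → proj₂ (clean p pp p<k))
  2+r≤k : 2 + r ≤ k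
  2+r≤k = ≤-trans (n≤1+n _) 3+r≤k
  rest : ∀ δ → δ ≤ 1 → Code (Fin (N + δ)) r
  rest zero _ = subst (λ m → Code (Fin m) r) (sym (+-identityʳ N)) (affineCode {{>-nonZero 0<N}} roughᴺ 2+r≤k)
  rest (suc zero) _ = PointChoice.pointCode {{>-nonZero 0<N}} roughᴺ 2+r≤k k (2 * (k * k)) {{prime⇒nonZero pk}} 2+r≤k ≤-refl r<N rW≤N
  rest (suc (suc _)) (s≤s ())

-- Every lower bound that the parameters demand of e₀, added up.
D : ℕ
D = a₀ + 2 * J₀ + 100000 + (800 + 100 * constant + (1000 + 200 * a₀))

module Parameters (n L e₀ : ℕ) (2^L≤n : 2 ^ L ≤ n) (n<2^1+L : n < 2 ^ suc L) (D≤e₀ : D ≤ e₀)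
  (1254e₀≤ : e₀ * 1254 ≤ 100 * L) (100L≤ : 100 * L ≤ e₀ * 1254 + 1254) where

  open ≤-Reasoning

  d lo : ℕ
  -- The prime k is sought between 2^(e₀ - d) and 2^e₀. Relative error 1/E₀ suffices once E₀ d
  -- exceeds 2 e₀, and this d lowers the exponent of k by only one part in 2000.
  d = e₀ / 2000
  lo = e₀ ∸ d

  a₀≤e₀ : a₀ ≤ e₀
  a₀≤e₀ = ≤-trans (≤-trans (m≤m+n a₀ (2 * J₀)) (≤-trans (m≤m+n _ 100000) (m≤m+n _ _))) D≤e₀

  2J₀≤e₀ : 2 * J₀ ≤ e₀
  2J₀≤e₀ = ≤-trans (≤-trans (m≤n+m (2 * J₀) a₀) (≤-trans (m≤m+n _ 100000) (m≤m+n _ _))) D≤e₀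

  100000≤e₀ : 100000 ≤ e₀
  100000≤e₀ = ≤-trans (≤-trans (m≤n+m 100000 (a₀ + 2 * J₀)) (m≤m+n _ _)) D≤e₀

  constants≤e₀ : 800 + 100 * constant + (1000 + 200 * a₀) ≤ e₀
  constants≤e₀ = ≤-trans (m≤n+m _ (a₀ + 2 * J₀ + 100000)) D≤e₀

  d*2000≤e₀ : d * 2000 ≤ e₀
  d*2000≤e₀ = m/n*n≤m e₀ 2000

  d≤e₀ : d ≤ e₀
  d≤e₀ = ≤-trans (m≤m*n d 2000) d*2000≤e₀

  lo+d : lo + d ≡ e₀
  lo+d = m∸n+n≡m d≤e₀

  0<d : 0 < d
  0<d = ≤-trans (s≤s z≤n) (/-monoˡ-≤ 2000 100000≤e₀)

  e₀≤2000+ : e₀ ≤ d * 2000 + 2000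
  e₀≤2000+ = ≤-trans (≤-reflexive (trans (m≡m%n+[m/n]*n e₀ 2000) (+-comm _ (d * 2000)))) (+-monoʳ-≤ (d * 2000) (<⇒≤ (m%n<n e₀ 2000)))

  J₀≤lo : J₀ ≤ lo
  J₀≤lo = +-cancelʳ-≤ d J₀ lo (*-cancelˡ-≤ 2 (begin
    2 * (J₀ + d) ≡⟨ *-distribˡ-+ 2 J₀ d ⟩
    2 * J₀ + 2 * d ≤⟨ +-mono-≤ 2J₀≤e₀ (≤-trans (≤-reflexive (*-comm 2 d)) (≤-trans (*-monoʳ-≤ d (≤ᵇ⇒≤ 2 2000 tt)) d*2000≤e₀)) ⟩
    e₀ + e₀ ≡⟨ cong (e₀ +_) (sym (+-identityʳ e₀)) ⟩
    2 * e₀ ≡⟨ cong (2 *_) (sym lo+d) ⟩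
    2 * (lo + d) ∎))

  gap : suc E₀ * lo + e₀ < E₀ * e₀
  gap = begin-strict
    suc E₀ * lo + e₀ ≡⟨ shuffle₁ E₀ lo e₀ ⟩
    E₀ * lo + (lo + e₀) <⟨ +-monoʳ-< (E₀ * lo) (begin-strict
      lo + e₀ ≤⟨ +-mono-≤ (m∸n≤m e₀ d) ≤-refl ⟩
      e₀ + e₀ ≤⟨ +-mono-≤ e₀≤2000+ e₀≤2000+ ⟩
      d * 2000 + 2000 + (d * 2000 + 2000) ≡⟨ shuffle₂ d ⟩
      d * 4000 + 4000 * 1 ≤⟨ +-monoʳ-≤ (d * 4000) (*-monoʳ-≤ 4000 0<d) ⟩
      d * 4000 + 4000 * d ≡⟨ shuffle₃ d ⟩
      8000 * d <⟨ *-monoˡ-< d {{>-nonZero 0<d}} (<-≤-trans (≤ᵇ⇒≤ 8001 10000 tt) E₀-large) ⟩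
      E₀ * d ∎) ⟩
    E₀ * lo + E₀ * d ≡⟨ trans (sym (*-distribˡ-+ E₀ lo d)) (cong (E₀ *_) lo+d) ⟩
    E₀ * e₀ ∎
    where
    shuffle₁ : ∀ E l e → suc E * l + e ≡ E * l + (l + e)
    shuffle₁ = solve-∀
    shuffle₂ : ∀ d → d * 2000 + 2000 + (d * 2000 + 2000) ≡ d * 4000 + 4000 * 1
    shuffle₂ = solve-∀
    shuffle₃ : ∀ d → d * 4000 + 4000 * d ≡ 8000 * d
    shuffle₃ = solve-∀

  private
    prime-k : ∃ λ p → Prime p × 2 ^ lo ≤ p × p < 2 ^ e₀
    prime-k = Reciprocals.primeIn e₀ lo J₀≤lo (m∸n≤m e₀ d) gap

  k : ℕ
  k = proj₁ prime-k
  pk : Prime k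
  pk = proj₁ (proj₂ prime-k)
  2^lo≤k : 2 ^ lo ≤ k
  2^lo≤k = proj₁ (proj₂ (proj₂ prime-k))
  k<2^e₀ : k < 2 ^ e₀
  k<2^e₀ = proj₂ (proj₂ (proj₂ prime-k))

  r : ℕ
  r = k / 2

  lo-pred : ∃ λ l → lo ≡ 1 + l × 4 ≤ l
  lo-pred = lo ∸ 1 , sym (m+[n∸m]≡n (≤-trans (s≤s z≤n) 5≤lo)) , ∸-monoˡ-≤ 1 5≤lo
    where
    5≤lo : 5 ≤ lo
    5≤lo = *-cancelˡ-≤ 2 (+-cancelʳ-≤ (2 * d) _ _ (begin
      2 * 5 + 2 * d ≤⟨ +-mono-≤ (≤-trans (≤ᵇ⇒≤ 10 100000 tt) 100000≤e₀) (≤-trans (≤-reflexive (*-comm 2 d)) (≤-trans (*-monoʳ-≤ d (≤ᵇ⇒≤ 2 2000 tt)) d*2000≤e₀)) ⟩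
      e₀ + e₀ ≡⟨ cong (e₀ +_) (sym (+-identityʳ e₀)) ⟩
      2 * e₀ ≡⟨ trans (cong (2 *_) (sym lo+d)) (*-distribˡ-+ 2 lo d) ⟩
      2 * lo + 2 * d ∎))

  l : ℕ
  l = proj₁ lo-pred

  2^l≤r : 2 ^ l ≤ r
  2^l≤r = begin
    2 ^ l ≡⟨ sym (m*n/n≡m (2 ^ l) 2) ⟩
    2 ^ l * 2 / 2 ≤⟨ /-monoˡ-≤ 2 (≤-trans (≤-reflexive (trans (*-comm (2 ^ l) 2) (cong (2 ^_) (sym (proj₁ (proj₂ lo-pred)))))) 2^lo≤k) ⟩
    k / 2 ∎

  r*2≤k : r * 2 ≤ k
  r*2≤k = m/n*n≤m k 2

  3≤r : 3 ≤ r
  3≤r = ≤-trans (≤ᵇ⇒≤ 3 (2 ^ 4) tt) (≤-trans (^-monoʳ-≤ 2 (proj₂ (proj₂ lo-pred))) 2^l≤r)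

  3+r≤k : 3 + r ≤ k
  3+r≤k = ≤-trans (+-monoˡ-≤ r 3≤r) (≤-trans (≤-reflexive (trans (cong (r +_) (sym (+-identityʳ r))) (*-comm 2 r))) r*2≤k)

  -- 0.0797 · 12.54 = 0.999438. Of the remaining 0.000562 the loss d takes 0.0005, and 0.000062 e₀
  -- outweighs the additive constants.
  power-bound : n ^ 797 ≤ r ^ 10000
  power-bound = power-compare 797 10000 (suc L) l (<⇒≤ n<2^1+L) 2^l≤r exponents
    where
    l+1+d : l + suc d ≡ e₀
    l+1+d = trans (+-suc l d) (trans (cong (_+ d) (sym (proj₁ (proj₂ lo-pred)))) lo+d)
    generic : ∀ a b c f g M h → 100 * (a * suc L) ≤ f * e₀ + g → M * d ≤ h * e₀ → M + g ≤ c * e₀ → f + h + c ≡ M → M ≡ 100 * b → a * suc L ≤ b * l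
    generic a b c f g M h H₁ H₂ H₃ H₄ H₅ = *-cancelˡ-≤ 100 (+-cancelʳ-≤ (M * suc d) _ _ (begin
      100 * (a * suc L) + M * suc d ≤⟨ +-mono-≤ H₁ (≤-trans (≤-reflexive (*-suc M d)) (+-monoʳ-≤ M H₂)) ⟩
      f * e₀ + g + (M + h * e₀) ≡⟨ shuffle₁ (f * e₀) g M (h * e₀) ⟩
      f * e₀ + h * e₀ + (M + g) ≤⟨ +-monoʳ-≤ (f * e₀ + h * e₀) H₃ ⟩
      f * e₀ + h * e₀ + c * e₀ ≡⟨ trans (sym (trans (*-distribʳ-+ e₀ (f + h) c) (cong (_+ c * e₀) (*-distribʳ-+ e₀ f h)))) (cong (_* e₀) H₄) ⟩
      M * e₀ ≡⟨ cong (M *_) (sym l+1+d) ⟩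
      M * (l + suc d) ≡⟨ *-distribˡ-+ M l (suc d) ⟩
      M * l + M * suc d ≡⟨ cong (_+ M * suc d) (trans (cong (_* l) H₅) (*-assoc 100 b l)) ⟩
      100 * (b * l) + M * suc d ∎))
      where
      shuffle₁ : ∀ a g M b → a + g + (M + b) ≡ a + b + (M + g)
      shuffle₁ = solve-∀
    exponents : 797 * suc L ≤ 10000 * l
    exponents = generic 797 10000 62 999438 (797 * 1354) 1000000 500 H₁ H₂ H₃ refl refl
      where
      H₁ : 100 * (797 * suc L) ≤ 999438 * e₀ + 797 * 1354
      H₁ = begin
        100 * (797 * suc L) ≡⟨ *-swap 100 797 (suc L) ⟩
        797 * (100 * suc L) ≡⟨ cong (797 *_) (*-suc 100 L) ⟩
        797 * (100 + 100 * L) ≤⟨ *-monoʳ-≤ 797 (+-monoʳ-≤ 100 100L≤) ⟩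
        797 * (100 + (e₀ * 1254 + 1254))
          ≡⟨ cong (797 *_) (trans (+-comm 100 (e₀ * 1254 + 1254)) (+-assoc (e₀ * 1254) 1254 100)) ⟩
        797 * (e₀ * 1254 + 1354) ≡⟨ *-distribˡ-+ 797 (e₀ * 1254) 1354 ⟩
        797 * (e₀ * 1254) + 797 * 1354
          ≡⟨ cong (_+ 797 * 1354) (trans (cong (797 *_) (*-comm e₀ 1254)) (sym (*-assoc 797 1254 e₀))) ⟩
        999438 * e₀ + 797 * 1354 ∎
      H₂ : 1000000 * d ≤ 500 * e₀
      H₂ = ≤-trans (≤-reflexive (trans (*-assoc 500 2000 d) (cong (500 *_) (*-comm 2000 d)))) (*-monoʳ-≤ 500 d*2000≤e₀)
      H₃ : 1000000 + 797 * 1354 ≤ 62 * e₀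
      H₃ = ≤-trans (≤ᵇ⇒≤ (1000000 + 797 * 1354) (62 * 100000) tt) (*-monoʳ-≤ 62 100000≤e₀)

  -- For N = n′ - K t the condition N < t means t > n′ / (K + 1), whence t₀. Reserving M > k³ for N
  -- leaves room for about s / K values of t; 2^(4 e₀ + 3) in the definition of X covers K (K + 1)
  -- and the roundings.
  n′ δ K s t₀ x X M : ℕ
  n′ = n / 2 * 2
  δ = n % 2
  K = k * k
  s = n′ / suc K
  t₀ = suc s
  x = L ∸ (4 * e₀ + 3)
  X = 2 ^ x
  M = 2 ^ (3 * e₀)

  n≡ : n ≡ n′ + δ
  n≡ = trans (m≡m%n+[m/n]*n n 2) (+-comm δ n′)

  δ≤1 : δ ≤ 1
  δ≤1 = s≤s⁻¹ (m%n<n n 2)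

  4e₀+3≤L : 4 * e₀ + 3 ≤ L
  4e₀+3≤L = *-cancelˡ-≤ 100 (begin
    100 * (4 * e₀ + 3) ≡⟨ shuffle e₀ ⟩
    400 * e₀ + 300 ≤⟨ +-monoʳ-≤ (400 * e₀) (≤-trans (≤-trans (≤ᵇ⇒≤ 300 100000 tt) 100000≤e₀) (m≤n*m e₀ 854)) ⟩
    400 * e₀ + 854 * e₀ ≡⟨ trans (sym (*-distribʳ-+ e₀ 400 854)) (*-comm 1254 e₀) ⟩
    e₀ * 1254 ≤⟨ 1254e₀≤ ⟩
    100 * L ∎)
    where
    shuffle : ∀ e → 100 * (4 * e + 3) ≡ 400 * e + 300
    shuffle = solve-∀

  L≡ : 4 * e₀ + 3 + x ≡ L
  L≡ = m+[n∸m]≡n 4e₀+3≤L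

  854e₀≤ : 854 * e₀ ≤ 100 * x + 300
  854e₀≤ = +-cancelˡ-≤ (400 * e₀) _ _ (begin
    400 * e₀ + 854 * e₀ ≡⟨ trans (sym (*-distribʳ-+ e₀ 400 854)) (*-comm 1254 e₀) ⟩
    e₀ * 1254 ≤⟨ 1254e₀≤ ⟩
    100 * L ≡⟨ cong (100 *_) (sym L≡) ⟩
    100 * (4 * e₀ + 3 + x) ≡⟨ shuffle e₀ x ⟩
    400 * e₀ + (100 * x + 300) ∎)
    where
    shuffle : ∀ e x → 100 * (4 * e + 3 + x) ≡ 400 * e + (100 * x + 300)
    shuffle = solve-∀

  e₀≤x : e₀ ≤ x
  e₀≤x = *-cancelˡ-≤ 100 (+-cancelʳ-≤ 300 _ _ (begin
    100 * e₀ + 300 ≤⟨ +-monoʳ-≤ (100 * e₀) (≤-trans (≤-trans (≤ᵇ⇒≤ 300 100000 tt) 100000≤e₀) (m≤n*m e₀ 754)) ⟩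
    100 * e₀ + 754 * e₀ ≡⟨ sym (*-distribʳ-+ e₀ 100 754) ⟩
    854 * e₀ ≤⟨ 854e₀≤ ⟩
    100 * x + 300 ∎))

  1+K≤ : suc K ≤ 2 ^ (2 * e₀)
  1+K≤ = ≤-trans (*-mono-< k<2^e₀ k<2^e₀) (≤-reflexive (trans (sym (^-distribˡ-+-* 2 e₀ e₀)) (cong (λ t → 2 ^ (e₀ + t)) (sym (+-identityʳ e₀)))))

  KX+M≤ : K * X + M ≤ 2 * 2 ^ (2 * e₀ + x)
  KX+M≤ = begin
    K * X + M ≤⟨ +-mono-≤ (≤-trans (*-monoˡ-≤ X (<⇒≤ 1+K≤)) (≤-reflexive (sym (^-distribˡ-+-* 2 (2 * e₀) x))))
        (^-monoʳ-≤ 2 (≤-trans (≤-reflexive (three e₀)) (+-monoʳ-≤ (2 * e₀) e₀≤x))) ⟩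
    2 ^ (2 * e₀ + x) + 2 ^ (2 * e₀ + x) ≡⟨ cong (2 ^ (2 * e₀ + x) +_) (sym (+-identityʳ _)) ⟩
    2 * 2 ^ (2 * e₀ + x) ∎
    where
    three : ∀ e → 3 * e ≡ 2 * e + e
    three = solve-∀

  n′-large : 2 ^ (4 * e₀ + x + 2) ≤ n′
  n′-large = +-cancelʳ-≤ 1 _ _ (begin
    h + 1 ≤⟨ +-monoʳ-≤ h (m^n>0 2 (4 * e₀ + x + 2)) ⟩
    h + h ≡⟨ cong (h +_) (sym (+-identityʳ h)) ⟩
    2 ^ suc (4 * e₀ + x + 2) ≡⟨ cong (2 ^_) (trans (exponent e₀ x) L≡) ⟩
    2 ^ L ≤⟨ 2^L≤n ⟩
    n ≡⟨ n≡ ⟩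
    n′ + δ ≤⟨ +-monoʳ-≤ n′ δ≤1 ⟩
    n′ + 1 ∎)
    where
    h : ℕ
    h = 2 ^ (4 * e₀ + x + 2)
    exponent : ∀ e x → suc (4 * e + x + 2) ≡ 4 * e + 3 + x
    exponent = solve-∀

  KX+M≤s : K * X + M ≤ s
  KX+M≤s = begin
    K * X + M ≡⟨ sym (m*n/n≡m (K * X + M) (suc K)) ⟩
    (K * X + M) * suc K / suc K ≤⟨ /-monoˡ-≤ (suc K) (begin
      (K * X + M) * suc K ≤⟨ *-mono-≤ KX+M≤ 1+K≤ ⟩
      2 * 2 ^ (2 * e₀ + x) * 2 ^ (2 * e₀)
        ≡⟨ trans (*-assoc 2 (2 ^ (2 * e₀ + x)) (2 ^ (2 * e₀))) (cong (2 *_) (sym (^-distribˡ-+-* 2 (2 * e₀ + x) (2 * e₀)))) ⟩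
      2 ^ suc (2 * e₀ + x + 2 * e₀) ≤⟨ ^-monoʳ-≤ 2 (≤-trans (n≤1+n _) (≤-reflexive (exponent e₀ x))) ⟩
      2 ^ (4 * e₀ + x + 2) ≤⟨ n′-large ⟩
      n′ ∎) ⟩
    n′ / suc K ∎
    where
    exponent : ∀ e x → suc (suc (2 * e + x + 2 * e)) ≡ 4 * e + x + 2
    exponent = solve-∀

  s[1+K]≤n′ : s * suc K ≤ n′
  s[1+K]≤n′ = m/n*n≤m n′ (suc K)

  fits : ∀ i → i < X → K * (t₀ + i) + M ≤ n′
  fits i i<X = begin
    K * (suc s + i) + M ≡⟨ shuffle K s i M ⟩
    K * s + (K * suc i + M) ≤⟨ +-monoʳ-≤ (K * s) (≤-trans (+-monoˡ-≤ M (*-monoʳ-≤ K i<X)) KX+M≤s) ⟩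
    K * s + s ≡⟨ trans (+-comm (K * s) s) (*-comm (suc K) s) ⟩
    s * suc K ≤⟨ s[1+K]≤n′ ⟩
    n′ ∎
    where
    shuffle : ∀ K s i M → K * (suc s + i) + M ≡ K * s + (K * suc i + M)
    shuffle = solve-∀

  n′< : ∀ i → n′ < K * (t₀ + i) + (t₀ + i)
  n′< i = begin-strict
    n′ ≡⟨ m≡m%n+[m/n]*n n′ (suc K) ⟩
    n′ % suc K + s * suc K <⟨ +-monoˡ-< (s * suc K) (m%n<n n′ (suc K)) ⟩
    suc K + s * suc K ≤⟨ m≤m+n _ (i * suc K) ⟩
    suc K + s * suc K + i * suc K ≡⟨ shuffle K s i ⟩
    K * (suc s + i) + (suc s + i) ∎
    where
    shuffle : ∀ K s i → suc K + s * suc K + i * suc K ≡ K * (suc s + i) + (suc s + i)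
    shuffle = solve-∀

  2<k : 2 < k
  2<k = ≤-trans (m≤m+n 3 r) 3+r≤k

  module SP = SieveProblem e₀ a₀≤e₀ k pk 2<k n′ (n∣m*n (n / 2)) t₀ X

  X-large : 28 * constant * 2 ^ (SP.n + budget (Exponents.e e₀ a₀≤e₀) SP.n 0) < 3 * X
  X-large = begin-strict
    28 * constant * 2 ^ nb ≤⟨ *-monoˡ-≤ (2 ^ nb) (*-mono-≤ (≤ᵇ⇒≤ 28 (2 ^ 5) tt) (<⇒≤ (n<2^n constant))) ⟩
    2 ^ 5 * 2 ^ constant * 2 ^ nb
      ≡⟨ trans (cong (_* 2 ^ nb) (sym (^-distribˡ-+-* 2 5 constant))) (sym (^-distribˡ-+-* 2 (5 + constant) nb)) ⟩
    2 ^ (5 + constant + nb) ≤⟨ ^-monoʳ-≤ 2 exponents ⟩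
    X <⟨ m<m*n X 3 {{m^n≢0 2 x}} (s≤s (s≤s z≤n)) ⟩
    X * 3 ≡⟨ *-comm X 3 ⟩
    3 * X ∎
    where
    nb : ℕ
    nb = SP.n + budget (Exponents.e e₀ a₀≤e₀) SP.n 0
    exponents : 5 + constant + nb ≤ x
    exponents = *-cancelˡ-≤ 100 (+-cancelʳ-≤ 300 _ _ (begin
      100 * (5 + constant + nb) + 300 ≡⟨ shuffle₁ constant nb ⟩
      100 * nb + (800 + 100 * constant) ≤⟨ +-monoˡ-≤ (800 + 100 * constant) SP.sifting-exponent ⟩
      853 * e₀ + (1000 + 200 * a₀) + (800 + 100 * constant) ≡⟨ shuffle₂ (853 * e₀) (1000 + 200 * a₀) (800 + 100 * constant) ⟩
      853 * e₀ + (800 + 100 * constant + (1000 + 200 * a₀)) ≤⟨ +-monoʳ-≤ (853 * e₀) constants≤e₀ ⟩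
      853 * e₀ + e₀ ≡⟨ +-comm (853 * e₀) e₀ ⟩
      854 * e₀ ≤⟨ 854e₀≤ ⟩
      100 * x + 300 ∎))
      where
      shuffle₁ : ∀ c b → 100 * (5 + c + b) + 300 ≡ 100 * b + (800 + 100 * c)
      shuffle₁ = solve-∀
      shuffle₂ : ∀ a b c → a + b + c ≡ a + (c + b)
      shuffle₂ = solve-∀

  private
    sift : ∃ λ i → i < X × (∀ m → Prime m → m < k → m ∤ t₀ + i × m ∤ SP.form m i)
    sift = SP.sifted (<⇒≤ k<2^e₀) X-large

  t N : ℕ
  t = t₀ + proj₁ sift
  N = n′ ∸ K * t

  Kt+M≤n′ : K * t + M ≤ n′
  Kt+M≤n′ = fits (proj₁ sift) (proj₁ (proj₂ sift))

  Kt+N : K * t + N ≡ n′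
  Kt+N = m+[n∸m]≡n (≤-trans (m≤m+n (K * t) M) Kt+M≤n′)

  M≤N : M ≤ N
  M≤N = +-cancelˡ-≤ (K * t) _ _ (≤-trans Kt+M≤n′ (≤-reflexive (sym Kt+N)))

  N<t : N + 1 ≤ t
  N<t = ≤-trans (≤-reflexive (+-comm N 1)) (+-cancelˡ-< (K * t) _ _ (≤-<-trans (≤-reflexive Kt+N) (n′< (proj₁ sift))))

  clean : ∀ p → Prime p → p < k → p ∤ t × p ∤ N
  clean p pp p<k = proj₁ (proj₂ (proj₂ sift) p pp p<k) , λ p∣N → proj₂ (proj₂ (proj₂ sift) p pp p<k)
      (subst (p ∣_) (sym form≡) (∣m∣n⇒∣m+n p∣N (m∣m*n (K * t))))
    where
    form≡ : SP.form p (proj₁ sift) ≡ N + p * (K * t)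
    form≡ = trans (cong (_+ (p ∸ 1) * (K * t)) (sym Kt+N)) (trans (shuffle (K * t) N (p ∸ 1)) (cong (λ z → N + z * (K * t)) (m+[n∸m]≡n (<⇒≤ (prime>1 pp)))))
      where
      shuffle : ∀ a N p → a + N + p * a ≡ N + (1 + p) * a
      shuffle = solve-∀

  k≤M : k ≤ M
  k≤M = ≤-trans (<⇒≤ k<2^e₀) (^-monoʳ-≤ 2 (m≤m+n e₀ _))

  r<k : r < k
  r<k = ≤-trans (s≤s (m≤n+m r 2)) 3+r≤k

  r*2K≤N : r * (2 * (k * k)) ≤ N
  r*2K≤N = begin
    r * (2 * (k * k)) ≡⟨ sym (*-assoc r 2 (k * k)) ⟩
    r * 2 * (k * k) ≤⟨ *-mono-≤ (≤-trans r*2≤k (<⇒≤ k<2^e₀)) (<⇒≤ 1+K≤) ⟩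
    2 ^ e₀ * 2 ^ (2 * e₀) ≡⟨ sym (^-distribˡ-+-* 2 e₀ (2 * e₀)) ⟩
    M ≤⟨ M≤N ⟩
    N ∎

  code : Code (Fin n) r
  code = subst (λ m → Code (Fin m) r) size (codeFor pk 3+r≤k r*2≤k clean (s≤s z≤n) (≤-trans (m^n>0 2 (3 * e₀)) M≤N)
      (<-≤-trans r<k (≤-trans k≤M M≤N)) r*2K≤N N<t δ δ≤1)
    where
    size : k * k * t + (N + δ) ≡ n
    size = trans (sym (+-assoc (K * t) N δ)) (trans (cong (_+ δ) Kt+N) (sym n≡))

  2≤n : 2 ≤ n
  2≤n = ≤-trans (≤-trans (<⇒≤ 2<k) (≤-trans k≤M M≤N)) (≤-trans (m∸n≤m n′ (K * t)) (≤-trans (m≤m+n n′ δ) (≤-reflexive (sym n≡))))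

-- The bound r ≥ n^0.0797 is raised to the power 10000 to stay within the integers.
theorem4p3 : Σ ℕ λ n₀ → (n : ℕ) → n₀ ≤ n →
    Σ ℕ λ r → (n ^ 797 ≤ r ^ 10000) × Σ (List (Permutation′ n)) λ C → IsRIPC r n C
-- The 13 is 12.54 rounded up, so that e₀ = 100 lg n / 1254 is at least D.
theorem4p3 = 2 ^ (13 * D) , λ n n₀≤n → r n n₀≤n , power-bound n n₀≤n , code⇒IPC (2≤n n n₀≤n) (code n n₀≤n)
  where
  exponent : ∀ n → 2 ^ (13 * D) ≤ n → D ≤ 100 * lg n / 1254
  exponent n n₀≤n = begin
    D ≡⟨ sym (m*n/n≡m D 1254) ⟩
    D * 1254 / 1254 ≤⟨ /-monoˡ-≤ 1254 (begin
      D * 1254 ≤⟨ *-monoʳ-≤ D (≤ᵇ⇒≤ 1254 1300 tt) ⟩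
      D * 1300 ≡⟨ trans (*-comm D 1300) (*-assoc 100 13 D) ⟩
      100 * (13 * D) ≤⟨ *-monoʳ-≤ 100 (lg-≥ {13 * D} n₀≤n) ⟩
      100 * lg n ∎) ⟩
    100 * lg n / 1254 ∎
    where open ≤-Reasoning
  open module Chosen (n : ℕ) (n₀≤n : 2 ^ (13 * D) ≤ n) = Parameters n (lg n) (100 * lg n / 1254)
    (lg-lower n (≤-trans (2^-positive (13 * D)) n₀≤n)) (lg-upper n) (exponent n n₀≤n) (m/n*n≤m (100 * lg n) 1254)
    (≤-trans (≤-reflexive (trans (m≡m%n+[m/n]*n (100 * lg n) 1254) (+-comm _ (100 * lg n / 1254 * 1254))))
      (+-monoʳ-≤ (100 * lg n / 1254 * 1254) (<⇒≤ (m%n<n (100 * lg n) 1254))))
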